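{- Let $m,n\geq 3$ and $0\leq k\leq \min\{m,n\}$ be integers with $(m,n,k)\notin\{(5,4,4),(4,5,4),(5,5,5)\}$. Let $G_{m,n,k}$ denote the graph obtained from the complete bipartite graph $K_{m,n}$ by deleting the edges of a matching of size $k$. Then the nonorientable genus of $G_{m,n,k}$ is $$\tilde{\gamma}(G_{m,n,k})=\max\Big\{\Big\lceil\frac{(m-2)(n-2)-k}{2}\Big\rceil,\,1\Big\}.$$ In particular, for every $n\geq 6$, $$\tilde{\gamma}(G_{n,n,n})=\Big\lceil\frac{(n-2)(n-2)-n}{2}\Big\rceil=\frac{n^2-5n+4}{2},$$ and for every even $n\geq 6$, $$\tilde{\gamma}(G_{n+1,n,n})=\Big\lceil\frac{(n-1)(n-2)-n}{2}\Big\rceil=\frac{n^2-4n+2}{2}.$$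
   Context: The nonorientable genus $\tilde{\gamma}(G)$ of a graph $G$ is the smallest integer $h\geq 1$ such that $G$ embeds in the nonorientable closed surface $N_h$ (the sphere with $h$ crosscaps). Up to isomorphism $G_{m,n,k}$ does not depend on the choice of the deleted $k$-matching. -}

module Defs where

open import Data.Nat using (ℕ; zero; suc; _+_; _*_; _∸_; _≤_; _<_; _≡ᵇ_; _<ᵇ_; _⊔_; ⌈_/2⌉)
open import Data.Fin using (Fin; toℕ)
open import Data.Bool using (Bool; true; false; T; _∧_; _∨_; not; _xor_; if_then_else_)
open import Data.Bool.Properties using (∨-comm)
open import Data.Product using (Σ; ∃; ∃-syntax; _×_; _,_; proj₁; proj₂)
open import Data.Sum using (_⊎_)
open import Relation.Binary.PropositionalEquality using (_≡_; subst)
open import Relation.Nullary using (¬_)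
open import Function.Bundles using (_↔_)

record Graph : Set where
  field
    V       : ℕ
    adj     : Fin V → Fin V → Bool
    adj-sym : ∀ u w → adj u w ≡ adj w u
open Graph public

iter : {A : Set} → (A → A) → ℕ → A → A
iter f zero    x = x
iter f (suc k) x = f (iter f k x)

Card : Set → ℕ → Set
Card A n = A ↔ Fin n

HasOrbits : {S : Set} → (S → S) → ℕ → Set
HasOrbits {S} f c =
  Σ (S → Fin c) λ r →
      (∀ i → ∃[ x ] r x ≡ i)
    × (∀ x y → r x ≡ r y → ∃[ k ] iter f k x ≡ y)
    × (∀ x k → r (iter f k x) ≡ r x)

module _ (G : Graph) where

  Dart : Set
  Dart = Σ (Fin (V G) × Fin (V G)) λ p → T (adj G (proj₁ p) (proj₂ p))

  src tgt : Dart → Fin (V G)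
  src d = proj₁ (proj₁ d)
  tgt d = proj₂ (proj₁ d)

  rev : Dart → Dart
  rev ((u , w) , p) = (w , u) , subst T (adj-sym G u w) p

  -- A general (signed) rotation system, i.e. a combinatorial
  -- 2-cell embedding of G in a closed surface (Mohar–Thomassen):
  -- a cyclic permutation (local rotation) of the darts at each vertex,
  -- and an edge signature (true = twisted edge).
  record RotSys : Set where
    field
      next prev : Dart → Dart
      next-src  : ∀ d → src (next d) ≡ src d
      prev-next : ∀ d → prev (next d) ≡ d
      next-prev : ∀ d → next (prev d) ≡ d
      cyclic    : ∀ d d' → src d ≡ src d' → ∃[ k ] iter next k d ≡ d'
      sign      : Fin (V G) → Fin (V G) → Bool
      sign-sym  : ∀ u w → sign u w ≡ sign w u

  module _ (R : RotSys) where
    open RotSys R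

    -- Face-tracing map on (dart, current direction of rotation).
    -- Each face boundary is traced by exactly two orbits of this map
    -- (its two traversal directions).
    faceStep : Dart × Bool → Dart × Bool
    faceStep (d , dir) =
      let d'   = rev d
          dir' = dir xor sign (src d) (tgt d)
      in (if dir' then next d' else prev d') , dir'

    -- The surface of R is orientable iff the signature is switching
    -- equivalent to the all-untwisted one (every cycle has an even
    -- number of twisted edges).
    Orientable : Set
    Orientable = Σ (Fin (V G) → Bool) λ s → (∀ u w → T (adj G u w) → sign u w ≡ (s u xor s w))

    -- Euler genus g of the surface of R, via Euler's formula
    -- V - E + F = 2 - g, with 2E = #darts and 2F = #face-tracing orbits.
    EulerGenus : ℕ → Set
    EulerGenus g = ∃[ d ] ∃[ c ]
        Card Dart d × HasOrbits faceStep c × (2 * V G + c + 2 * g ≡ 4 + d)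

  -- G embeds in the nonorientable surface N_h (h ≥ 1): either a
  -- nonorientable 2-cell embedding of Euler genus ≤ h, or an orientable
  -- one of Euler genus < h (S_g ⊂ N_{2g+1}).
  EmbedsInN : ℕ → Set
  EmbedsInN h = ∃[ R ] ∃[ g ] EulerGenus R g ×
    ((¬ Orientable R × g ≤ h) ⊎ (Orientable R × g < h))

  NonorientableGenus : ℕ → Set
  NonorientableGenus h =
    1 ≤ h × EmbedsInN h × (∀ h' → 1 ≤ h' → h' < h → ¬ EmbedsInN h')

-- G_{m,n,k}: K_{m,n} minus a matching of size k.
-- Vertices 0..m-1 form side A (a_i = i), vertices m..m+n-1 side B
-- (b_j = m + j); the deleted matching is {a_i b_i : i < k}.

bipAdj : (m k : ℕ) → ℕ → ℕ → Bool
bipAdj m k a b = (a <ᵇ m) ∧ not (b <ᵇ m) ∧ not ((a <ᵇ k) ∧ (a ≡ᵇ (b ∸ m)))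

Gmnk : ℕ → ℕ → ℕ → Graph
Gmnk m n k = record
  { V       = m + n
  ; adj     = λ x y → bipAdj m k (toℕ x) (toℕ y) ∨ bipAdj m k (toℕ y) (toℕ x)
  ; adj-sym = λ x y → ∨-comm (bipAdj m k (toℕ x) (toℕ y)) (bipAdj m k (toℕ y) (toℕ x))
  }

{-# OPTIONS --safe #-}
-- A 2-cell embedding of a bipartite graph is given by the list of its faces: every edge must occur twice
-- among their sides, and at every vertex the corners must link all neighbours.  A quadrangular embedding
-- has the smallest possible Euler genus, since all facial walks have length at least four.
--
-- Replacing a vertex v by three copies with the same rotation keeps an embedding quadrangular: at every
-- corner of v one copy takes over the old quadrilateral and the other two copies bound a new one, and the
-- choices must differ at neighbouring corners, i.e. they 3-colour the corners of v.  This enlarges one side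
-- by two.  If v and s are a deleted pair, tripling both leaves a 3 × 3 block of non-edges, and replacing a few
-- quadrilaterals near a suitable edge inserts six of the nine edges; this enlarges both sides and the matching
-- by two, reproduces the situation around a new deleted pair, and creates a Möbius band.  The quadrangular
-- embeddings needed arise in this way from a few small ones.  If (m - 2)(n - 2) - k is odd, either an edge is deleted
-- from a quadrangular embedding, or (k = 0) the same construction starts from embeddings with one hexagon.

module Submission where

open import Defs
open import Data.Bool using (Bool; true; false; not; _∧_; _∨_; _xor_; if_then_else_; T; T?)
open import Data.Bool.ListAction using (all; any)
open import Data.Bool.Properties using (not-involutive; not-injective; T-irrelevant; xor-assoc; ∧-zeroʳ; ∨-identityʳ) renaming (_≟_ to _≟ᵇ_)
open import Data.Empty using (⊥; ⊥-elim)
open import Data.Fin as Fin using (Fin; zero; suc; toℕ; fromℕ<; _↑ˡ_; _↑ʳ_; splitAt; combine; remQuot)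
open import Data.Fin.Permutation using (↔⇒≡)
import Data.Fin.Properties as Fin
open import Data.Fin.Subset.Properties using (anySubset?)
open import Data.List using (List; []; _∷_; _++_; map; concatMap; length; take; drop; allFin; filterᵇ)
open import Data.List.Membership.Propositional using (_∈_)
import Data.List.Membership.Propositional.Properties as ∈
open import Data.List.Relation.Binary.Permutation.Propositional as Perm using (_↭_)
import Data.List.Relation.Binary.Permutation.Propositional.Properties as Perm
open import Data.List.Relation.Unary.All as All using (All; []; _∷_)
import Data.List.Relation.Unary.All.Properties as All
open import Data.List.Relation.Unary.Any as Any using (Any; here; there)
import Data.List.Relation.Unary.Any.Properties as Any
open import Data.Maybe using (Maybe; just; nothing; is-just)
open import Data.Nat using (ℕ; zero; suc; _+_; _*_; _∸_; _≤_; _<_; _⊔_; _/_; _%_; ⌈_/2⌉; _≤ᵇ_; _<ᵇ_; _≡ᵇ_; z≤n; s≤s; z<s; s≤s⁻¹)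
import Data.Nat.DivMod as ℕ
import Data.Nat.Properties as ℕ
open import Data.Nat.Tactic.RingSolver using (solve-∀)
open import Data.Product using (Σ; ∃-syntax; _×_; _,_; proj₁; proj₂)
open import Data.Sum using (_⊎_; inj₁; inj₂)
import Data.Sum
import Data.Sum.Properties as Sum
open import Data.Unit using (⊤; tt)
open import Data.Vec as Vec using (Vec; []; _∷_; lookup)
open import Data.Vec.Properties using (lookup∘tabulate)
open import Function using (_∘_; id)
open import Function.Bundles using (Inverse; mk↔ₛ′)
open import Function.Construct.Composition using (_↔-∘_)
open import Function.Construct.Symmetry using (↔-sym)
open import Relation.Binary.Construct.Closure.ReflexiveTransitive as Star using (Star; ε; _◅_; _◅◅_)
open import Relation.Binary.PropositionalEquality
open import Relation.Nullary using (¬_; Dec; yes; no; contradiction)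
open import Relation.Nullary.Decidable using (does; map′; dec-true; dec-false; _→-dec_; _×-dec_)

-- Orbits and dihedral actions

-- Euler's formula with mn - k edges and faces of length at least four bounds the Euler genus below
-- by ((m - 2)(n - 2) - k) / 2; the labour lies in attaining this. Face lists are used because both
-- enlargements are then rearrangements of lists, so that rotation systems enter in a single
-- conversion. Different colours at neighbouring corners are exactly what keeps the three copies in
-- one cycle around the common neighbour; with equal colours two of the copies would close up on
-- their own. Three colours suffice for every degree, since a corner has at most two neighbours.
-- Non-orientability is never computed for a large surface: an orientation restricts to any part of
-- the list, so it is enough that every enlargement leaves a few faces whose orientations all clash.
-- Both enlargements preserve the parities of k, p = m - k and q = n - k. A few starts would
-- therefore do, were it not that the smallest graph of some parity patterns is an excluded one or
-- the six-cycle G_{3,3,3}; these patterns need larger starts.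

iter-+ : {A : Set} (f : A → A) (j k : ℕ) (x : A) → iter f (j + k) x ≡ iter f j (iter f k x)
iter-+ f zero    k x = refl
iter-+ f (suc j) k x = cong f (iter-+ f j k x)

iter-comm : {A : Set} (f : A → A) (k : ℕ) (x : A) → iter f k (f x) ≡ f (iter f k x)
iter-comm f zero    x = refl
iter-comm f (suc k) x = cong f (iter-comm f k x)

iter-injective : {A : Set} {f : A → A} → (∀ {x y} → f x ≡ f y → x ≡ y) →
                 ∀ k {x y} → iter f k x ≡ iter f k y → x ≡ y
iter-injective inj zero    eq = eq
iter-injective inj (suc k) eq = iter-injective inj k (inj eq)

-- Pigeonhole makes two of the iterates with exponents 0 to N coincide; injectivity cancels the
-- smaller exponent.
iter-periodic : ∀ {N} {f : Fin N → Fin N} → (∀ {x y} → f x ≡ f y → x ≡ y) →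
                ∀ x → ∃[ p ] iter f (suc p) x ≡ x
iter-periodic {N} {f} inj x
  with Fin.pigeonhole (ℕ.n<1+n N) (λ i → iter f (toℕ i) x)
... | i , j , i<j , eq with ℕ.m≤n⇒∃[o]m+o≡n i<j
... | p , 1+i+p≡j = p , iter-injective inj (toℕ i) (sym (begin
    iter f (toℕ i) x                  ≡⟨ eq ⟩
    iter f (toℕ j) x                  ≡⟨ cong (λ k → iter f k x) (trans (sym 1+i+p≡j) (sym (ℕ.+-suc (toℕ i) p))) ⟩
    iter f (toℕ i + suc p) x          ≡⟨ iter-+ f (toℕ i) (suc p) x ⟩
    iter f (toℕ i) (iter f (suc p) x) ∎))
  where open ≡-Reasoning

module Orbit {N : ℕ} (f : Fin N → Fin N) (f-inj : ∀ {x y} → f x ≡ f y → x ≡ y) where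

  -- Exponents can be kept below the period, which turns membership in an orbit into a finite
  -- search.
  reduce : ∀ x k → ∃[ i ] iter f (toℕ {suc (proj₁ (iter-periodic f-inj x))} i) x ≡ iter f k x
  reduce x zero = Fin.zero , refl
  reduce x (suc k) with reduce x k
  ... | i , eq with suc (toℕ i) ℕ.<? suc (proj₁ (iter-periodic f-inj x))
  ... | yes lt = fromℕ< lt , trans (cong (λ j → iter f j x) (Fin.toℕ-fromℕ< lt)) (cong f eq)
  ... | no ¬lt = Fin.zero , trans (sym (proj₂ (iter-periodic f-inj x)))
        (trans (cong (λ j → iter f j x) (ℕ.≤-antisym (ℕ.≮⇒≥ ¬lt) (Fin.toℕ<n i))) (cong f eq))

  orbit? : ∀ x y → Dec (∃[ k ] iter f k x ≡ y)
  orbit? x y = map′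
    (λ (i , eq) → toℕ i , eq)
    (λ (k , eq) → proj₁ (reduce x k) , trans (proj₂ (reduce x k)) eq)
    (Fin.any? (λ i → iter f (toℕ {suc (proj₁ (iter-periodic f-inj x))} i) x Fin.≟ y))

  -- A step of a finite orbit is undone by running through the rest of its period.
  orbit-sym : ∀ {x y} k → iter f k x ≡ y → ∃[ j ] iter f j y ≡ x
  orbit-sym {x} k refl = go k
    where
    step : ∀ z → ∃[ j ] iter f j (f z) ≡ z
    step z with iter-periodic f-inj z
    ... | p , eq = p , trans (iter-comm f p z) eq
    go : ∀ k → ∃[ j ] iter f j (iter f k x) ≡ x
    go zero = zero , refl
    go (suc k) with go k | step (iter f k x)
    ... | j , eq | i , eq' = j + i , trans (iter-+ f j i _) (trans (cong (iter f j) eq') eq)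

complementary : ∀ {P Q : Set} (p : Dec P) (q : Dec Q) → (P → ¬ Q) → (¬ P → Q) → does q ≡ not (does p)
complementary (yes p) q f g = dec-false q (f p)
complementary (no ¬p) q f g = dec-true q (g ¬p)

does-true : ∀ {P : Set} (p : Dec P) → does p ≡ true → P
does-true (yes p) _ = p

-- Where the involutions α and τ have no fixed points and act transitively, the rotations τ ∘ α have exactly
-- two orbits, which both involutions exchange; one of them is singled out by pos.
module Dihedral {N : ℕ} (α τ : Fin N → Fin N)
  (αα : ∀ x → α (α x) ≡ x) (ττ : ∀ x → τ (τ x) ≡ x)
  (α≢ : ∀ x → α x ≢ x) (τ≢ : ∀ x → τ x ≢ x) where

  data Move (x : Fin N) : Fin N → Set where
    byα : Move x (α x)
    byτ : Move x (τ x)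

  ρ : Fin N → Fin N
  ρ x = τ (α x)

  α-inj : ∀ {x y} → α x ≡ α y → x ≡ y
  α-inj {x} {y} eq = trans (sym (αα x)) (trans (cong α eq) (αα y))

  τ-inj : ∀ {x y} → τ x ≡ τ y → x ≡ y
  τ-inj {x} {y} eq = trans (sym (ττ x)) (trans (cong τ eq) (ττ y))

  ρ-inj : ∀ {x y} → ρ x ≡ ρ y → x ≡ y
  ρ-inj eq = α-inj (τ-inj eq)

  open Orbit ρ ρ-inj public

  -- The dihedral relation `τ y` = `ρ (τ (ρ y))` removes two factors `ρ` at a time. What remains are
  -- the exponents 0 and 1, where the claim is the absence of fixed points of `τ` and `α`.
  ρ^k≢τ : ∀ k y → iter ρ k y ≢ τ y
  ρ^k≢τ zero    y eq = τ≢ y (sym eq)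
  ρ^k≢τ (suc zero) y eq = α≢ y (τ-inj eq)
  ρ^k≢τ (suc (suc k)) y eq = ρ^k≢τ k (ρ y) (ρ-inj (begin
      ρ (iter ρ k (ρ y))     ≡⟨ cong ρ (iter-comm ρ k y) ⟩
      iter ρ (suc (suc k)) y ≡⟨ eq ⟩
      τ y                    ≡⟨ cong τ (sym (αα y)) ⟩
      ρ (α y)                ≡⟨ cong ρ (sym (ττ (α y))) ⟩
      ρ (τ (ρ y))            ∎))
    where open ≡-Reasoning

  module _ {C : Set} (cls : Fin N → C) (base : C → Fin N)
    (reach : ∀ x → Star Move (base (cls x)) x)
    (cls-α : ∀ x → cls (α x) ≡ cls x) (cls-τ : ∀ x → cls (τ x) ≡ cls x) where

    private
      InOrbit : Fin N → Set
      InOrbit x = ∃[ k ] iter ρ k (base (cls x)) ≡ x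

      OnSide : C → Fin N → Set
      OnSide c x = ∃[ k ] iter ρ k (base c) ≡ x

      -- The invariant along a walk: `x` or `τ x` lies on the rotation orbit of the base point. By
      -- transitivity there are thus at most two rotation orbits.
      other : ∀ c {x y} → Move x y → OnSide c x ⊎ OnSide c (τ x) → OnSide c y ⊎ OnSide c (τ y)
      other c {x} byτ (inj₁ s) = inj₂ (subst (OnSide c) (sym (ττ x)) s)
      other c {x} byτ (inj₂ s) = inj₁ s
      other c {x} byα (inj₁ (k , eq)) = inj₂ (suc k , cong ρ eq)
      other c {x} byα (inj₂ (k , eq)) with orbit-sym {α x} 1 refl
      ... | j , eq' = inj₁ (j + k , trans (iter-+ ρ j k _) (trans (cong (iter ρ j) (trans eq (cong τ (sym (αα x))))) eq'))

      walk : ∀ c {x y} → Star Move x y → OnSide c x ⊎ OnSide c (τ x) → OnSide c y ⊎ OnSide c (τ y)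
      walk c ε        s = s
      walk c (m ◅ ms) s = walk c ms (other c m s)

      -- Otherwise a power of `ρ` would carry `x` to `τ x`; so the two orbits are disjoint.
      both : ∀ c x → OnSide c x → OnSide c (τ x) → ⊥
      both c x (k , eq) s with orbit-sym k eq
      ... | j , eq' with s
      ... | i , eqi = ρ^k≢τ (i + j) x (trans (iter-+ ρ i j x) (trans (cong (iter ρ i) eq') eqi))

      pos? : ∀ x → Dec (InOrbit x)
      pos? x = orbit? (base (cls x)) x

    pos : Fin N → Bool
    pos x = does (pos? x)

    pos-τ : ∀ x → pos (τ x) ≡ not (pos x)
    pos-τ x = complementary (pos? x) (pos? (τ x))
      (λ s s' → both (cls x) x s (subst (λ c → OnSide c (τ x)) (cls-τ x) s'))
      (λ ¬s → subst (λ c → OnSide c (τ x)) (sym (cls-τ x)) (s' ¬s))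
      where
      s' : ¬ OnSide (cls x) x → OnSide (cls x) (τ x)
      s' ¬s with walk (cls x) (reach x) (inj₁ (0 , refl))
      ... | inj₁ s = contradiction s ¬s
      ... | inj₂ s = s

    pos-α : ∀ x → pos (α x) ≡ not (pos x)
    pos-α x = complementary (pos? x) (pos? (α x))
      (λ (k , eq) s' → both (cls x) (α x) (subst (λ c → OnSide c (α x)) (cls-α x) s') (suc k , cong ρ eq))
      (λ ¬s → subst (λ c → OnSide c (α x)) (sym (cls-α x)) (s'' ¬s))
      where
      s'' : ¬ OnSide (cls x) x → OnSide (cls x) (α x)
      s'' ¬s with other (cls x) byα (walk (cls x) (reach x) (inj₁ (0 , refl)))
      ... | inj₁ s = s
      ... | inj₂ (k , eq) with orbit-sym {x} 1 refl
      ...   | j , eq' = contradiction (j + k , trans (iter-+ ρ j k _) (trans (cong (iter ρ j) eq) eq')) ¬s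

    pos-cyclic : ∀ x y → cls x ≡ cls y → pos x ≡ true → pos y ≡ true → ∃[ k ] iter ρ k x ≡ y
    pos-cyclic x y eq px py with does-true (pos? x) px | does-true (pos? y) py
    ... | k , e | l , e' with orbit-sym k e
    ...   | j , e'' = l + j , trans (iter-+ ρ l j x) (trans (cong (iter ρ l) (trans e'' (cong base eq))) e')

-- Face lists

record Eq (A : Set) : Set where
  field _≟_ : (x y : A) → Dec (x ≡ y)
open Eq {{...}} public

instance
  eqFin : ∀ {n} → Eq (Fin n)
  eqFin = record { _≟_ = Fin._≟_ }

  eq⊎ : ∀ {A B} → {{Eq A}} → {{Eq B}} → Eq (A ⊎ B)
  eq⊎ = record { _≟_ = Sum.≡-dec _≟_ _≟_ }

-- Number-valued, so that counts of sides become polynomials in values of `δ` and the effect of a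
-- surgery is an identity for the ring solver.
δ : {A : Set} → {{Eq A}} → A → A → ℕ
δ x y = if does (x ≟ y) then 1 else 0

module _ {A : Set} {{_ : Eq A}} where

  δ-refl : (x : A) → δ x x ≡ 1
  δ-refl x = cong (if_then 1 else 0) (dec-true (x ≟ x) refl)

  δ-≢ : {x y : A} → x ≢ y → δ x y ≡ 0
  δ-≢ {x} {y} ne = cong (if_then 1 else 0) (dec-false (x ≟ y) ne)

  δ-pos : {x y : A} → 0 < δ x y → x ≡ y
  δ-pos {x} {y} lt with x ≟ y
  ... | yes eq = eq

module _ {A : Set} {{_ : Eq A}} where

  δ-cong : {C : Set} {{_ : Eq C}} (f : A → C) → (∀ {x y} → f x ≡ f y → x ≡ y) → ∀ x y → δ (f x) (f y) ≡ δ x y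
  δ-cong f inj x y with x ≟ y
  ... | yes refl = δ-refl (f x)
  ... | no ne = δ-≢ λ eq → ne (inj eq)

  -- Identifying vertices can only raise a count. This lets finite checks on names be transferred to
  -- vertices that may coincide.
  δ-≤ : {C : Set} {{_ : Eq C}} (f : A → C) → ∀ x y → δ x y ≤ δ (f x) (f y)
  δ-≤ f x y with x ≟ y
  ... | yes refl = ℕ.≤-reflexive (sym (δ-refl (f x)))
  ... | no ne = z≤n

halve : ∀ {e} → 0 < e + e → 0 < e
halve {suc e} _ = z<s

data Face (A B : Set) : Set where
  quad : (a : A) (b : B) (c : A) (d : B) → Face A B
  hexa : (a : A) (b : B) (c : A) (d : B) (e : A) (f : B) → Face A B

private variable A B A′ B′ : Set

-- The walk is read backwards from its second vertex. Exchanging the sides and reversing the walk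
-- cancel, so that `up` and `down` keep their meaning.
flip : Face A B → Face B A
flip (quad a b c d)     = quad b a d c
flip (hexa a b c d e f) = hexa b a f e d c

flip-flip : (f : Face A B) → flip (flip f) ≡ f
flip-flip (quad a b c d)     = refl
flip-flip (hexa a b c d e f) = refl

mapF : (A → A′) → (B → B′) → Face A B → Face A′ B′
mapF g h (quad a b c d)     = quad (g a) (h b) (g c) (h d)
mapF g h (hexa a b c d e f) = hexa (g a) (h b) (g c) (h d) (g e) (h f)

-- Corner f a b b′: the boundary walk of f contains b, a, b′ in one of the two directions.
data Corner {A B : Set} : Face A B → A → B → B → Set where
  q₁ : ∀ {a b c d} → Corner (quad a b c d) a b d
  q₂ : ∀ {a b c d} → Corner (quad a b c d) a d b
  q₃ : ∀ {a b c d} → Corner (quad a b c d) c b d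
  q₄ : ∀ {a b c d} → Corner (quad a b c d) c d b
  h₁ : ∀ {a b c d e f} → Corner (hexa a b c d e f) a b f
  h₂ : ∀ {a b c d e f} → Corner (hexa a b c d e f) a f b
  h₃ : ∀ {a b c d e f} → Corner (hexa a b c d e f) c b d
  h₄ : ∀ {a b c d e f} → Corner (hexa a b c d e f) c d b
  h₅ : ∀ {a b c d e f} → Corner (hexa a b c d e f) e d f
  h₆ : ∀ {a b c d e f} → Corner (hexa a b c d e f) e f d

Corner-sym : ∀ {f : Face A B} {a b b′} → Corner f a b b′ → Corner f a b′ b
Corner-sym q₁ = q₂
Corner-sym q₂ = q₁
Corner-sym q₃ = q₄
Corner-sym q₄ = q₃
Corner-sym h₁ = h₂
Corner-sym h₂ = h₁
Corner-sym h₃ = h₄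
Corner-sym h₄ = h₃
Corner-sym h₅ = h₆
Corner-sym h₆ = h₅

Corner-map : ∀ (g : A → A′) (h : B → B′) {f a b b′} → Corner f a b b′ → Corner (mapF g h f) (g a) (h b) (h b′)
Corner-map g h q₁ = q₁
Corner-map g h q₂ = q₂
Corner-map g h q₃ = q₃
Corner-map g h q₄ = q₄
Corner-map g h h₁ = h₁
Corner-map g h h₂ = h₂
Corner-map g h h₃ = h₃
Corner-map g h h₄ = h₄
Corner-map g h h₅ = h₅
Corner-map g h h₆ = h₆

flip-map : ∀ (g : A → A′) (h : B → B′) f → flip (mapF g h f) ≡ mapF h g (flip f)
flip-map g h (quad a b c d)     = refl
flip-map g h (hexa a b c d e f) = refl

-- These are the edges of the link of `a`; its connectedness says that the faces at `a` form one
-- disc and not several discs pinched together.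
Link : List (Face A B) → A → B → B → Set
Link L a b b′ = Any (λ f → Corner f a b b′) L

Colink : List (Face A B) → B → A → A → Set
Colink L b a a′ = Any (λ f → Corner (flip f) b a a′) L

Link-sym : ∀ {L : List (Face A B)} {a b b′} → Link L a b b′ → Link L a b′ b
Link-sym = Any.map Corner-sym

Colink-sym : ∀ {L : List (Face A B)} {b a a′} → Colink L b a a′ → Colink L b a′ a
Colink-sym = Any.map Corner-sym

module _ {A B : Set} {{_ : Eq A}} {{_ : Eq B}} where

  -- The sides of a face traversed from A to B, resp. from B to A, when the face is traversed as written.
  up down : Face A B → A → B → ℕ
  up   (quad a b c d)     x y = δ x a * δ y b + δ x c * δ y d
  up   (hexa a b c d e f) x y = δ x a * δ y b + (δ x c * δ y d + δ x e * δ y f)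
  down (quad a b c d)     x y = δ x c * δ y b + δ x a * δ y d
  down (hexa a b c d e f) x y = δ x c * δ y b + (δ x e * δ y d + δ x a * δ y f)

  dir : Bool → Face A B → A → B → ℕ
  dir true  = up
  dir false = down

  cnt : List (Face A B) → A → B → ℕ
  cnt []      x y = 0
  cnt (f ∷ L) x y = (up f x y + down f x y) + cnt L x y

  -- The value `true` marks a face that is traversed against the way it is written.
  Orientation : List (Face A B) → Set
  Orientation = All (λ _ → Bool)

  dirs : ∀ {L} → Orientation L → Bool → A → B → ℕ
  dirs []                d x y = 0
  dirs (_∷_ {x = f} o os) d x y = dir (o xor d) f x y + dirs os d x y

  -- When an edge has exactly two sides, the bound 1 for either direction forces them to be
  -- traversed oppositely. Stated as an inequality, the property passes to sublists.
  Coherent : List (Face A B) → Set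
  Coherent L = Σ (Orientation L) λ o → ∀ d x y → dirs o d x y ≤ 1

  -- Only connectedness is asked of the links: for edges of multiplicity one `count` gives every
  -- vertex of a link degree two, so a connected link is a single cycle.
  record Cert (E : A → B → ℕ) (L : List (Face A B)) : Set where
    field
      count  : ∀ x y → cnt L x y ≡ E x y + E x y
      link   : ∀ a b b′ → 0 < E a b → 0 < E a b′ → Star (Link L a) b b′
      colink : ∀ b a a′ → 0 < E a b → 0 < E a′ b → Star (Colink L b) a a′

  cnt-++ : ∀ L L′ x y → cnt (L ++ L′) x y ≡ cnt L x y + cnt L′ x y
  cnt-++ []      L′ x y = refl
  cnt-++ (f ∷ L) L′ x y = trans (cong (up f x y + down f x y +_) (cnt-++ L L′ x y)) (sym (ℕ.+-assoc (up f x y + down f x y) _ _))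

  data _~_ : Face A B → Face A B → Set where
    same  : ∀ {f} → f ~ f
    swapA : ∀ {a b c d} → quad a b c d ~ quad c b a d
    swapB : ∀ {a b c d} → quad a b c d ~ quad a d c b

  data _≼_ : List (Face A B) → List (Face A B) → Set where
    []    : [] ≼ []
    _∷_   : ∀ {f g L M} → f ~ g → L ≼ M → (f ∷ L) ≼ (g ∷ M)
    swap  : ∀ {f g L} → (f ∷ g ∷ L) ≼ (g ∷ f ∷ L)
    join  : ∀ {L M N} → L ≼ M → M ≼ N → L ≼ N

  ≼-refl : ∀ {L} → L ≼ L
  ≼-refl {[]}    = []
  ≼-refl {f ∷ L} = same ∷ ≼-refl

  ↭⇒≼ : ∀ {L M} → L ↭ M → L ≼ M
  ↭⇒≼ Perm.refl         = ≼-refl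
  ↭⇒≼ (Perm.prep f p)   = same ∷ ↭⇒≼ p
  ↭⇒≼ (Perm.swap f g p) = join swap (same ∷ (same ∷ ↭⇒≼ p))
  ↭⇒≼ (Perm.trans p q)  = join (↭⇒≼ p) (↭⇒≼ q)

  ≼-++ : ∀ K {L M} → L ≼ M → (K ++ L) ≼ (K ++ M)
  ≼-++ []      p = p
  ≼-++ (f ∷ K) p = same ∷ ≼-++ K p

  up+down : ∀ a b c d x y → up (quad a b c d) x y + down (quad a b c d) x y ≡ (δ x a + δ x c) * (δ y b + δ y d)
  up+down a b c d x y = lemma (δ x a) (δ x c) (δ y b) (δ y d)
    where
    lemma : ∀ p r q s → (p * q + r * s) + (r * q + p * s) ≡ (p + r) * (q + s)
    lemma = solve-∀

  -- Either exchange of opposite corners reads the boundary backwards, whence the value `true`.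
  ~-dir : ∀ {f g} → f ~ g → ∃[ s ] (∀ d x y → dir d g x y ≡ dir (s xor d) f x y)
  ~-dir same  = false , λ d x y → refl
  ~-dir (swapA {a} {b} {c} {d}) = true , λ where true x y → refl ; false x y → refl
  ~-dir (swapB {a} {b} {c} {d}) = true , λ where
    true  x y → ℕ.+-comm (δ x a * δ y d) _
    false x y → ℕ.+-comm (δ x c * δ y d) _

  ~-cnt : ∀ {f g} → f ~ g → ∀ x y → up f x y + down f x y ≡ up g x y + down g x y
  ~-cnt {f} {g} r x y with ~-dir r
  ... | false , eq = sym (cong₂ _+_ (eq true x y) (eq false x y))
  ... | true  , eq = sym (trans (cong₂ _+_ (eq true x y) (eq false x y)) (ℕ.+-comm (down f x y) _))

  ~-Corner : ∀ {f g} → f ~ g → ∀ {a b b′} → Corner f a b b′ → Corner g a b b′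
  ~-Corner same  c  = c
  ~-Corner swapA q₁ = q₃
  ~-Corner swapA q₂ = q₄
  ~-Corner swapA q₃ = q₁
  ~-Corner swapA q₄ = q₂
  ~-Corner swapB q₁ = q₂
  ~-Corner swapB q₂ = q₁
  ~-Corner swapB q₃ = q₄
  ~-Corner swapB q₄ = q₃

  ~-Cocorner : ∀ {f g} → f ~ g → ∀ {b a a′} → Corner (flip f) b a a′ → Corner (flip g) b a a′
  ~-Cocorner same  c  = c
  ~-Cocorner swapB q₁ = q₃
  ~-Cocorner swapB q₂ = q₄
  ~-Cocorner swapB q₃ = q₁
  ~-Cocorner swapB q₄ = q₂
  ~-Cocorner swapA q₁ = q₂
  ~-Cocorner swapA q₂ = q₁
  ~-Cocorner swapA q₃ = q₄
  ~-Cocorner swapA q₄ = q₃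

  ≼-cnt : ∀ {L M} → L ≼ M → ∀ x y → cnt L x y ≡ cnt M x y
  ≼-cnt []          x y = refl
  ≼-cnt (r ∷ p)     x y = cong₂ _+_ (~-cnt r x y) (≼-cnt p x y)
  ≼-cnt (swap {f} {g} {L}) x y = lemma (up f x y + down f x y) (up g x y + down g x y) (cnt L x y)
    where
    lemma : ∀ p q r → p + (q + r) ≡ q + (p + r)
    lemma = solve-∀
  ≼-cnt (join p q) x y = trans (≼-cnt p x y) (≼-cnt q x y)

  ≼-Link : ∀ {L M} → L ≼ M → ∀ {a b b′} → Link L a b b′ → Link M a b b′
  ≼-Link (r ∷ p) (here c)           = here (~-Corner r c)
  ≼-Link (r ∷ p) (there l)          = there (≼-Link p l)
  ≼-Link swap    (here c)           = there (here c)
  ≼-Link swap    (there (here c))   = here c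
  ≼-Link swap    (there (there l))  = there (there l)
  ≼-Link (join p q) l              = ≼-Link q (≼-Link p l)

  ≼-Colink : ∀ {L M} → L ≼ M → ∀ {a b b′} → Colink L a b b′ → Colink M a b b′
  ≼-Colink (r ∷ p) (here c)           = here (~-Cocorner r c)
  ≼-Colink (r ∷ p) (there l)          = there (≼-Colink p l)
  ≼-Colink swap    (here c)           = there (here c)
  ≼-Colink swap    (there (here c))   = here c
  ≼-Colink swap    (there (there l))  = there (there l)
  ≼-Colink (join p q) l              = ≼-Colink q (≼-Colink p l)

  ≼-Orientation : ∀ {L M} → L ≼ M → (o : Orientation M) →
                  Σ (Orientation L) λ o′ → ∀ d x y → dirs o′ d x y ≡ dirs o d x y
  ≼-Orientation []      [] = [] , λ d x y → refl
  ≼-Orientation (_∷_ {f} {g} r p) (o ∷ os) with ~-dir r | ≼-Orientation p os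
  ... | s , eq | os′ , eq′ = (s xor o) ∷ os′ , λ d x y →
        cong₂ _+_ (trans (cong (λ t → dir t f x y) (xor-assoc s o d)) (sym (eq (o xor d) x y))) (eq′ d x y)
  ≼-Orientation swap (o ∷ o′ ∷ os) = o′ ∷ o ∷ os , λ d x y → lemma (dir (o′ xor d) _ x y) (dir (o xor d) _ x y) (dirs os d x y)
    where
    lemma : ∀ p q r → p + (q + r) ≡ q + (p + r)
    lemma = solve-∀
  ≼-Orientation (join p q) o with ≼-Orientation q o
  ... | o′ , eq with ≼-Orientation p o′
  ... | o″ , eq′ = o″ , λ d x y → trans (eq′ d x y) (eq d x y)

  ≼-Coherent : ∀ {L M} → L ≼ M → Coherent M → Coherent L
  ≼-Coherent p (o , h) with ≼-Orientation p o
  ... | o′ , eq = o′ , λ d x y → subst (_≤ 1) (sym (eq d x y)) (h d x y)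

  ≼-Cert : ∀ {E L M} → L ≼ M → Cert E L → Cert E M
  ≼-Cert p C = record
    { count  = λ x y → trans (sym (≼-cnt p x y)) (count x y)
    ; link   = λ a b b′ e e′ → Star.map (≼-Link p) (link a b b′ e e′)
    ; colink = λ b a a′ e e′ → Star.map (≼-Colink p) (colink b a a′ e e′)
    }
    where open Cert C

  Cert-cong : ∀ {E E′ : A → B → ℕ} {L} → (∀ x y → E x y ≡ E′ x y) → Cert E L → Cert E′ L
  Cert-cong eq C = record
    { count  = λ x y → trans (count x y) (cong (λ e → e + e) (eq x y))
    ; link   = λ a b b′ e e′ → link a b b′ (subst (0 <_) (sym (eq a b)) e) (subst (0 <_) (sym (eq a b′)) e′)
    ; colink = λ b a a′ e e′ → colink b a a′ (subst (0 <_) (sym (eq a b)) e) (subst (0 <_) (sym (eq a′ b)) e′)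
    }
    where open Cert C

module _ {A B : Set} {{_ : Eq A}} {{_ : Eq B}} where

  flip-up : (f : Face A B) → ∀ x y → up (flip f) y x ≡ up f x y
  flip-up (quad a b c d) x y = cong₂ _+_ (ℕ.*-comm (δ y b) _) (ℕ.*-comm (δ y d) _)
  flip-up (hexa a b c d e f) x y = trans
    (cong₂ _+_ (ℕ.*-comm (δ y b) _) (cong₂ _+_ (ℕ.*-comm (δ y f) _) (ℕ.*-comm (δ y d) _)))
    (cong (δ x a * δ y b +_) (ℕ.+-comm (δ x e * δ y f) _))

  flip-down : (f : Face A B) → ∀ x y → down (flip f) y x ≡ down f x y
  flip-down (quad a b c d) x y = trans (cong₂ _+_ (ℕ.*-comm (δ y d) _) (ℕ.*-comm (δ y b) _)) (ℕ.+-comm (δ x a * δ y d) _)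
  flip-down (hexa a b c d e f) x y = lemma (δ x a) (δ x c) (δ x e) (δ y b) (δ y d) (δ y f)
    where
    lemma : ∀ a c e b d f → f * a + (d * e + b * c) ≡ c * b + (e * d + a * f)
    lemma = solve-∀

  flip-dir : (f : Face A B) → ∀ d x y → dir d (flip f) y x ≡ dir d f x y
  flip-dir f true  = flip-up f
  flip-dir f false = flip-down f

  flip-cnt : (L : List (Face A B)) → ∀ x y → cnt (map flip L) y x ≡ cnt L x y
  flip-cnt []      x y = refl
  flip-cnt (f ∷ L) x y = cong₂ _+_ (cong₂ _+_ (flip-up f x y) (flip-down f x y)) (flip-cnt L x y)

  flip-Cert : ∀ {E : A → B → ℕ} {L} → Cert E L → Cert (λ y x → E x y) (map flip L)
  flip-Cert {E} {L} C = record
    { count  = λ y x → trans (flip-cnt L x y) (count x y)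
    ; link   = λ b a a′ e e′ → Star.map Any.map⁺ (colink b a a′ e e′)
    ; colink = λ a b b′ e e′ → Star.map (λ l → Any.map⁺ (Any.map (subst (λ f → Corner f a _ _) (sym (flip-flip _))) l)) (link a b b′ e e′)
    }
    where open Cert C

  flip-Coherent : {L : List (Face A B)} → Coherent (map flip L) → Coherent L
  flip-Coherent {L} (o , h) with go L o
    where
    go : ∀ L (o : Orientation (map flip L)) → Σ (Orientation L) λ o′ → ∀ d x y → dirs o′ d x y ≡ dirs o d y x
    go [] [] = [] , λ d x y → refl
    go (f ∷ L) (o ∷ os) with go L os
    ... | os′ , eq = o ∷ os′ , λ d x y → cong₂ _+_ (sym (flip-dir f (o xor d) x y)) (eq d x y)
  ... | o′ , eq = o′ , λ d x y → subst (_≤ 1) (sym (eq d x y)) (h d y x)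

-- Tripling a vertex

pattern #0 = zero
pattern #1 = suc zero
pattern #2 = suc (suc zero)

module _ {A B : Set} where

  -- The predicates constrain hexagons only: with empty predicates there are none, and with `Free`
  -- they stay away from the vertex to be tripled.
  Simple : (A → Set) → (B → Set) → Face A B → Set
  Simple PA PB (quad a b c d)     = a ≢ c × b ≢ d
  Simple PA PB (hexa a b c d e f) = (PA a × PA c × PA e) × (PB b × PB d × PB f)

  Avoids : A → Face A B → Set
  Avoids v (quad a b c d)     = a ≢ v × c ≢ v
  Avoids v (hexa a b c d e f) = a ≢ v × c ≢ v × e ≢ v

  Avoids-Corner : ∀ {v f b d} → Avoids v f → ¬ Corner f v b d
  Avoids-Corner (p , q) q₁ = p refl
  Avoids-Corner (p , q) q₂ = p refl
  Avoids-Corner (p , q) q₃ = q refl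
  Avoids-Corner (p , q) q₄ = q refl
  Avoids-Corner (p , q , r) h₁ = p refl
  Avoids-Corner (p , q , r) h₂ = p refl
  Avoids-Corner (p , q , r) h₃ = q refl
  Avoids-Corner (p , q , r) h₄ = q refl
  Avoids-Corner (p , q , r) h₅ = r refl
  Avoids-Corner (p , q , r) h₆ = r refl

  Avoids-Cocorner : ∀ {v f b a a′} → Avoids v f → Corner (flip f) b a a′ → a ≢ v × a′ ≢ v
  Avoids-Cocorner {f = quad a b c d} (p , q) q₁ = p , q
  Avoids-Cocorner {f = quad a b c d} (p , q) q₂ = q , p
  Avoids-Cocorner {f = quad a b c d} (p , q) q₃ = p , q
  Avoids-Cocorner {f = quad a b c d} (p , q) q₄ = q , p
  Avoids-Cocorner {f = hexa a b c d e f} (p , q , r) h₁ = p , q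
  Avoids-Cocorner {f = hexa a b c d e f} (p , q , r) h₂ = q , p
  Avoids-Cocorner {f = hexa a b c d e f} (p , q , r) h₃ = p , r
  Avoids-Cocorner {f = hexa a b c d e f} (p , q , r) h₄ = r , p
  Avoids-Cocorner {f = hexa a b c d e f} (p , q , r) h₅ = r , q
  Avoids-Cocorner {f = hexa a b c d e f} (p , q , r) h₆ = q , r

  -- A corner (b , u , d) of a vertex v stands for the quadrilateral v b u d.
  Cor : Set
  Cor = B × A × B

  corner : A → Cor → Face A B
  corner v (b , u , d) = quad v b u d

  Proper : A → Cor → Set
  Proper v (b , u , d) = u ≢ v × b ≢ d

Simple-flip : ∀ {A B : Set} {PA : A → Set} {PB : B → Set} f → Simple PA PB f → Simple PB PA (flip f)
Simple-flip (quad a b c d) (p , q) = q , p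
Simple-flip (hexa a b c d e f) ((a₁ , a₂ , a₃) , (b₁ , b₂ , b₃)) = (b₁ , b₃ , b₂) , (a₁ , a₃ , a₂)

module _ {A B : Set} {{_ : Eq A}} {{_ : Eq B}} where

  ~-Simple : ∀ {PA : A → Set} {PB : B → Set} {f g : Face A B} → f ~ g → Simple PA PB f → Simple PA PB g
  ~-Simple same  s       = s
  ~-Simple swapA (p , q) = p ∘ sym , q
  ~-Simple swapB (p , q) = p , q ∘ sym

  ≼-Simple : ∀ {PA : A → Set} {PB : B → Set} {L M : List (Face A B)} → L ≼ M → All (Simple PA PB) L → All (Simple PA PB) M
  ≼-Simple []         []           = []
  ≼-Simple (r ∷ p)    (s ∷ ss)     = ~-Simple r s ∷ ≼-Simple p ss
  ≼-Simple swap       (s ∷ t ∷ ss) = t ∷ s ∷ ss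
  ≼-Simple (join p q) ss           = ≼-Simple q (≼-Simple p ss)

  Avoids-cnt : ∀ v (f : Face A B) → Avoids v f → ∀ y → up f v y + down f v y ≡ 0
  Avoids-cnt v (quad a b c d) (p , q) y
    rewrite δ-≢ (p ∘ sym) | δ-≢ (q ∘ sym) = refl
  Avoids-cnt v (hexa a b c d e f) (p , q , r) y
    rewrite δ-≢ (p ∘ sym) | δ-≢ (q ∘ sym) | δ-≢ (r ∘ sym) = refl

  record Star-at (v : A) (L : List (Face A B)) : Set where
    constructor star-at
    field
      corners : List (Cor {A} {B})
      others  : List (Face A B)
      split   : L ≼ (map (corner v) corners ++ others)
      proper  : All (Proper v) corners
      avoid   : All (Avoids v) others

  -- Hexagons miss `v` by `h`, and a simple quadrilateral meets `v` at most once, so one exchange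
  -- brings `v` to the front.
  star : ∀ v {PA : A → Set} {PB : B → Set} → (∀ {u} → PA u → u ≢ v) → ∀ L → All (Simple PA PB) L → Star-at v L
  star v h [] [] = star-at [] [] [] [] []
  star v h (f ∷ L) (s ∷ ss) with star v h L ss
  star v h (quad a b c d ∷ L) ((p , q) ∷ ss) | star-at Cs Os sp pr av with a ≟ v | c ≟ v
  ... | yes refl | _ = star-at ((b , c , d) ∷ Cs) Os (same ∷ sp) ((p ∘ sym , q) ∷ pr) av
  ... | no a≢v | yes refl = star-at ((b , a , d) ∷ Cs) Os (swapA ∷ sp) ((a≢v , q) ∷ pr) av
  ... | no a≢v | no c≢v = star-at Cs (quad a b c d ∷ Os)
          (join (same ∷ sp) (↭⇒≼ (Perm.↭-sym (Perm.shift _ (map (corner v) Cs) Os)))) pr ((a≢v , c≢v) ∷ av)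
  star v h (hexa a b c d e f ∷ L) (((p , q , r) , _) ∷ ss) | star-at Cs Os sp pr av =
    star-at Cs (hexa a b c d e f ∷ Os)
      (join (same ∷ sp) (↭⇒≼ (Perm.↭-sym (Perm.shift _ (map (corner v) Cs) Os)))) pr ((h p , h q , h r) ∷ av)

  -- This is the degree of `y` in the link of `v`, when the corners are taken as the edges of that
  -- link.
  tot : List (Cor {A} {B}) → B → ℕ
  tot [] y = 0
  tot ((b , u , d) ∷ R) y = (δ y b + δ y d) + tot R y

  cnt-star : ∀ v R O → All (Proper v) R → All (Avoids v) O → ∀ y → cnt (map (corner v) R ++ O) v y ≡ tot R y
  cnt-star v [] [] [] [] y = refl
  cnt-star v [] (f ∷ O) [] (p ∷ ps) y = cong₂ _+_ (Avoids-cnt v f p y) (cnt-star v [] O [] ps y)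
  cnt-star v ((b , u , d) ∷ R) O ((p , q) ∷ ps) av y = cong₂ _+_
    (trans (up+down v b u d v y) (trans (cong₂ (λ s t → (s + t) * (δ y b + δ y d)) (δ-refl v) (δ-≢ (p ∘ sym))) (ℕ.*-identityˡ _)))
    (cnt-star v R O ps av y)

  -- Every corner at v is coloured by the copy of v that keeps it; the other two copies are joined there.
  CCor : Set
  CCor = Cor {A} {B} × Fin 3

  ncol : Fin 3 → List CCor → B → ℕ
  ncol c [] y = 0
  ncol c (((b , u , d) , c′) ∷ S) y = δ c c′ * (δ y b + δ y d) + ncol c S y

  ncol-++ : ∀ c S T y → ncol c (S ++ T) y ≡ ncol c S y + ncol c T y
  ncol-++ c [] T y = refl
  ncol-++ c (((b , u , d) , c′) ∷ S) T y = trans (cong (δ c c′ * (δ y b + δ y d) +_) (ncol-++ c S T y)) (sym (ℕ.+-assoc (δ c c′ * (δ y b + δ y d)) _ _))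

  Σδ : ∀ (c : Fin 3) → (δ #0 c + δ #1 c) + δ #2 c ≡ 1
  Σδ #0 = refl
  Σδ #1 = refl
  Σδ #2 = refl

  ncol-tot : ∀ S y → (ncol #0 S y + ncol #1 S y) + ncol #2 S y ≡ tot (map proj₁ S) y
  ncol-tot [] y = refl
  ncol-tot (((b , u , d) , c) ∷ S) y = trans
    (lemma (δ #0 c) (δ #1 c) (δ #2 c) (δ y b + δ y d) (ncol #0 S y) (ncol #1 S y) (ncol #2 S y))
    (cong₂ _+_ (trans (cong (_* (δ y b + δ y d)) (Σδ c)) (ℕ.*-identityˡ _)) (ncol-tot S y))
    where
    lemma : ∀ p q r t x y z → (p * t + x) + (q * t + y) + (r * t + z) ≡ (p + q + r) * t + (x + y + z)
    lemma = solve-∀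

  -- In other words, two corners that meet at an edge of `v` have different colours.
  Coloured : List CCor → Set
  Coloured S = ∀ c y → ncol c S y ≤ 1

  module _ (f : Fin 3 → ℕ) where
    one-of : (f #0 + f #1) + f #2 ≤ 1 → ∃[ c ] (∀ c′ → c′ ≢ c → f c′ ≡ 0)
    one-of p with f #0 ℕ.≟ 0 | f #1 ℕ.≟ 0
    ... | yes e₀ | yes e₁ = #2 , λ { #0 _ → e₀ ; #1 _ → e₁ ; #2 ne → contradiction refl ne }
    ... | yes e₀ | no n₁ = #1 , λ { #0 _ → e₀ ; #1 ne → contradiction refl ne ; #2 _ → rest }
      where
      rest : f #2 ≡ 0
      rest = ℕ.n<1⇒n≡0 (ℕ.≤-trans (s≤s (ℕ.≤-refl)) (ℕ.≤-trans (ℕ.+-monoˡ-≤ (f #2) (ℕ.≤-trans (ℕ.n≢0⇒n>0 n₁) (ℕ.m≤n+m (f #1) (f #0)))) p))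
    ... | no n₀ | _ = #0 , λ { #0 ne → contradiction refl ne ; #1 _ → ℕ.m+n≡0⇒m≡0 (f #1) rest ; #2 _ → ℕ.m+n≡0⇒n≡0 (f #1) rest }
      where
      rest : f #1 + f #2 ≡ 0
      rest = ℕ.n<1⇒n≡0 (ℕ.≤-trans (ℕ.+-monoˡ-≤ (f #1 + f #2) (ℕ.n≢0⇒n>0 n₀)) (subst (_≤ 1) (ℕ.+-assoc (f #0) _ _) p))

  third : ∀ (c c′ : Fin 3) → ∃[ c″ ] (c″ ≢ c × c″ ≢ c′)
  third #0 #0 = #1 , (λ ()) , (λ ())
  third #0 #1 = #2 , (λ ()) , (λ ())
  third #0 #2 = #1 , (λ ()) , (λ ())
  third #1 #0 = #2 , (λ ()) , (λ ())
  third #1 #1 = #0 , (λ ()) , (λ ())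
  third #1 #2 = #0 , (λ ()) , (λ ())
  third #2 #0 = #1 , (λ ()) , (λ ())
  third #2 #1 = #0 , (λ ()) , (λ ())
  third #2 #2 = #0 , (λ ()) , (λ ())

  free : (f g : Fin 3 → ℕ) → (f #0 + f #1) + f #2 ≤ 1 → (g #0 + g #1) + g #2 ≤ 1 → ∃[ c ] (f c ≡ 0 × g c ≡ 0)
  free f g p q with one-of f p | one-of g q
  ... | c , hf | c′ , hg with third c c′
  ... | c″ , ne , ne′ = c″ , hf c″ ne , hg c″ ne′

  -- Each end of a corner is shared with at most one further corner, so at most two of the three
  -- colours are blocked. `S` is a precoloured part, by which the constructions prescribe colours at
  -- a chosen place.
  greedy : ∀ S R → Coloured S → All (λ (b , u , d) → b ≢ d) R →
           (∀ y → tot R y + tot (map proj₁ S) y ≤ 2) →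
           ∃[ T ] (map proj₁ T ≡ R × Coloured (T ++ S))
  greedy S [] col [] h = [] , refl , col
  greedy S (r@(b , u , d) ∷ R) col (b≢d ∷ ne) h
    with greedy S R col ne (λ y → ℕ.≤-trans (ℕ.+-monoˡ-≤ (tot (map proj₁ S) y) (ℕ.m≤n+m (tot R y) (δ y b + δ y d))) (h y))
  ... | T , refl , col′ with free (λ c → ncol c (T ++ S) b) (λ c → ncol c (T ++ S) d)
                              (room b (subst (1 ≤_) (cong (_+ δ b d) (sym (δ-refl b))) (s≤s z≤n)))
                              (room d (subst (1 ≤_) (cong (δ d b +_) (sym (δ-refl d))) (ℕ.m≤n+m 1 (δ d b))))
    where
    room : ∀ y → 1 ≤ δ y b + δ y d → (ncol #0 (T ++ S) y + ncol #1 (T ++ S) y) + ncol #2 (T ++ S) y ≤ 1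
    -- The corner being coloured takes one of the two places at `y`, which leaves room for at most
    -- one coloured corner there.
    room y one = s≤s⁻¹ (begin
      1 + ((ncol #0 (T ++ S) y + ncol #1 (T ++ S) y) + ncol #2 (T ++ S) y)  ≡⟨ cong suc (ncol-tot (T ++ S) y) ⟩
      1 + tot (map proj₁ (T ++ S)) y                                         ≡⟨ cong (λ z → 1 + z) (tot-++ T S y) ⟩
      1 + (tot R y + tot (map proj₁ S) y)                                    ≤⟨ ℕ.+-monoˡ-≤ _ one ⟩
      (δ y b + δ y d) + (tot R y + tot (map proj₁ S) y)                      ≡⟨ sym (ℕ.+-assoc (δ y b + δ y d) _ _) ⟩
      tot (r ∷ R) y + tot (map proj₁ S) y                                    ≤⟨ h y ⟩
      2 ∎)
      where
      open ℕ.≤-Reasoning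
      tot-++ : ∀ T S y → tot (map proj₁ (T ++ S)) y ≡ tot (map proj₁ T) y + tot (map proj₁ S) y
      tot-++ [] S y = refl
      tot-++ (((b , u , d) , _) ∷ T) S y = trans (cong (δ y b + δ y d +_) (tot-++ T S y)) (sym (ℕ.+-assoc (δ y b + δ y d) _ _))
  ... | c , eb , ed = (r , c) ∷ T , refl , col″
    where
    col″ : Coloured (((r , c) ∷ T) ++ S)
    col″ c′ y with c′ Fin.≟ c | y ≟ b | y ≟ d
    ... | no _     | _        | _        = col′ c′ y
    ... | yes _    | no _     | no _     = col′ c′ y
    ... | yes _    | yes refl | yes refl = contradiction refl b≢d
    ... | yes refl | yes refl | no _     = s≤s (ℕ.≤-reflexive eb)
    ... | yes refl | no _     | yes refl = s≤s (ℕ.≤-reflexive ed)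

o₁ o₂ : Fin 3 → Fin 3
o₁ #0 = #1
o₁ #1 = #0
o₁ #2 = #0
o₂ #0 = #2
o₂ #1 = #2
o₂ #2 = #1

-- The enlarged side enters only through its projection `π`, whose fibre over `v` consists of the
-- copies; so tripling a matched and an unmatched vertex share one proof.
module Duplicate {A A′ B : Set} {{_ : Eq A}} {{_ : Eq A′}} {{_ : Eq B}}
  (v : A) (V : Fin 3 → A′) (ι : A → A′) (π : A′ → A)
  (δ-V : ∀ x → δ x (V #0) + (δ x (V #1) + δ x (V #2)) ≡ δ (π x) v)
  (δ-ι : ∀ x u → u ≢ v → δ x (ι u) ≡ δ (π x) u)
  (view : ∀ x → (∃[ i ] (x ≡ V i)) ⊎ (π x ≢ v × x ≡ ι (π x)))
  (V-others : ∀ c → V (o₁ c) ≢ V (o₂ c)) where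

  π-V : ∀ i → π (V i) ≡ v
  π-V i = δ-pos (subst (0 <_) (δ-V (V i)) (go i))
    where
    go : ∀ i → 0 < δ (V i) (V #0) + (δ (V i) (V #1) + δ (V i) (V #2))
    go #0 rewrite δ-refl (V #0) = s≤s z≤n
    go #1 rewrite δ-refl (V #1) = ℕ.≤-trans (ℕ.m≤n+m 1 (δ (V #1) (V #0))) (ℕ.+-monoʳ-≤ (δ (V #1) (V #0)) (s≤s z≤n))
    go #2 rewrite δ-refl (V #2) = ℕ.≤-trans (ℕ.m≤n+m 1 (δ (V #2) (V #1))) (ℕ.m≤n+m _ (δ (V #2) (V #0)))

  π-ι : ∀ {u} → u ≢ v → π (ι u) ≡ u
  π-ι {u} ne = δ-pos (subst (0 <_) (δ-ι (ι u) u ne) (subst (0 <_) (sym (δ-refl (ι u))) z<s))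

  V≢ι : ∀ i {u} → u ≢ v → V i ≢ ι u
  V≢ι i ne eq = ne (trans (sym (π-ι ne)) (trans (cong π (sym eq)) (π-V i)))

  copies : CCor {A} {B} → List (Face A′ B)
  copies ((b , u , d) , c) = quad (V c) b (ι u) d ∷ quad (V (o₁ c)) b (V (o₂ c)) d ∷ []

  dup : List (CCor {A} {B}) → List (Face A B) → List (Face A′ B)
  dup S O = concatMap copies S ++ map (mapF ι id) O

  old : List (CCor {A} {B}) → List (Face A B) → List (Face A B)
  old S O = map (corner v) (map proj₁ S) ++ O

  Σ-colours : ∀ (f : Fin 3 → ℕ) c → f c + (f (o₁ c) + f (o₂ c)) ≡ f #0 + (f #1 + f #2)
  Σ-colours f #0 = refl
  Σ-colours f #1 = lemma (f #0) (f #1) (f #2)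
    where
    lemma : ∀ p q r → q + (p + r) ≡ p + (q + r)
    lemma = solve-∀
  Σ-colours f #2 = lemma (f #0) (f #1) (f #2)
    where
    lemma : ∀ p q r → r + (p + q) ≡ p + (q + r)
    lemma = solve-∀

  -- At each corner every copy occurs in exactly one of the two new quadrilaterals, so the three
  -- copies together contribute there what `v` contributed.
  cnt-dup : ∀ S O → All (Proper v) (map proj₁ S) → All (Avoids v) O → ∀ x y → cnt (dup S O) x y ≡ cnt (old S O) (π x) y
  cnt-dup [] [] _ _ x y = refl
  cnt-dup [] (quad a b c d ∷ O) pr ((p , q) ∷ av) x y =
    cong₂ _+_ (cong₂ _+_ (cong₂ _+_ (cong (_* _) (δ-ι x a p)) (cong (_* _) (δ-ι x c q)))
                         (cong₂ _+_ (cong (_* _) (δ-ι x c q)) (cong (_* _) (δ-ι x a p)))) (cnt-dup [] O pr av x y)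
  cnt-dup [] (hexa a b c d e f ∷ O) pr ((p , q , r) ∷ av) x y =
    cong₂ _+_ (cong₂ _+_ (cong₂ _+_ (cong (_* _) (δ-ι x a p)) (cong₂ _+_ (cong (_* _) (δ-ι x c q)) (cong (_* _) (δ-ι x e r))))
                         (cong₂ _+_ (cong (_* _) (δ-ι x c q)) (cong₂ _+_ (cong (_* _) (δ-ι x e r)) (cong (_* _) (δ-ι x a p))))) (cnt-dup [] O pr av x y)
  cnt-dup (((b , u , d) , c) ∷ S) O ((p , _) ∷ pr) av x y = begin
    s₁ + (s₂ + r)
      ≡⟨ sym (ℕ.+-assoc s₁ s₂ r) ⟩
    (s₁ + s₂) + r
      ≡⟨ cong₂ (λ z w → z + w + r) (up+down (V c) b (ι u) d x y) (up+down (V (o₁ c)) b (V (o₂ c)) d x y) ⟩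
    ((δ x (V c) + δ x (ι u)) * t + (δ x (V (o₁ c)) + δ x (V (o₂ c))) * t) + r
      ≡⟨ cong (_+ r) (lemma (δ x (V c)) (δ x (ι u)) (δ x (V (o₁ c))) (δ x (V (o₂ c))) t) ⟩
    (δ x (V c) + (δ x (V (o₁ c)) + δ x (V (o₂ c))) + δ x (ι u)) * t + r
      ≡⟨ cong (λ z → (z + δ x (ι u)) * t + r) (trans (Σ-colours (λ i → δ x (V i)) c) (δ-V x)) ⟩
    (δ (π x) v + δ x (ι u)) * t + r
      ≡⟨ cong₂ (λ z w → (δ (π x) v + z) * t + w) (δ-ι x u p) (cnt-dup S O pr av x y) ⟩
    (δ (π x) v + δ (π x) u) * t + cnt (old S O) (π x) y
      ≡⟨ cong (_+ cnt (old S O) (π x) y) (sym (up+down v b u d (π x) y)) ⟩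
    cnt (old (((b , u , d) , c) ∷ S) O) (π x) y ∎
    where
    open ≡-Reasoning
    t s₁ s₂ r : ℕ
    t = δ y b + δ y d
    s₁ = up (quad (V c) b (ι u) d) x y + down (quad (V c) b (ι u) d) x y
    s₂ = up (quad (V (o₁ c)) b (V (o₂ c)) d) x y + down (quad (V (o₁ c)) b (V (o₂ c)) d) x y
    r = cnt (dup S O) x y
    lemma : ∀ p q r s t → (p + q) * t + (r + s) * t ≡ (p + (r + s) + q) * t
    lemma = solve-∀

  module _ {E : A → B → ℕ} (S : List (CCor {A} {B})) (O : List (Face A B))
    (E≤1 : ∀ b → E v b ≤ 1) (C : Cert E (old S O))
    (proper : All (Proper v) (map proj₁ S)) (avoid : All (Avoids v) O) (coloured : Coloured S) where

    open Cert C

    private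
      which : ∀ c i → i ≡ c ⊎ (i ≡ o₁ c ⊎ i ≡ o₂ c)
      which #0 #0 = inj₁ refl
      which #0 #1 = inj₂ (inj₁ refl)
      which #0 #2 = inj₂ (inj₂ refl)
      which #1 #0 = inj₂ (inj₁ refl)
      which #1 #1 = inj₁ refl
      which #1 #2 = inj₂ (inj₂ refl)
      which #2 #0 = inj₂ (inj₁ refl)
      which #2 #1 = inj₂ (inj₂ refl)
      which #2 #2 = inj₁ refl

      link-V : ∀ i {S O} → All (Proper v) (map proj₁ S) → All (Avoids v) O →
               ∀ {b d} → Link (old S O) v b d → Link (dup S O) (V i) b d
      link-V i {[]} _ (av ∷ avs) (here c) = contradiction c (Avoids-Corner av)
      link-V i {[]} pr (av ∷ avs) (there l) = there (link-V i {[]} pr avs l)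
      link-V i {(_ , c) ∷ S} ((p , _) ∷ _) av (here q₃) = contradiction refl p
      link-V i {(_ , c) ∷ S} ((p , _) ∷ _) av (here q₄) = contradiction refl p
      link-V i {(_ , c) ∷ S} _ av (here q₁) with which c i
      ... | inj₁ refl        = here q₁
      ... | inj₂ (inj₁ refl) = there (here q₁)
      ... | inj₂ (inj₂ refl) = there (here q₃)
      link-V i {(_ , c) ∷ S} _ av (here q₂) with which c i
      ... | inj₁ refl        = here q₂
      ... | inj₂ (inj₁ refl) = there (here q₂)
      ... | inj₂ (inj₂ refl) = there (here q₄)
      link-V i {_ ∷ S} (_ ∷ pr) av (there l) = there (there (link-V i pr av l))

      link-ι : ∀ {S O u b d} → u ≢ v → Link (old S O) u b d → Link (dup S O) (ι u) b d
      link-ι {[]} {f ∷ O} ne (here c) = here (Corner-map ι id c)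
      link-ι {[]} {f ∷ O} ne (there l) = there (link-ι {[]} ne l)
      link-ι {_ ∷ S} ne (here q₁) = contradiction refl ne
      link-ι {_ ∷ S} ne (here q₂) = contradiction refl ne
      link-ι {_ ∷ S} ne (here q₃) = here q₃
      link-ι {_ ∷ S} ne (here q₄) = here q₄
      link-ι {_ ∷ S} ne (there l) = there (there (link-ι {S} ne l))

      colink-copies : ∀ c {S O b} → 0 < ncol c S b → Colink (dup S O) b (V (o₁ c)) (V (o₂ c))
      colink-copies c {((x , u , y) , c′) ∷ S} {b = b} lt with c ≟ c′ | b ≟ x | b ≟ y
      ... | yes refl | yes refl | _        = there (here q₁)
      ... | yes refl | no _     | yes refl = there (here q₃)
      ... | yes refl | no _     | no _     = there (there (colink-copies c {S} lt))
      ... | no _     | _        | _        = there (there (colink-copies c {S} lt))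

      Conn : B → A′ → A′ → Set
      Conn b = Star (Colink (dup S O) b)

      two-of : ∀ (f : Fin 3 → ℕ) → (∀ c → f c ≤ 1) → (f #0 + f #1) + f #2 ≡ 2 →
               (0 < f #0 × 0 < f #1) ⊎ ((0 < f #0 × 0 < f #2) ⊎ (0 < f #1 × 0 < f #2))
      two-of f h eq with f #0 | f #1 | f #2 | h #0 | h #1 | h #2
      ... | suc _ | suc _ | _     | _ | _ | _ = inj₁ (z<s , z<s)
      ... | suc _ | zero  | suc _ | _ | _ | _ = inj₂ (inj₁ (z<s , z<s))
      ... | zero  | suc _ | suc _ | _ | _ | _ = inj₂ (inj₂ (z<s , z<s))
      two-of f h () | zero        | zero        | zero        | _ | _ | _
      two-of f h () | suc zero    | zero        | zero        | _ | _ | _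
      two-of f h eq | suc (suc _) | zero        | zero        | s≤s () | _ | _
      two-of f h () | zero        | suc zero    | zero        | _ | _ | _
      two-of f h eq | zero        | suc (suc _) | zero        | _ | s≤s () | _
      two-of f h () | zero        | zero        | suc zero    | _ | _ | _
      two-of f h eq | zero        | zero        | suc (suc _) | _ | _ | s≤s ()

      twice : ∀ {e} → 0 < e → e ≤ 1 → e + e ≡ 2
      twice (s≤s z≤n) (s≤s z≤n) = refl

      -- The two corners of `v` at `b` have different colours, and a corner of colour `c` joins the
      -- two copies other than `c`. Two different pairs of copies connect all three.
      copies-conn₀ : ∀ {b} → 0 < E v b → ∀ i → Conn b (V #0) (V i)
      copies-conn₀ {b} e i with two-of (λ c → ncol c S b) (λ c → coloured c b)
        (trans (ncol-tot S b) (trans (sym (cnt-star v (map proj₁ S) O proper avoid b)) (trans (count v b) (twice e (E≤1 b)))))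
      copies-conn₀ e #0 | _ = ε
      copies-conn₀ e #1 | inj₁ (p , q) = colink-copies #1 {S} q ◅ Colink-sym (colink-copies #0 {S} p) ◅ ε
      copies-conn₀ e #2 | inj₁ (p , q) = colink-copies #1 {S} q ◅ ε
      copies-conn₀ e #1 | inj₂ (inj₁ (p , q)) = colink-copies #2 {S} q ◅ ε
      copies-conn₀ e #2 | inj₂ (inj₁ (p , q)) = colink-copies #2 {S} q ◅ colink-copies #0 {S} p ◅ ε
      copies-conn₀ e #1 | inj₂ (inj₂ (p , q)) = colink-copies #2 {S} q ◅ ε
      copies-conn₀ e #2 | inj₂ (inj₂ (p , q)) = colink-copies #1 {S} p ◅ ε

      copies-conn : ∀ {b} → 0 < E v b → ∀ i j → Conn b (V i) (V j)
      copies-conn e i j = Star.reverse Colink-sym (copies-conn₀ e i) ◅◅ copies-conn₀ e j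

      data Rep (w : A) : A′ → Set where
        cop : ∀ i → w ≡ v → Rep w (V i)
        oth : w ≢ v → Rep w (ι w)

      rep : ∀ x → Rep (π x) x
      rep x with view x
      ... | inj₁ (i , refl) = cop i (π-V i)
      ... | inj₂ (ne , eq) = subst (Rep (π x)) (sym eq) (oth ne)

      same-rep : ∀ {b w x x′} → (w ≡ v → 0 < E v b) → Rep w x → Rep w x′ → Conn b x x′
      same-rep e (cop i eq) (cop j _) = copies-conn (e eq) i j
      same-rep e (cop i eq) (oth ne) = contradiction eq ne
      same-rep e (oth ne) (cop i eq) = contradiction eq ne
      same-rep e (oth ne) (oth _) = ε

      -- Which copy continues an old link is dictated by the colour of the corner, hence the
      -- existential; `same-rep` afterwards moves between the copies.
      colink-dup : ∀ {S O} → All (Proper v) (map proj₁ S) → All (Avoids v) O → ∀ {b w w′} → Colink (old S O) b w w′ →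
                   ∃[ x ] ∃[ x′ ] (Rep w x × Rep w′ x′ × Colink (dup S O) b x x′)
      colink-dup {[]} {f ∷ O} pr (av ∷ avs) (here c) with Avoids-Cocorner {f = f} av c
      ... | ne , ne′ = ι _ , ι _ , oth ne , oth ne′ , here (subst (λ g → Corner g _ _ _) (sym (flip-map ι id f)) (Corner-map id ι c))
      colink-dup {[]} pr (av ∷ avs) (there l) with colink-dup {[]} pr avs l
      ... | x , x′ , r , r′ , l′ = x , x′ , r , r′ , there l′
      colink-dup {(_ , c) ∷ S} ((p , _) ∷ _) av (here q₁) = V c , ι _ , cop c refl , oth p , here q₁
      colink-dup {(_ , c) ∷ S} ((p , _) ∷ _) av (here q₂) = ι _ , V c , oth p , cop c refl , here q₂
      colink-dup {(_ , c) ∷ S} ((p , _) ∷ _) av (here q₃) = V c , ι _ , cop c refl , oth p , here q₃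
      colink-dup {(_ , c) ∷ S} ((p , _) ∷ _) av (here q₄) = ι _ , V c , oth p , cop c refl , here q₄
      colink-dup {_ ∷ S} (_ ∷ pr) av (there l) with colink-dup {S} pr av l
      ... | x , x′ , r , r′ , l′ = x , x′ , r , r′ , there (there l′)


      tot-pos : ∀ {S O b w} → All (Avoids v) O → Colink (old S O) b v w → 0 < tot (map proj₁ S) b
      tot-pos {[]} {f ∷ O} (av ∷ _) (here c) = contradiction refl (proj₁ (Avoids-Cocorner {f = f} av c))
      tot-pos {[]} (_ ∷ avs) (there l) = tot-pos {[]} avs l
      tot-pos {((b , _ , d) , _) ∷ S} av (here q₁) rewrite δ-refl b = s≤s z≤n
      tot-pos {((b , _ , d) , _) ∷ S} av (here q₂) rewrite δ-refl b = s≤s z≤n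
      tot-pos {((b , _ , d) , _) ∷ S} av (here q₃) rewrite δ-refl d = ℕ.m≤n⇒m≤n+o _ (ℕ.m≤n+m 1 (δ d b))
      tot-pos {((b , _ , d) , _) ∷ S} av (here q₄) rewrite δ-refl d = ℕ.m≤n⇒m≤n+o _ (ℕ.m≤n+m 1 (δ d b))
      tot-pos {_ ∷ S} {b = b} av (there l) = ℕ.≤-trans (tot-pos {S} av l) (ℕ.m≤n+m _ _)

      E-pos : ∀ {b w w′} → Colink (old S O) b w w′ → w ≡ v → 0 < E v b
      E-pos {b} l refl = halve (subst (0 <_) (trans (sym (cnt-star v (map proj₁ S) O proper avoid b)) (count v b)) (tot-pos {S} avoid l))

      conn-dup : ∀ {b w w′} → Star (Colink (old S O) b) w w′ → (w′ ≡ v → 0 < E v b) →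
                 ∀ {x x′} → Rep w x → Rep w′ x′ → Conn b x x′
      conn-dup ε e r r′ = same-rep e r r′
      conn-dup (l ◅ ls) e r r′ with colink-dup {S} proper avoid l
      ... | y , y′ , ry , ry′ , l′ = same-rep (E-pos l) r ry ◅◅ (l′ ◅ conn-dup ls e ry′ r′)

    dup-Cert : Cert (λ x y → E (π x) y) (dup S O)
    dup-Cert = record
      { count  = λ x y → trans (cnt-dup S O proper avoid x y) (count (π x) y)
      ; link   = λ x b d e e′ → links x (view x) b d (link (π x) b d e e′)
      ; colink = λ b x x′ e e′ → conn-dup (colink b (π x) (π x′) e e′) (λ eq → subst (λ w → 0 < E w b) eq e′) (rep x) (rep x′)
      }
      where
      links : ∀ x → (∃[ i ] (x ≡ V i)) ⊎ (π x ≢ v × x ≡ ι (π x)) → ∀ b d → Star (Link (old S O) (π x)) b d → Star (Link (dup S O) x) b d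
      links x (inj₁ (i , refl)) b d ls = Star.map (λ l → link-V i {S} proper avoid (subst (λ w → Link (old S O) w _ _) (π-V i) l)) ls
      links x (inj₂ (ne , eq)) b d ls = subst (λ z → Star (Link (dup S O) z) b d) (sym eq) (Star.map (link-ι {S} ne) ls)

  dup-Simple : ∀ {PA : A → Set} {PA′ : A′ → Set} {PB : B → Set} → (∀ {u} → PA u → PA′ (ι u)) → ∀ S O →
               All (Proper v) (map proj₁ S) → All (Simple PA PB) O → All (Avoids v) O → All (Simple PA′ PB) (dup S O)
  dup-Simple h [] [] _ _ _ = []
  dup-Simple h [] (quad a b c d ∷ O) pr ((p , q) ∷ ss) ((r , s) ∷ avs) =
    ((λ eq → p (trans (sym (π-ι r)) (trans (cong π eq) (π-ι s)))) , q) ∷ dup-Simple h [] O pr ss avs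
  dup-Simple h [] (hexa a b c d e f ∷ O) pr (((p , q , r) , k) ∷ ss) (_ ∷ avs) =
    ((h p , h q , h r) , k) ∷ dup-Simple h [] O pr ss avs
  dup-Simple h (((b , u , d) , c) ∷ S) O ((p , q) ∷ pr) ss av =
    (V≢ι c p , q) ∷ (V-others c , q) ∷ dup-Simple h S O pr ss av

-- Checks by computation

record Finite (A : Set) : Set where
  field
    elems    : List A
    complete : ∀ x → x ∈ elems
open Finite {{...}} public

instance
  finFin : ∀ {n} → Finite (Fin n)
  finFin {n} = record { elems = allFin n ; complete = ∈.∈-allFin }

  fin⊎ : ∀ {A B} → {{Finite A}} → {{Finite B}} → Finite (A ⊎ B)
  fin⊎ = record
    { elems = map inj₁ elems ++ map inj₂ elems
    ; complete = λ where
        (inj₁ x) → ∈.∈-++⁺ˡ (∈.∈-map⁺ inj₁ (complete x))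
        (inj₂ y) → ∈.∈-++⁺ʳ _ (∈.∈-map⁺ inj₂ (complete y)) }

T-∧₁ : ∀ {x y} → T (x ∧ y) → T x
T-∧₁ {true} _ = tt

T-∧₂ : ∀ {x y} → T (x ∧ y) → T y
T-∧₂ {true} t = t

all-sound : {A : Set} (P : A → Bool) (xs : List A) → T (all P xs) → ∀ {x} → x ∈ xs → T (P x)
all-sound P (x ∷ xs) t (here refl) = T-∧₁ t
all-sound P (x ∷ xs) t (there i)   = all-sound P xs (T-∧₂ {P x} t) i

any-sound : {A : Set} (P : A → Bool) (xs : List A) → T (any P xs) → ∃[ x ] T (P x)
any-sound P (x ∷ xs) t with P x in eq
... | true  = x , subst T (sym eq) tt
... | false = any-sound P xs t

every : {A : Set} {{_ : Finite A}} → (A → Bool) → Bool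
every P = all P elems

every-sound : {A : Set} {{_ : Finite A}} (P : A → Bool) → T (every P) → ∀ x → T (P x)
every-sound P t x = all-sound P elems t (complete x)

module _ {A B : Set} {{_ : Eq A}} {{_ : Eq B}} where

  at : ∀ {f : Face A B} {a b b′} → Corner f a b b′ → ∀ x y → List (∃[ y′ ] Corner f x y y′)
  at {a = a} {b} {b′} c x y with x ≟ a | y ≟ b
  ... | yes refl | yes refl = (b′ , c) ∷ []
  ... | _        | _        = []

  turns : ∀ (f : Face A B) x y → List (∃[ y′ ] Corner f x y y′)
  turns (quad a b c d)     x y = at q₁ x y ++ at q₂ x y ++ at q₃ x y ++ at q₄ x y
  turns (hexa a b c d e f) x y = at h₁ x y ++ at h₂ x y ++ at h₃ x y ++ at h₄ x y ++ at h₅ x y ++ at h₆ x y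

  links : ∀ (L : List (Face A B)) x y → List (∃[ y′ ] Link L x y y′)
  links []      x y = []
  links (f ∷ L) x y = map (λ (y′ , c) → y′ , here c) (turns f x y) ++ map (λ (y′ , l) → y′ , there l) (links L x y)

  -- Every vertex found carries the path that reached it, so the search needs no separate proof of
  -- soundness.
  Reached : List (Face A B) → A → B → Set
  Reached L x y = List (∃[ y′ ] Star (Link L x) y y′)

  find : ∀ {L x y} → Reached L x y → ∀ y′ → Maybe (Star (Link L x) y y′)
  find []              y′ = nothing
  find ((z , p) ∷ R) y′ with z ≟ y′
  ... | yes refl = just p
  ... | no _     = find R y′

  add : ∀ {L x y z} → Star (Link L x) y z → List (∃[ z′ ] Link L x z z′) → Reached L x y → Reached L x y
  add p []             R = R
  add p ((z , l) ∷ ls) R with is-just (find R z)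
  ... | true  = add p ls R
  ... | false = add p ls ((z , p ◅◅ (l ◅ ε)) ∷ R)

  grow : ∀ {L x y} → Reached L x y → Reached L x y → Reached L x y
  grow         []            R = R
  grow {L} {x} ((z , p) ∷ Q) R = grow Q (add p (links L x z) R)

  expand : ∀ {L x y} → Reached L x y → Reached L x y
  expand R = grow R R

  -- The number of rounds bounds how far along the link the search is sure to get; too few rounds
  -- can only make a check fail.
  reach : ℕ → ∀ L x y → Reached L x y
  reach zero    L x y = (y , ε) ∷ []
  reach (suc n) L x y = expand (reach n L x y)

  walk? : ℕ → ∀ L x y y′ → Maybe (Star (Link L x) y y′)
  walk? n L x y y′ = find (reach n L x y) y′

  joined : ℕ → List (Face A B) → A → B → B → Bool
  joined n L x y y′ = is-just (walk? n L x y y′)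

  joined-sound : ∀ n L x y y′ → T (joined n L x y y′) → Star (Link L x) y y′
  joined-sound n L x y y′ t with walk? n L x y y′
  ... | just p = p

  covers : ∀ {L x y} → Reached L x y → List B → Bool
  covers R = all (λ y′ → is-just (find R y′))

  connected : ℕ → List (Face A B) → A → List B → Bool
  connected n L x []       = true
  connected n L x (y ∷ ys) = covers (reach n L x y) (y ∷ ys)

  connected-sound : ∀ n L x ys → T (connected n L x ys) → ∀ {y y′} → y ∈ ys → y′ ∈ ys → Star (Link L x) y y′
  connected-sound n L x (z ∷ ys) t {y} {y′} i i′ = Star.reverse Link-sym (from i) ◅◅ from i′
    where
    from : ∀ {y} → y ∈ z ∷ ys → Star (Link L x) z y
    from {y} i = joined-sound n L x z y (all-sound _ (z ∷ ys) t i)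

module _ {A B : Set} {{_ : Eq A}} {{_ : Eq B}} {{_ : Finite A}} {{_ : Finite B}} where

  linked : ℕ → (A → B → ℕ) → List (Face A B) → Bool
  linked n E L = every λ a → connected n L a (filterᵇ (λ b → 0 <ᵇ E a b) elems)

  linked-sound : ∀ n E L → T (linked n E L) → ∀ a b b′ → 0 < E a b → 0 < E a b′ → Star (Link L a) b b′
  linked-sound n E L t a b b′ e e′ = connected-sound n L a _ (every-sound _ t a) (adjacent e) (adjacent e′)
    where
    adjacent : ∀ {b} → 0 < E a b → b ∈ filterᵇ (λ b → 0 <ᵇ E a b) elems
    adjacent {b} e = ∈.∈-filter⁺ (λ b → T? (0 <ᵇ E a b)) (complete b) (ℕ.<⇒<ᵇ e)

  counted : (A → B → ℕ) → List (Face A B) → Bool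
  counted E L = every λ a → every λ b → cnt L a b ≡ᵇ E a b + E a b

module _ {A B : Set} {{_ : Eq A}} {{_ : Eq B}} {{_ : Finite A}} {{_ : Finite B}} where

  check : ℕ → (A → B → ℕ) → List (Face A B) → Bool
  check n E L = counted E L ∧ (linked n E L ∧ linked n (λ b a → E a b) (map flip L))

  check-sound : ∀ n E L → T (check n E L) → Cert E L
  check-sound n E L t = record
    { count  = λ x y → ℕ.≡ᵇ⇒≡ _ _ (every-sound _ (every-sound _ (T-∧₁ t) x) y)
    ; link   = linked-sound n E L (T-∧₁ t₂)
    ; colink = λ b a a′ e e′ → Star.map Any.map⁻ (linked-sound n (λ b a → E a b) (map flip L) (T-∧₂ {linked n E L} t₂) b a a′ e e′)
    }
    where
    t₂ : T (linked n E L ∧ linked n (λ b a → E a b) (map flip L))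
    t₂ = T-∧₂ {counted E L} t

  clash : (L : List (Face A B)) → Orientation L → Bool
  clash L o = any (λ d → any (λ x → any (λ y → 2 ≤ᵇ dirs o d x y) elems) elems) (true ∷ false ∷ [])

  all-orientations : (L : List (Face A B)) → (Orientation L → Bool) → Bool
  all-orientations []      P = P []
  all-orientations (f ∷ L) P = all-orientations L (λ o → P (true ∷ o) ∧ P (false ∷ o))

  all-orientations-sound : ∀ L P → T (all-orientations L P) → ∀ o → T (P o)
  all-orientations-sound []      P t []          = t
  all-orientations-sound (f ∷ L) P t (true ∷ o)  = T-∧₁ (all-orientations-sound L _ t o)
  all-orientations-sound (f ∷ L) P t (false ∷ o) = T-∧₂ {P (true ∷ o)} (all-orientations-sound L _ t o)

  unorientable : List (Face A B) → Bool
  unorientable L = all-orientations L (clash L)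

module _ {X Y A B : Set} {{_ : Eq X}} {{_ : Eq Y}} {{_ : Eq A}} {{_ : Eq B}} {{_ : Finite X}} {{_ : Finite Y}}
  (g : X → A) (h : Y → B) where

  dir-map : ∀ d f x y → dir d f x y ≤ dir d (mapF g h f) (g x) (h y)
  dir-map true  (quad a b c d) x y = ℕ.+-mono-≤ (ℕ.*-mono-≤ (δ-≤ g x a) (δ-≤ h y b)) (ℕ.*-mono-≤ (δ-≤ g x c) (δ-≤ h y d))
  dir-map false (quad a b c d) x y = ℕ.+-mono-≤ (ℕ.*-mono-≤ (δ-≤ g x c) (δ-≤ h y b)) (ℕ.*-mono-≤ (δ-≤ g x a) (δ-≤ h y d))
  dir-map true  (hexa a b c d e f) x y = ℕ.+-mono-≤ (ℕ.*-mono-≤ (δ-≤ g x a) (δ-≤ h y b))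
    (ℕ.+-mono-≤ (ℕ.*-mono-≤ (δ-≤ g x c) (δ-≤ h y d)) (ℕ.*-mono-≤ (δ-≤ g x e) (δ-≤ h y f)))
  dir-map false (hexa a b c d e f) x y = ℕ.+-mono-≤ (ℕ.*-mono-≤ (δ-≤ g x c) (δ-≤ h y b))
    (ℕ.+-mono-≤ (ℕ.*-mono-≤ (δ-≤ g x e) (δ-≤ h y d)) (ℕ.*-mono-≤ (δ-≤ g x a) (δ-≤ h y f)))

  restrict : ∀ W {R} → (o : Orientation (map (mapF g h) W ++ R)) →
             Σ (Orientation W) λ o′ → ∀ d x y → dirs o′ d x y ≤ dirs o d (g x) (h y)
  restrict []      o = [] , λ d x y → z≤n
  restrict (f ∷ W) (o ∷ os) with restrict W os
  ... | os′ , le = o ∷ os′ , λ d x y → ℕ.+-mono-≤ (dir-map (o xor d) f x y) (le d x y)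

  -- An orientation of the whole list restricts to the images of `W`, and the clash found for the
  -- names persists, as `g` and `h` can only add coincidences of sides.
  unorientable-sound : ∀ W {R} → T (unorientable W) → ¬ Coherent (map (mapF g h) W ++ R)
  unorientable-sound W t (o , ok) with restrict W o
  ... | o′ , le with any-sound (λ d → any (λ x → any (λ y → 2 ≤ᵇ dirs o′ d x y) elems) elems) (true ∷ false ∷ []) (all-orientations-sound W _ t o′)
  ... | d , t₁ with any-sound (λ x → any (λ y → 2 ≤ᵇ dirs o′ d x y) elems) elems t₁
  ... | x , t₂ with any-sound (λ y → 2 ≤ᵇ dirs o′ d x y) elems t₂
  ... | y , t₃ = ℕ.<⇒≱ (ℕ.≤-trans (ℕ.≤ᵇ⇒≤ 2 _ t₃) (le d x y)) (ok d (g x) (h y))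

module _ {X Y A B : Set} {{_ : Eq X}} {{_ : Eq Y}} {{_ : Eq A}} {{_ : Eq B}} where

  sides : (X → A) → (Y → B) → List (X × Y) → A → B → ℕ
  sides g h []            x y = 0
  sides g h ((i , j) ∷ N) x y = δ x (g i) * δ y (h j) + sides g h N x y

-- Local surgery

-- The faces mapF g h D are to be replaced by mapF g h D′, which creates the edges N.
module Surgery {X Y : Set} {{_ : Eq X}} {{_ : Eq Y}} {{_ : Finite X}} {{_ : Finite Y}} (fuel : ℕ) (D D′ : List (Face X Y)) (N : List (X × Y)) where

  -- Each of the four corners lost with an old face must be replaced by a path of corners of the new
  -- faces.
  bridged : Face X Y → Bool
  bridged (quad a b c d) = (joined fuel D′ a b d ∧ joined fuel D′ c b d) ∧
                           (joined fuel (map flip D′) b a c ∧ joined fuel (map flip D′) d a c)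
  bridged (hexa _ _ _ _ _ _) = false

  -- At both of its ends a new edge must be linked, through new faces, to an edge that was already
  -- there.
  attached : X × Y → Bool
  attached (i , j) = any (λ j′ → joined fuel D′ i j j′ ∧ (0 <ᵇ cnt D i j′)) elems ∧
                     any (λ i′ → joined fuel (map flip D′) j i i′ ∧ (0 <ᵇ cnt D i′ j)) elems

  valid : Bool
  valid = all bridged D ∧ all attached N

  module _ {A B : Set} {{_ : Eq A}} {{_ : Eq B}} (ok : T valid) (g : X → A) (h : Y → B)
    (balance : ∀ x y → cnt (map (mapF g h) D′) x y ≡ cnt (map (mapF g h) D) x y + (sides g h N x y + sides g h N x y)) where

    private
      gh : List (Face X Y) → List (Face A B)
      gh = map (mapF g h)

      flip-joined : ∀ j i i′ → T (joined fuel (map flip D′) j i i′) → Star (Colink D′ j) i i′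
      flip-joined j i i′ t = Star.map Any.map⁻ (joined-sound fuel (map flip D′) j i i′ t)

      Link-map : ∀ {L i j j′} → Link L i j j′ → Link (gh L) (g i) (h j) (h j′)
      Link-map l = Any.map⁺ (Any.map (Corner-map g h) l)

      Colink-map : ∀ {L j i i′} → Colink L j i i′ → Colink (gh L) (h j) (g i) (g i′)
      Colink-map l = Any.map⁺ (Any.map (λ {f} c → subst (λ k → Corner k _ _ _) (sym (flip-map g h f)) (Corner-map h g c)) l)

      go : ∀ {j j′ i} → Star (Link D′ i) j j′ → Star (Link (gh D′) (g i)) (h j) (h j′)
      go = Star.gmap h Link-map

      cogo : ∀ {i i′ j} → Star (Colink D′ j) i i′ → Star (Colink (gh D′) (h j)) (g i) (g i′)
      cogo = Star.gmap g Colink-map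

      back : ∀ {a b b′} → Star (Link (gh D′) a) b b′ → Star (Link (gh D′) a) b′ b
      back = Star.reverse Link-sym

      coback : ∀ {b a a′} → Star (Colink (gh D′) b) a a′ → Star (Colink (gh D′) b) a′ a
      coback = Star.reverse Colink-sym

      bridge : ∀ L → T (all bridged L) → ∀ {a b b′} → Link (gh L) a b b′ → Star (Link (gh D′) a) b b′
      bridge (f ∷ L) t (there l) = bridge L (T-∧₂ {bridged f} t) l
      bridge (quad a b c d ∷ L) t (here q) = at′ q
        where
        t₁ = T-∧₁ {joined fuel D′ a b d ∧ joined fuel D′ c b d} (T-∧₁ {bridged (quad a b c d)} t)
        at′ : ∀ {x y z} → Corner (mapF g h (quad a b c d)) x y z → Star (Link (gh D′) x) y z
        at′ q₁ = go (joined-sound fuel D′ a b d (T-∧₁ t₁))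
        at′ q₂ = back (go (joined-sound fuel D′ a b d (T-∧₁ t₁)))
        at′ q₃ = go (joined-sound fuel D′ c b d (T-∧₂ {joined fuel D′ a b d} t₁))
        at′ q₄ = back (go (joined-sound fuel D′ c b d (T-∧₂ {joined fuel D′ a b d} t₁)))

      cobridge : ∀ L → T (all bridged L) → ∀ {b a a′} → Colink (gh L) b a a′ → Star (Colink (gh D′) b) a a′
      cobridge (f ∷ L) t (there l) = cobridge L (T-∧₂ {bridged f} t) l
      cobridge (quad a b c d ∷ L) t (here q) = at′ q
        where
        t₁ = T-∧₂ {joined fuel D′ a b d ∧ joined fuel D′ c b d} (T-∧₁ {bridged (quad a b c d)} t)
        at′ : ∀ {x y z} → Corner (flip (mapF g h (quad a b c d))) x y z → Star (Colink (gh D′) x) y z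
        at′ q₁ = cogo (flip-joined b a c (T-∧₁ t₁))
        at′ q₂ = coback (cogo (flip-joined b a c (T-∧₁ t₁)))
        at′ q₃ = cogo (flip-joined d a c (T-∧₂ {joined fuel (map flip D′) b a c} t₁))
        at′ q₄ = coback (cogo (flip-joined d a c (T-∧₂ {joined fuel (map flip D′) b a c} t₁)))

      cnt-map : ∀ L i j → cnt L i j ≤ cnt (gh L) (g i) (h j)
      cnt-map []      i j = z≤n
      cnt-map (f ∷ L) i j = ℕ.+-mono-≤ (ℕ.+-mono-≤ (dir-map g h true f i j) (dir-map g h false f i j)) (cnt-map L i j)

      attach : ∀ M → T (all attached M) → ∀ {x y} → 0 < sides g h M x y →
               (∃[ y′ ] (Star (Link (gh D′) x) y y′ × 0 < cnt (gh D) x y′)) ×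
               (∃[ x′ ] (Star (Colink (gh D′) y) x x′ × 0 < cnt (gh D) x′ y))
      attach ((i , j) ∷ M) t {x} {y} lt with x ≟ g i | y ≟ h j
      ... | no _ | _ = attach M (T-∧₂ {attached (i , j)} t) lt
      ... | yes refl | no _ = attach M (T-∧₂ {attached (i , j)} t) lt
      ... | yes refl | yes refl
        with any-sound (λ j′ → joined fuel D′ i j j′ ∧ (0 <ᵇ cnt D i j′)) elems (T-∧₁ (T-∧₁ {attached (i , j)} t))
           | any-sound (λ i′ → joined fuel (map flip D′) j i i′ ∧ (0 <ᵇ cnt D i′ j)) elems
               (T-∧₂ {any (λ j′ → joined fuel D′ i j j′ ∧ (0 <ᵇ cnt D i j′)) elems} (T-∧₁ {attached (i , j)} t))
      ... | j′ , u | i′ , w =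
        (h j′ , go (joined-sound fuel D′ i j j′ (T-∧₁ u)) ,
           ℕ.≤-trans (ℕ.<ᵇ⇒< 0 _ (T-∧₂ {joined fuel D′ i j j′} u)) (cnt-map D i j′)) ,
        (g i′ , cogo (flip-joined j i i′ (T-∧₁ w)) ,
           ℕ.≤-trans (ℕ.<ᵇ⇒< 0 _ (T-∧₂ {joined fuel (map flip D′) j i i′} w)) (cnt-map D i′ j))

      split : ∀ {m n} → 0 < m + n → 0 < m ⊎ 0 < n
      split {zero}  lt = inj₂ lt
      split {suc m} lt = inj₁ z<s

    -- To connect two edges at a vertex, walk from each to an old edge by `attached`, connect these
    -- in the old surface, and replace every lost corner by its `bridged` path.
    operate : ∀ {E R} → Cert E (gh D ++ R) → Cert (λ x y → E x y + sides g h N x y) (gh D′ ++ R)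
    operate {E} {R} C = record
      { count  = λ x y → let e = E x y ; n = sides g h N x y in begin
          cnt (gh D′ ++ R) x y                        ≡⟨ cnt-++ (gh D′) R x y ⟩
          cnt (gh D′) x y + cnt R x y                 ≡⟨ cong (_+ cnt R x y) (balance x y) ⟩
          (cnt (gh D) x y + (n + n)) + cnt R x y      ≡⟨ lemma (cnt (gh D) x y) (n + n) (cnt R x y) ⟩
          (cnt (gh D) x y + cnt R x y) + (n + n)      ≡⟨ cong (_+ (n + n)) (trans (sym (cnt-++ (gh D) R x y)) (count x y)) ⟩
          (e + e) + (n + n)                           ≡⟨ lemma′ e n ⟩
          (e + n) + (e + n) ∎
      ; link   = λ a b b′ e e′ → let (c , p , f) = base a b e ; (c′ , p′ , f′) = base a b′ e′ in
          p ◅◅ (Star.concat (Star.map step (link a c c′ f f′)) ◅◅ Star.reverse Link-sym p′)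
      ; colink = λ b a a′ e e′ → let (c , p , f) = cobase a b e ; (c′ , p′ , f′) = cobase a′ b e′ in
          p ◅◅ (Star.concat (Star.map costep (colink b c c′ f f′)) ◅◅ Star.reverse Colink-sym p′)
      }
      where
      open Cert C
      open ≡-Reasoning
      lemma : ∀ p q r → (p + q) + r ≡ (p + r) + q
      lemma = solve-∀
      lemma′ : ∀ p q → (p + p) + (q + q) ≡ (p + q) + (p + q)
      lemma′ = solve-∀
      old-edge : ∀ {x y} → 0 < cnt (gh D) x y → 0 < E x y
      old-edge {x} {y} lt = halve (subst (0 <_) (trans (sym (cnt-++ (gh D) R x y)) (count x y)) (ℕ.m≤n⇒m≤n+o _ lt))
      base : ∀ a b → 0 < E a b + sides g h N a b → ∃[ b′ ] (Star (Link (gh D′ ++ R) a) b b′ × 0 < E a b′)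
      base a b lt with split {E a b} lt
      ... | inj₁ e = b , ε , e
      ... | inj₂ n with proj₁ (attach N (T-∧₂ {all bridged D} ok) n)
      ...   | b′ , p , c = b′ , Star.map Any.++⁺ˡ p , old-edge c
      cobase : ∀ a b → 0 < E a b + sides g h N a b → ∃[ a′ ] (Star (Colink (gh D′ ++ R) b) a a′ × 0 < E a′ b)
      cobase a b lt with split {E a b} lt
      ... | inj₁ e = a , ε , e
      ... | inj₂ n with proj₂ (attach N (T-∧₂ {all bridged D} ok) n)
      ...   | a′ , p , c = a′ , Star.map Any.++⁺ˡ p , old-edge c
      step : ∀ {a b b′} → Link (gh D ++ R) a b b′ → Star (Link (gh D′ ++ R) a) b b′
      step l with Any.++⁻ (gh D) l
      ... | inj₁ l′ = Star.map Any.++⁺ˡ (bridge D (T-∧₁ ok) l′)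
      ... | inj₂ l′ = Any.++⁺ʳ (gh D′) l′ ◅ ε
      costep : ∀ {b a a′} → Colink (gh D ++ R) b a a′ → Star (Colink (gh D′ ++ R) b) a a′
      costep l with Any.++⁻ (gh D) l
      ... | inj₁ l′ = Star.map Any.++⁺ˡ (cobridge D (T-∧₁ ok) l′)
      ... | inj₂ l′ = Any.++⁺ʳ (gh D′) l′ ◅ ε

module _ {A B : Set} {{_ : Eq A}} {{_ : Eq B}} where

  absent : ∀ {L : List (Face A B)} {x y} → cnt L x y ≡ 0 → All (λ f → up f x y + down f x y ≡ 0) L
  absent {[]}    eq = []
  absent {f ∷ L} {x} {y} eq = ℕ.m+n≡0⇒m≡0 _ eq ∷ absent (ℕ.m+n≡0⇒n≡0 (up f x y + down f x y) eq)

  -- Meant for a deleted pair: in a quadrilateral every vertex of one side is joined to both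
  -- vertices of the other, so no such face contains both vertices of a non-edge.
  no-side : ∀ {a c x : A} {b d y : B} → up (quad a b c d) x y + down (quad a b c d) x y ≡ 0 →
            a ≡ x ⊎ c ≡ x → b ≡ y ⊎ d ≡ y → ⊥
  no-side {a} {c} {x} {b} {d} {y} eq p q = ℕ.<⇒≢ (ℕ.*-mono-≤ (one x p) (one y q)) (trans (sym eq) (up+down a b c d x y))
    where
    one : ∀ {C : Set} {{_ : Eq C}} {a c : C} (x : C) → a ≡ x ⊎ c ≡ x → 1 ≤ δ x a + δ x c
    one x (inj₁ refl) rewrite δ-refl x = s≤s z≤n
    one {a = a} x (inj₂ refl) rewrite δ-refl x = ℕ.m≤n+m 1 (δ x a)

pattern #3 = suc (suc (suc zero))
pattern #4 = suc #3
pattern #5 = suc #4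
pattern #6 = suc #5

-- Enlarging the matching

-- One side of the graph: k matched and p unmatched vertices.
Side : ℕ → ℕ → Set
Side k p = Fin k ⊎ Fin p

E : ∀ {k p q} → Side k p → Side k q → ℕ
E (inj₁ i) (inj₁ j) = if does (i Fin.≟ j) then 0 else 1
E (inj₁ _) (inj₂ _) = 1
E (inj₂ _) _        = 1

E≤1 : ∀ {k p q} (x : Side k p) (y : Side k q) → E x y ≤ 1
E≤1 (inj₁ i) (inj₁ j) with does (i Fin.≟ j)
... | true  = z≤n
... | false = s≤s z≤n
E≤1 (inj₁ _) (inj₂ _) = s≤s z≤n
E≤1 (inj₂ _) _        = s≤s z≤n

Distinct : ∀ {A B : Set} → Face A B → Set
Distinct = Simple (λ _ → ⊥) (λ _ → ⊥)

-- Va and Vb number the copies of the first matched vertex on the two sides so that after the surgery below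
-- the missing edges join copies of equal index.
module Matched {k p : ℕ} where

  ι : Side (suc k) p → Side (3 + k) p
  ι (inj₁ i) = inj₁ (suc (suc i))
  ι (inj₂ j) = inj₂ j

  π : Side (3 + k) p → Side (suc k) p
  π (inj₁ #0)            = inj₁ #0
  π (inj₁ #1)            = inj₁ #0
  π (inj₁ (suc (suc i))) = inj₁ i
  π (inj₂ j)             = inj₂ j

  Va Vb : Fin 3 → Side (3 + k) p
  Va #0 = inj₁ #0
  Va #1 = inj₁ #1
  Va #2 = inj₁ #2
  Vb #0 = inj₁ #0
  Vb #1 = inj₁ #2
  Vb #2 = inj₁ #1

  δ-Va : ∀ x → δ x (Va #0) + (δ x (Va #1) + δ x (Va #2)) ≡ δ (π x) (inj₁ #0)
  δ-Va (inj₁ #0)                  = refl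
  δ-Va (inj₁ #1)                  = refl
  δ-Va (inj₁ #2)                  = refl
  δ-Va (inj₁ (suc (suc (suc i)))) = refl
  δ-Va (inj₂ j)                   = refl

  δ-Vb : ∀ x → δ x (Vb #0) + (δ x (Vb #1) + δ x (Vb #2)) ≡ δ (π x) (inj₁ #0)
  δ-Vb (inj₁ #0)                  = refl
  δ-Vb (inj₁ #1)                  = refl
  δ-Vb (inj₁ #2)                  = refl
  δ-Vb (inj₁ (suc (suc (suc i)))) = refl
  δ-Vb (inj₂ j)                   = refl

  δ-ι : ∀ x u → u ≢ inj₁ #0 → δ x (ι u) ≡ δ (π x) u
  δ-ι x                    (inj₁ #0)      ne = contradiction refl ne
  δ-ι (inj₁ #0)            (inj₁ (suc i)) ne = refl
  δ-ι (inj₁ #1)            (inj₁ (suc i)) ne = refl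
  δ-ι (inj₁ (suc (suc j))) (inj₁ (suc i)) ne = refl
  δ-ι (inj₂ j)             (inj₁ (suc i)) ne = refl
  δ-ι (inj₁ #0)            (inj₂ i)       ne = refl
  δ-ι (inj₁ #1)            (inj₂ i)       ne = refl
  δ-ι (inj₁ (suc (suc j))) (inj₂ i)       ne = refl
  δ-ι (inj₂ j)             (inj₂ i)       ne = refl

  view-a : ∀ x → (∃[ i ] (x ≡ Va i)) ⊎ (π x ≢ inj₁ #0 × x ≡ ι (π x))
  view-a (inj₁ #0)                  = inj₁ (#0 , refl)
  view-a (inj₁ #1)                  = inj₁ (#1 , refl)
  view-a (inj₁ #2)                  = inj₁ (#2 , refl)
  view-a (inj₁ (suc (suc (suc i)))) = inj₂ ((λ ()) , refl)
  view-a (inj₂ j)                   = inj₂ ((λ ()) , refl)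

  view-b : ∀ x → (∃[ i ] (x ≡ Vb i)) ⊎ (π x ≢ inj₁ #0 × x ≡ ι (π x))
  view-b (inj₁ #0)                  = inj₁ (#0 , refl)
  view-b (inj₁ #1)                  = inj₁ (#2 , refl)
  view-b (inj₁ #2)                  = inj₁ (#1 , refl)
  view-b (inj₁ (suc (suc (suc i)))) = inj₂ ((λ ()) , refl)
  view-b (inj₂ j)                   = inj₂ ((λ ()) , refl)

  Va-others : ∀ c → Va (o₁ c) ≢ Va (o₂ c)
  Va-others #0 ()
  Va-others #1 ()
  Va-others #2 ()

  Vb-others : ∀ c → Vb (o₁ c) ≢ Vb (o₂ c)
  Vb-others #0 ()
  Vb-others #1 ()
  Vb-others #2 ()

module _ {A B : Set} {{_ : Eq A}} {{_ : Eq B}} where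

  Coloured-comm : ∀ S T → Coloured {A} {B} (T ++ S) → Coloured (S ++ T)
  Coloured-comm S T col c y = subst (_≤ 1)
    (trans (ncol-++ c T S y) (trans (ℕ.+-comm (ncol c T y) _) (sym (ncol-++ c S T y)))) (col c y)

  two-colours : ∀ {b u d u′ d′} → b ≢ d → d ≢ d′ → Coloured {A} {B} (((b , u , d) , #0) ∷ ((d , u′ , d′) , #1) ∷ [])
  two-colours {b} {d = d} ne ne′ #0 y with y ≟ b | y ≟ d
  ... | yes refl | yes refl = contradiction refl ne
  ... | yes _    | no _     = s≤s z≤n
  ... | no _     | yes _    = s≤s z≤n
  ... | no _     | no _     = z≤n
  two-colours {d = d} {d′ = d′} ne ne′ #1 y with y ≟ d | y ≟ d′
  ... | yes refl | yes refl = contradiction refl ne′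
  ... | yes _    | no _     = s≤s z≤n
  ... | no _     | yes _    = s≤s z≤n
  ... | no _     | no _     = z≤n
  two-colours ne ne′ #2 y = z≤n

  -- The surgery has to know which copies lie on which of the faces it removes. So two consecutive
  -- corners receive the colours 0 and 1 in advance, and `F` holds faces away from `v` that must
  -- stay in a known place.
  record Extended (v : A) (c₁ c₂ : Cor {A} {B}) (F L : List (Face A B)) : Set where
    constructor extended
    field
      colours  : List (CCor {A} {B})
      others   : List (Face A B)
    S : List (CCor {A} {B})
    S = (c₁ , #0) ∷ (c₂ , #1) ∷ colours
    field
      split    : (corner v c₁ ∷ corner v c₂ ∷ F ++ L) ≼ (map (corner v) (map proj₁ S) ++ F ++ others)
      proper   : All (Proper v) (map proj₁ S)
      avoid    : All (Avoids v) others
      coloured : Coloured S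
      distinct : All Distinct others

  abstract
    extend : ∀ {Γ : A → B → ℕ} v b u d u′ d′ F L → (∀ y → Γ v y ≤ 1) →
             Cert Γ (corner v (b , u , d) ∷ corner v (d , u′ , d′) ∷ F ++ L) →
             Proper v (b , u , d) → Proper v (d , u′ , d′) → All (Avoids v) F → All Distinct L →
             Extended v (b , u , d) (d , u′ , d′) F L
    extend {Γ} v b u d u′ d′ F L e≤1 C pr pr′ avF ds with star v (λ ()) L ds
    ... | star-at Cs Os sp prs avs with greedy S₀ Cs (two-colours {u = u} {u′ = u′} (proj₂ pr) (proj₂ pr′)) (All.map proj₂ prs) bound
      where
      S₀ : List (CCor {A} {B})
      S₀ = ((b , u , d) , #0) ∷ ((d , u′ , d′) , #1) ∷ []
      sp′ : (corner v (b , u , d) ∷ corner v (d , u′ , d′) ∷ F ++ L) ≼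
            (map (corner v) ((b , u , d) ∷ (d , u′ , d′) ∷ Cs) ++ F ++ Os)
      sp′ = same ∷ (same ∷ join (≼-++ F sp) (↭⇒≼ (Perm.shifts F (map (corner v) Cs))))
      bound : ∀ y → tot Cs y + tot (map proj₁ S₀) y ≤ 2
      bound y = subst (_≤ 2) (begin
        Γ v y + Γ v y                                   ≡⟨ sym (Cert.count C v y) ⟩
        _                                               ≡⟨ ≼-cnt sp′ v y ⟩
        _                                               ≡⟨ cnt-star v _ _ (pr ∷ pr′ ∷ prs) (All.++⁺ avF avs) y ⟩
        (δ y b + δ y d) + ((δ y d + δ y d′) + tot Cs y) ≡⟨ lemma (δ y b + δ y d) (δ y d + δ y d′) (tot Cs y) ⟩
        tot Cs y + ((δ y b + δ y d) + ((δ y d + δ y d′) + 0)) ∎) (ℕ.+-mono-≤ (e≤1 y) (e≤1 y))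
        where
        open ≡-Reasoning
        lemma : ∀ p q r → p + (q + r) ≡ r + (p + (q + 0))
        lemma = solve-∀
    ... | T , refl , col = extended T Os
          (same ∷ (same ∷ join (≼-++ F sp) (↭⇒≼ (Perm.shifts F (map (corner v) Cs)))))
          (pr ∷ pr′ ∷ prs) avs (Coloured-comm _ T col)
          (All.++⁻ʳ (map (corner v) Cs) (≼-Simple sp ds))

-- For the deleted pair v = s = inj₁ zero, the vertices w v a a₁ are consecutive around b, and b₁ b s z around a.
record Seed (k p q : ℕ) : Set where
  constructor seed
  field
    {a a₁ a₂ w} : Side (suc k) p
    {b b₁ b₂ z} : Side (suc k) q
    rest        : List (Face (Side (suc k) p) (Side (suc k) q))
  faces : List (Face (Side (suc k) p) (Side (suc k) q))
  faces = quad (inj₁ zero) b₁ a b ∷ quad (inj₁ zero) b w b₂ ∷ quad a₁ (inj₁ zero) a b ∷ quad a (inj₁ zero) a₂ z ∷ rest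
  field
    cert        : Cert E faces
    distinct    : All Distinct faces

-- The names 0 1 2 are the copies, then a a₁ a₂ w, resp. b b₁ b₂ z.  D₁ was found by computer search.
D₀ D₁ : List (Face (Fin 7) (Fin 7))
D₀ = quad #4 #0 #3 #3 ∷ quad #4 #1 #3 #2 ∷ quad #3 #1 #5 #6 ∷ quad #3 #0 #5 #2 ∷
     quad #0 #4 #3 #3 ∷ quad #1 #4 #2 #3 ∷ quad #1 #3 #6 #5 ∷ quad #0 #3 #2 #5 ∷ []
D₁ = quad #0 #3 #1 #1 ∷ quad #0 #1 #4 #2 ∷ quad #3 #0 #1 #1 ∷ quad #1 #0 #2 #4 ∷
     quad #0 #5 #2 #2 ∷ quad #2 #3 #3 #2 ∷ quad #0 #3 #3 #4 ∷ quad #3 #0 #5 #2 ∷ quad #2 #3 #4 #0 ∷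
     quad #1 #3 #6 #5 ∷ quad #3 #1 #5 #6 ∷ []

N₀ : List (Fin 7 × Fin 7)
N₀ = (#0 , #1) ∷ (#0 , #2) ∷ (#1 , #0) ∷ (#1 , #1) ∷ (#2 , #0) ∷ (#2 , #2) ∷ []

module Λ = Surgery {Fin 7} {Fin 7} 4 D₀ D₁ N₀

Λ-valid : T Λ.valid
Λ-valid = tt

-- These are the first seven faces of `D₁`; they make every surface produced by the surgery
-- non-orientable, whatever it was before.
twisted : T (unorientable (quad {Fin 7} {Fin 7} #0 #3 #1 #1 ∷ quad #0 #1 #4 #2 ∷ quad #3 #0 #1 #1 ∷ quad #1 #0 #2 #4 ∷
     quad #0 #5 #2 #2 ∷ quad #2 #3 #3 #2 ∷ quad #0 #3 #3 #4 ∷ []))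
twisted = tt

-- The variables stand for values of `δ` and are unrestricted, so the count also holds when some of
-- the named vertices coincide, as `a₁` and `w` do in `seed₄₀₀`.
Λ-balance : ∀ v₁ v₂ v₃ a a₁ a₂ w s₁ s₂ s₃ b b₁ b₂ z →
  let quad′ = λ x y z w → (x * y + z * w) + (z * y + x * w)
      new   = v₁ * s₂ + (v₁ * s₃ + (v₂ * s₁ + (v₂ * s₂ + (v₃ * s₁ + (v₃ * s₃ + 0))))) in
  quad′ v₁ b v₂ s₂ + (quad′ v₁ s₂ a₁ s₃ + (quad′ a s₁ v₂ s₂ + (quad′ v₂ s₁ v₃ b₁ + (quad′ v₁ b₂ v₃ s₃ +
    (quad′ v₃ b a s₃ + (quad′ v₁ b a b₁ + (quad′ a s₁ a₂ s₃ + (quad′ v₃ b a₁ s₁ + (quad′ v₂ b w b₂ + (quad′ a s₂ a₂ z + 0))))))))))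
  ≡ (quad′ a₁ s₁ a b + (quad′ a₁ s₂ a s₃ + (quad′ a s₂ a₂ z + (quad′ a s₁ a₂ s₃ +
    (quad′ v₁ b₁ a b + (quad′ v₂ b₁ v₃ b + (quad′ v₂ b w b₂ + (quad′ v₁ b v₃ b₂ + 0)))))))) + (new + new)
Λ-balance = solve-∀

module _ {k p q : ℕ} where
  open Matched

  module DA = Duplicate {B = Side (suc k) q} (inj₁ #0) Va (ι {k} {p}) π δ-Va δ-ι view-a Va-others
  module DB = Duplicate {B = Side (3 + k) p} (inj₁ #0) Vb (ι {k} {q}) π δ-Vb δ-ι view-b Vb-others

  new-edges : ∀ (g : Fin 7 → Side (3 + k) p) (h : Fin 7 → Side (3 + k) q) →
    (∀ i → g (i Fin.↑ˡ 4) ≡ Va i) → (∀ i → h (i Fin.↑ˡ 4) ≡ Vb i) →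
    ∀ x y → E (π x) (π y) + sides g h N₀ x y ≡ E x y
  new-edges g h eg eh x y rewrite eg #0 | eg #1 | eg #2 | eh #0 | eh #1 | eh #2 = go x y
    where
    go : ∀ (x : Side (3 + k) p) (y : Side (3 + k) q) → E (π x) (π y) +
         (δ x (Va #0) * δ y (Vb #1) + (δ x (Va #0) * δ y (Vb #2) + (δ x (Va #1) * δ y (Vb #0) +
         (δ x (Va #1) * δ y (Vb #1) + (δ x (Va #2) * δ y (Vb #0) + (δ x (Va #2) * δ y (Vb #2) + 0)))))) ≡ E x y
    go (inj₁ #0) (inj₁ #0) = refl
    go (inj₁ #0) (inj₁ #1) = refl
    go (inj₁ #0) (inj₁ #2) = refl
    go (inj₁ #0) (inj₁ (suc (suc (suc j)))) = refl
    go (inj₁ #0) (inj₂ j) = refl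
    go (inj₁ #1) (inj₁ #0) = refl
    go (inj₁ #1) (inj₁ #1) = refl
    go (inj₁ #1) (inj₁ #2) = refl
    go (inj₁ #1) (inj₁ (suc (suc (suc j)))) = refl
    go (inj₁ #1) (inj₂ j) = refl
    go (inj₁ #2) (inj₁ #0) = refl
    go (inj₁ #2) (inj₁ #1) = refl
    go (inj₁ #2) (inj₁ #2) = refl
    go (inj₁ #2) (inj₁ (suc (suc (suc j)))) = refl
    go (inj₁ #2) (inj₂ j) = refl
    go (inj₁ (suc (suc (suc i)))) (inj₁ #0) = refl
    go (inj₁ (suc (suc (suc i)))) (inj₁ #1) = refl
    go (inj₁ (suc (suc (suc i)))) (inj₁ #2) = refl
    go (inj₁ (suc (suc (suc i)))) (inj₁ (suc (suc (suc j)))) = ℕ.+-identityʳ _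
    go (inj₁ (suc (suc (suc i)))) (inj₂ j) = refl
    go (inj₂ i) (inj₁ #0) = refl
    go (inj₂ i) (inj₁ #1) = refl
    go (inj₂ i) (inj₁ #2) = refl
    go (inj₂ i) (inj₁ (suc (suc (suc j)))) = refl
    go (inj₂ i) (inj₂ j) = refl

  -- The vertex v is tripled on one side, s on the other after a flip, and `Λ` then replaces `D₀` by
  -- `D₁`. The new deleted pair consists of the copies numbered 0.
  grow-seed : Seed k p q → Σ (Seed (2 + k) p q) λ s → ¬ Coherent (Seed.faces s)
  grow-seed sd@(seed {a} {a₁} {a₂} {w} {b} {b₁} {b₂} {z} rest C ((v≢a , b₁≢b) ∷ (v≢w , b≢b₂) ∷ (a₁≢a , s≢b) ∷ (a≢a₂ , s≢z) ∷ ds))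
    -- The deleted pair has no sides, so no quadrilateral contains both of its vertices. This
    -- separates `b₁` and `b₂` from s, and `a₁` and `a₂` from v.
    with absent {L = Seed.faces sd} {inj₁ zero} {inj₁ zero} (Cert.count C (inj₁ zero) (inj₁ zero))
  ... | z₁ ∷ z₂ ∷ z₃ ∷ z₄ ∷ _ =
    -- The first four faces of `D₁` are again in seed position: `Va #1` and `Vb #1` become the new a
    -- and b, and the old a, a₁, b, b₁ become the new a₁, w, b₁, z.
    seed (map (mapF g h) D₂ ++ R) C₅
      ( ((λ ()) , DB.V≢ι #1 b≢s ∘ sym)
      ∷ (DA.V≢ι #0 a₁≢v , (λ ()))
      ∷ (DA.V≢ι #1 a≢v ∘ sym , (λ ()))
      ∷ ((λ ()) , DB.V≢ι #0 b₁≢s)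
      ∷ ((λ ()) , DB.V≢ι #2 b₂≢s ∘ sym)
      ∷ (DA.V≢ι #2 a≢v , DB.V≢ι #2 b≢s ∘ sym)
      ∷ (DA.V≢ι #0 a≢v , ιb≢ιb₁)
      ∷ (ιa≢ιa₂ , (λ ()))
      ∷ (DA.V≢ι #2 a₁≢v , DB.V≢ι #0 b≢s ∘ sym)
      ∷ (DA.V≢ι #1 w≢v , ιb≢ιb₂)
      ∷ (ιa≢ιa₂ , DB.V≢ι #1 z≢s)
      ∷ All.map⁺ (All.map (λ {f} → Simple-flip f)
          (DB.dup-Simple (λ ()) X₂.colours X₂.others (All.tail (All.tail X₂.proper)) X₂.distinct X₂.avoid)))
    , unorientable-sound g h W twisted
    where
    v = inj₁ zero
    s = inj₁ zero
    a≢v : a ≢ v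
    a≢v = v≢a ∘ sym
    w≢v : w ≢ v
    w≢v = v≢w ∘ sym
    b≢s : b ≢ s
    b≢s = s≢b ∘ sym
    z≢s : z ≢ s
    z≢s = s≢z ∘ sym
    b₁≢s : b₁ ≢ s
    b₁≢s eq = no-side {a = v} {a} {v} {b₁} {b} {s} z₁ (inj₁ refl) (inj₁ eq)
    b₂≢s : b₂ ≢ s
    b₂≢s eq = no-side {a = v} {w} {v} {b} {b₂} {s} z₂ (inj₁ refl) (inj₂ eq)
    a₁≢v : a₁ ≢ v
    a₁≢v eq = no-side {a = a₁} {a} {v} {s} {b} {s} z₃ (inj₁ eq) (inj₁ refl)
    a₂≢v : a₂ ≢ v
    a₂≢v eq = no-side {a = a} {a₂} {v} {s} {z} {s} z₄ (inj₂ eq) (inj₁ refl)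
    W D₂ : List (Face (Fin 7) (Fin 7))
    W  = take 7 D₁
    D₂ = drop 4 D₁
    g : Fin 7 → Side (3 + k) p
    g = lookup (Va #0 ∷ Va #1 ∷ Va #2 ∷ ι a ∷ ι a₁ ∷ ι a₂ ∷ ι w ∷ [])
    h : Fin 7 → Side (3 + k) q
    h = lookup (Vb #0 ∷ Vb #1 ∷ Vb #2 ∷ ι b ∷ ι b₁ ∷ ι b₂ ∷ ι z ∷ [])
    module X₁ = Extended (extend v b₁ a b w b₂ (quad a₁ s a b ∷ quad a s a₂ z ∷ []) rest (E≤1 v) C
      (a≢v , b₁≢b) (w≢v , b≢b₂) ((a₁≢v , a≢v) ∷ (a≢v , a₂≢v) ∷ []) ds)
    M₁ M₂ : List (Face (Side (3 + k) p) (Side (suc k) q))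
    M₁ = concatMap DA.copies X₁.colours
    M₂ = map (mapF ι id) X₁.others
    heads : List (Face (Side (3 + k) p) (Side (suc k) q))
    heads = quad (Va #0) b₁ (ι a) b ∷ quad (Va #1) b₁ (Va #2) b ∷ quad (Va #1) b (ι w) b₂ ∷ quad (Va #0) b (Va #2) b₂ ∷ []
    C₁ : Cert (λ x y → E (π x) y) (quad (ι a₁) s (ι a) b ∷ quad (ι a) s (ι a₂) z ∷ heads ++ M₁ ++ M₂)
    C₁ = ≼-Cert (↭⇒≼ (Perm.shifts (heads ++ M₁) (quad (ι a₁) s (ι a) b ∷ quad (ι a) s (ι a₂) z ∷ [])))
      (DA.dup-Cert X₁.S (quad a₁ s a b ∷ quad a s a₂ z ∷ X₁.others) (E≤1 v) (≼-Cert X₁.split C) X₁.proper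
        ((a₁≢v , a≢v) ∷ (a≢v , a₂≢v) ∷ X₁.avoid) X₁.coloured)
    ds₁ : All Distinct (map flip (M₁ ++ M₂))
    ds₁ = All.map⁺ (All.map (λ {f} → Simple-flip f) (DA.dup-Simple (λ ()) X₁.colours X₁.others (All.tail (All.tail X₁.proper)) X₁.distinct X₁.avoid))
    ιa₁≢ιa : ι a₁ ≢ ι a
    ιa₁≢ιa eq = a₁≢a (trans (sym (DA.π-ι a₁≢v)) (trans (cong π eq) (DA.π-ι (a≢v))))
    ιa≢ιa₂ : ι a ≢ ι a₂
    ιa≢ιa₂ eq = a≢a₂ (trans (sym (DA.π-ι (a≢v))) (trans (cong π eq) (DA.π-ι a₂≢v)))
    ιb≢ιb₁ : ι b ≢ ι b₁
    ιb≢ιb₁ eq = b₁≢b (trans (sym (DB.π-ι b₁≢s)) (trans (cong π (sym eq)) (DB.π-ι (b≢s))))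
    ιb≢ιb₂ : ι b ≢ ι b₂
    ιb≢ιb₂ eq = b≢b₂ (trans (sym (DB.π-ι (b≢s))) (trans (cong π eq) (DB.π-ι b₂≢s)))
    C₁′ = flip-Cert C₁
    avoid₂ : All (Avoids s) (map flip heads)
    avoid₂ = (b₁≢s , b≢s) ∷ (b₁≢s , b≢s) ∷ (b≢s , b₂≢s) ∷ (b≢s , b₂≢s) ∷ []
    module X₂ = Extended (extend s (ι a₁) b (ι a) z (ι a₂) (map flip heads) (map flip (M₁ ++ M₂)) (λ x → E≤1 (π x) s) C₁′
      (b≢s , ιa₁≢ιa) (z≢s , ιa≢ιa₂) avoid₂ ds₁)
    M₃ M₄ : List (Face (Side (3 + k) q) (Side (3 + k) p))
    M₃ = concatMap DB.copies X₂.colours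
    M₄ = map (mapF ι id) X₂.others
    R : List (Face (Side (3 + k) p) (Side (3 + k) q))
    R = map flip (M₃ ++ M₄)
    C₂ = DB.dup-Cert X₂.S (map flip heads ++ X₂.others) (λ x → E≤1 (π x) s) (≼-Cert X₂.split C₁′) X₂.proper
        (All.++⁺ avoid₂ X₂.avoid) X₂.coloured
    -- With colours 0 and 1 at the prescribed corners, the four faces of the seed have turned into
    -- exactly the eight faces of `D₀`.
    C₃ : Cert (λ x y → E (π x) (π y)) (map (mapF g h) D₀ ++ R)
    C₃ = flip-Cert (≼-Cert (same ∷ (same ∷ (same ∷ (same ∷ ↭⇒≼ (Perm.shifts M₃ (map (mapF ι id) (map flip heads))))))) C₂)
    C₅ : Cert E (map (mapF g h) D₁ ++ R)
    C₅ = Cert-cong (new-edges g h (λ { #0 → refl ; #1 → refl ; #2 → refl }) (λ { #0 → refl ; #1 → refl ; #2 → refl }))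
      (Λ.operate Λ-valid g h (λ x y → Λ-balance (δ x (g #0)) (δ x (g #1)) (δ x (g #2)) (δ x (g #3)) (δ x (g #4)) (δ x (g #5)) (δ x (g #6))
                                             (δ y (h #0)) (δ y (h #1)) (δ y (h #2)) (δ y (h #3)) (δ y (h #4)) (δ y (h #5)) (δ y (h #6))) C₃)

-- Enlarging one side

-- The vertex to be tripled is always the first unmatched one.
Free : ∀ {k p} → Side k p → Set
Free (inj₂ zero) = ⊥
Free _           = ⊤

Free⇒≢ : ∀ {k p} {x : Side k (suc p)} → Free x → x ≢ inj₂ zero
Free⇒≢ () refl

module Unmatched {k p : ℕ} where

  ι : Side k (suc p) → Side k (3 + p)
  ι (inj₁ i) = inj₁ i
  ι (inj₂ j) = inj₂ (suc (suc j))

  π : Side k (3 + p) → Side k (suc p)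
  π (inj₁ i)             = inj₁ i
  π (inj₂ #0)            = inj₂ #0
  π (inj₂ #1)            = inj₂ #0
  π (inj₂ (suc (suc j))) = inj₂ j

  Vu : Fin 3 → Side k (3 + p)
  Vu #0 = inj₂ #0
  Vu #1 = inj₂ #1
  Vu #2 = inj₂ #2

  δ-V : ∀ x → δ x (Vu #0) + (δ x (Vu #1) + δ x (Vu #2)) ≡ δ (π x) (inj₂ #0)
  δ-V (inj₂ #0)                  = refl
  δ-V (inj₂ #1)                  = refl
  δ-V (inj₂ #2)                  = refl
  δ-V (inj₂ (suc (suc (suc i)))) = refl
  δ-V (inj₁ j)                   = refl

  δ-ι : ∀ x u → u ≢ inj₂ #0 → δ x (ι u) ≡ δ (π x) u
  δ-ι x                    (inj₂ #0)      ne = contradiction refl ne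
  δ-ι (inj₂ #0)            (inj₂ (suc i)) ne = refl
  δ-ι (inj₂ #1)            (inj₂ (suc i)) ne = refl
  δ-ι (inj₂ (suc (suc j))) (inj₂ (suc i)) ne = refl
  δ-ι (inj₁ j)             (inj₂ (suc i)) ne = refl
  δ-ι (inj₂ #0)            (inj₁ i)       ne = refl
  δ-ι (inj₂ #1)            (inj₁ i)       ne = refl
  δ-ι (inj₂ (suc (suc j))) (inj₁ i)       ne = refl
  δ-ι (inj₁ j)             (inj₁ i)       ne = refl

  view : ∀ x → (∃[ i ] (x ≡ Vu i)) ⊎ (π x ≢ inj₂ #0 × x ≡ ι (π x))
  view (inj₂ #0)                  = inj₁ (#0 , refl)
  view (inj₂ #1)                  = inj₁ (#1 , refl)
  view (inj₂ #2)                  = inj₁ (#2 , refl)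
  view (inj₂ (suc (suc (suc i)))) = inj₂ ((λ ()) , refl)
  view (inj₁ j)                   = inj₂ ((λ ()) , refl)

  Vu-others : ∀ c → Vu (o₁ c) ≢ Vu (o₂ c)
  Vu-others #0 ()
  Vu-others #1 ()
  Vu-others #2 ()

  -- `ι` shifts the unmatched vertices by two, so no old vertex lands in the first place; hexagons
  -- still avoid it, and tripling can be repeated.
  Free-ι : ∀ u → Free (ι u)
  Free-ι (inj₁ _) = tt
  Free-ι (inj₂ _) = tt

  E-π : ∀ {q} x (y : Side k q) → E (π x) y ≡ E x y
  E-π (inj₁ i)             y = lemma i y
    where
    lemma : ∀ {p p′ q} (i : Fin k) (y : Side k q) → E {k} {p} (inj₁ i) y ≡ E {k} {p′} (inj₁ i) y
    lemma i (inj₁ j) = refl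
    lemma i (inj₂ j) = refl
  E-π (inj₂ #0)            y = refl
  E-π (inj₂ #1)            y = refl
  E-π (inj₂ (suc (suc j))) y = refl

hexes : ∀ {A B : Set} → List (Face A B) → ℕ
hexes []                     = 0
hexes (quad _ _ _ _ ∷ L)     = hexes L
hexes (hexa _ _ _ _ _ _ ∷ L) = suc (hexes L)

hexes-++ : ∀ {A B : Set} (K L : List (Face A B)) → hexes (K ++ L) ≡ hexes K + hexes L
hexes-++ []                         L = refl
hexes-++ (quad _ _ _ _ ∷ K)     L = hexes-++ K L
hexes-++ (hexa _ _ _ _ _ _ ∷ K) L = cong suc (hexes-++ K L)

hexes-map : ∀ {A A′ B B′ : Set} (g : A → A′) (h : B → B′) L → hexes (map (mapF g h) L) ≡ hexes L
hexes-map g h []                     = refl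
hexes-map g h (quad _ _ _ _ ∷ L)     = hexes-map g h L
hexes-map g h (hexa _ _ _ _ _ _ ∷ L) = cong suc (hexes-map g h L)

hexes-flip : ∀ {A B : Set} (L : List (Face A B)) → hexes (map flip L) ≡ hexes L
hexes-flip []                     = refl
hexes-flip (quad _ _ _ _ ∷ L)     = hexes-flip L
hexes-flip (hexa _ _ _ _ _ _ ∷ L) = cong suc (hexes-flip L)

hexes-corners : ∀ {A B : Set} (v : A) (R : List (Cor {A} {B})) O → hexes (map (corner v) R ++ O) ≡ hexes O
hexes-corners v []      O = refl
hexes-corners v (_ ∷ R) O = hexes-corners v R O

hexes-≼ : ∀ {A B : Set} {{_ : Eq A}} {{_ : Eq B}} {L M : List (Face A B)} → L ≼ M → hexes L ≡ hexes M
hexes-≼ [] = refl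
hexes-≼ (_∷_ {quad _ _ _ _}     same  p) = hexes-≼ p
hexes-≼ (_∷_ {hexa _ _ _ _ _ _} same  p) = cong suc (hexes-≼ p)
hexes-≼ (swapA ∷ p) = hexes-≼ p
hexes-≼ (swapB ∷ p) = hexes-≼ p
hexes-≼ (swap {quad _ _ _ _}     {quad _ _ _ _})     = refl
hexes-≼ (swap {quad _ _ _ _}     {hexa _ _ _ _ _ _}) = refl
hexes-≼ (swap {hexa _ _ _ _ _ _} {quad _ _ _ _})     = refl
hexes-≼ (swap {hexa _ _ _ _ _ _} {hexa _ _ _ _ _ _}) = refl
hexes-≼ (join p q) = trans (hexes-≼ p) (hexes-≼ q)

-- Ok true: the first unmatched vertex lies on no hexagon.
Ok : Bool → ∀ {k p} → Side k p → Set
Ok true  = Free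
Ok false = λ _ → ⊤

record Embedded (t : ℕ) (α β : Bool) (k p q : ℕ) : Set where
  constructor embedded
  field
    faces     : List (Face (Side k p) (Side k q))
    cert      : Cert E faces
    simple    : All (Simple (Ok α) (Ok β)) faces
    hexagonal : hexes faces ≡ t

NonOrientable : ∀ {t α β k p q} → Embedded t α β k p q → Set
NonOrientable M = ¬ Coherent (Embedded.faces M)

-- Consecutive corners around a vertex

module _ {A B : Set} {{_ : Eq A}} {{_ : Eq B}} (v : A) where

  record Extracted (y : B) (R : List (Cor {A} {B})) : Set where
    constructor extracted
    field
      {u}    : A
      {d}    : B
      rest   : List (Cor {A} {B})
      split  : map (corner v) R ≼ (corner v (y , u , d) ∷ map (corner v) rest)
      proper : All (Proper v) R → All (Proper v) ((y , u , d) ∷ rest)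
      total  : ∀ z → tot R z ≡ (δ z y + δ z d) + tot rest z

  extract : ∀ y R → 0 < tot R y → Extracted y R
  extract y ((b , u , d) ∷ R) lt with y ≟ b | y ≟ d
  ... | yes refl | _        = extracted R ≼-refl id (λ z → refl)
  ... | no _     | yes refl = extracted R (swapB ∷ ≼-refl) (λ { ((p , q) ∷ ps) → (p , q ∘ sym) ∷ ps })
                                (λ z → cong (_+ tot R z) (ℕ.+-comm (δ z b) _))
  ... | no _     | no _ with extract y R lt
  ...   | extracted {u′} {d′} R′ sp pr to = extracted ((b , u , d) ∷ R′) (join (same ∷ sp) swap)
            (λ { (p ∷ ps) → let q = pr ps in All.head q ∷ p ∷ All.tail q })
            (λ z → trans (cong (δ z b + δ z d +_) (to z)) (lemma (δ z b + δ z d) (δ z y + δ z d′) (tot R′ z)))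
    where
    lemma : ∀ p q r → p + (q + r) ≡ q + (p + r)
    lemma = solve-∀

  ≼-++ʳ : ∀ {L M : List (Face A B)} K → L ≼ M → (L ++ K) ≼ (M ++ K)
  ≼-++ʳ K []         = ≼-refl
  ≼-++ʳ K (r ∷ p)    = r ∷ ≼-++ʳ K p
  ≼-++ʳ K swap       = swap
  ≼-++ʳ K (join p q) = join (≼-++ʳ K p) (≼-++ʳ K q)

  Link-tot : ∀ {R : List (Cor {A} {B})} {O : List (Face A B)} {x y : B} → All (Proper v) R → All (Avoids v) O → Link (map (corner v) R ++ O) v x y → 0 < tot R x
  Link-tot {[]} {O = f ∷ O} pr (av ∷ avs) (here c) = contradiction c (Avoids-Corner av)
  Link-tot {[]} pr (av ∷ avs) (there l) = Link-tot {[]} pr avs l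
  Link-tot {(b , u , d) ∷ R} pr av (here q₁) rewrite δ-refl b = s≤s z≤n
  Link-tot {(b , u , d) ∷ R} pr av (here q₂) rewrite δ-refl d = ℕ.m≤n⇒m≤n+o _ (ℕ.m≤n+m 1 (δ d b))
  Link-tot {(b , u , d) ∷ R} ((p , _) ∷ _) av (here q₃) = contradiction refl p
  Link-tot {(b , u , d) ∷ R} ((p , _) ∷ _) av (here q₄) = contradiction refl p
  Link-tot {_ ∷ R} (_ ∷ pr) av (there l) = ℕ.≤-trans (Link-tot {R} pr av l) (ℕ.m≤n+m _ _)

  -- Three successive corners around `v`. The last end `b₃` may be `b₀` again, which happens at
  -- degree three.
  record Run (R : List (Cor {A} {B})) : Set where
    constructor run
    field
      {b₀ b₁ b₂ b₃} : B
      {u₁ u₂ u₃}    : A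
      rest          : List (Cor {A} {B})
    S₀ : List (CCor {A} {B})
    S₀ = ((b₀ , u₁ , b₁) , #0) ∷ ((b₁ , u₂ , b₂) , #1) ∷ ((b₂ , u₃ , b₃) , #2) ∷ []
    field
      split  : map (corner v) R ≼ (map (corner v) (map proj₁ S₀) ++ map (corner v) rest)
      proper : All (Proper v) (map proj₁ S₀ ++ rest)
      total  : ∀ z → tot R z ≡ tot (map proj₁ S₀) z + tot rest z

  private
    two∸ : ∀ {x t : ℕ} → 2 ≡ x + t → x ≡ 1 → t ≡ 1
    two∸ refl refl = refl

    δ-01 : ∀ {x y : B} → x ≢ y → δ y x + δ y y ≡ 1
    δ-01 {x} {y} ne = cong₂ _+_ (δ-≢ (ne ∘ sym)) (δ-refl y)

    δ-10 : ∀ {x y : B} → x ≢ y → δ x x + δ x y ≡ 1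
    δ-10 {x} {y} ne = cong₂ _+_ (δ-refl x) (δ-≢ ne)

  find-run : ∀ R O → All (Proper v) R → All (Avoids v) O → (∀ y → tot R y ≡ 2) →
             (∀ y y′ → Star (Link (map (corner v) R ++ O) v) y y′) →
             ∀ y₀ → (∀ y₁ → ∃[ t ] (t ≢ y₀ × t ≢ y₁)) → Run R
  find-run R O pr av two conn y₀ away with extract y₀ R (subst (0 <_) (sym (two y₀)) z<s)
  ... | extracted {u₁} {y₁} R₁ sp₁ pr₁ to₁ with pr₁ pr
  ... | (p₁ , y₀≢y₁) ∷ prs₁ with trans (sym (two y₁)) (to₁ y₁)
  ... | e₁ with extract y₁ R₁ (subst (0 <_) (sym (two∸ e₁ (δ-01 y₀≢y₁))) z<s)
  ... | extracted {u₂} {y₂} R₂ sp₂ pr₂ to₂ with pr₂ prs₁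
  ... | (p₂ , y₁≢y₂) ∷ prs₂ with y₂ ≟ y₀
  -- Returning after two corners would use up both sides at `y₀` and at `y₁`, so no link could leave
  -- these two; but the link is connected and contains a third vertex.
  ... | yes refl = ⊥-elim (escape (proj₂ (away y₁)))
    where
    none : ∀ {x} → x ≡ y₀ ⊎ x ≡ y₁ → tot R₂ x ≡ 0
    none (inj₁ refl) = ℕ.+-cancelˡ-≡ 2 _ _ (trans (sym (lemma (δ-10 y₀≢y₁) (δ-01 y₁≢y₂))) (trans (sym (trans (to₁ y₀) (cong (δ y₀ y₀ + δ y₀ y₁ +_) (to₂ y₀)))) (two y₀)))
      where
      lemma : ∀ {p q r} → p ≡ 1 → q ≡ 1 → p + (q + r) ≡ 2 + r
      lemma refl refl = refl
    none (inj₂ refl) = ℕ.+-cancelˡ-≡ 2 _ _ (trans (sym (lemma (δ-01 y₀≢y₁) (δ-10 y₁≢y₂))) (trans (sym (trans (to₁ y₁) (cong (δ y₁ y₀ + δ y₁ y₁ +_) (to₂ y₁)))) (two y₁)))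
      where
      lemma : ∀ {p q r} → p ≡ 1 → q ≡ 1 → p + (q + r) ≡ 2 + r
      lemma refl refl = refl
    stay : ∀ {x y} → Link (corner v (y₀ , u₁ , y₁) ∷ corner v (y₁ , u₂ , y₀) ∷ map (corner v) R₂ ++ O) v x y →
           x ≡ y₀ ⊎ x ≡ y₁ → y ≡ y₀ ⊎ y ≡ y₁
    stay (here q₁) _ = inj₂ refl
    stay (here q₂) _ = inj₁ refl
    stay (here q₃) _ = inj₂ refl
    stay (here q₄) _ = inj₁ refl
    stay (there (here q₁)) _ = inj₁ refl
    stay (there (here q₂)) _ = inj₂ refl
    stay (there (here q₃)) _ = inj₁ refl
    stay (there (here q₄)) _ = inj₂ refl
    stay (there (there l)) s = contradiction (sym (none s)) (ℕ.<⇒≢ (Link-tot {R₂} prs₂ av l))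
    stay* : ∀ {x y} → Star (Link (map (corner v) R ++ O) v) x y → x ≡ y₀ ⊎ x ≡ y₁ → y ≡ y₀ ⊎ y ≡ y₁
    stay* ε s = s
    stay* (l ◅ ls) s = stay* ls (stay (≼-Link (≼-++ʳ O (join sp₁ (same ∷ sp₂))) l) s)
    escape : (proj₁ (away y₁) ≢ y₀ × proj₁ (away y₁) ≢ y₁) → ⊥
    escape (n₀ , n₁) with stay* (conn y₀ (proj₁ (away y₁))) (inj₁ refl)
    ... | inj₁ eq = n₀ eq
    ... | inj₂ eq = n₁ eq
  ... | no y₂≢y₀ with extract y₂ R₂ (subst (0 <_) (sym (two∸ e₂ (δ-01 y₁≢y₂))) z<s)
    where
    e₂ : 2 ≡ (δ y₂ y₁ + δ y₂ y₂) + tot R₂ y₂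
    e₂ = trans (sym (two y₂)) (trans (to₁ y₂) (trans (cong₂ (λ s t → (s + t) + tot R₁ y₂) (δ-≢ y₂≢y₀) (δ-≢ (y₁≢y₂ ∘ sym))) (to₂ y₂)))
  ... | extracted R₃ sp₃ pr₃ to₃ with pr₃ prs₂
  ... | p₃ ∷ prs₃ = run R₃ (join sp₁ (same ∷ join sp₂ (same ∷ sp₃))) ((p₁ , y₀≢y₁) ∷ (p₂ , y₁≢y₂) ∷ p₃ ∷ prs₃)
        (λ z → trans (to₁ z) (trans (cong (δ z y₀ + δ z y₁ +_) (trans (to₂ z) (cong (δ z y₁ + δ z y₂ +_) (to₃ z))))
          (lemma (δ z y₀ + δ z y₁) (δ z y₁ + δ z y₂) _ (tot R₃ z))))
    where
    lemma : ∀ p q r s → p + (q + (r + s)) ≡ (p + (q + (r + 0))) + s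
    lemma = solve-∀

-- What `copies` makes of a run coloured 0, 1, 2. The three quadrilaterals between copies, together
-- with the one that keeps the middle corner, close up to a Möbius band.
three-corners : List (Face (Fin 6) (Fin 4))
three-corners = quad #0 #0 #3 #1 ∷ quad #1 #0 #2 #1 ∷ quad #1 #1 #4 #2 ∷ quad #0 #1 #2 #2 ∷
                quad #2 #2 #5 #3 ∷ quad #0 #2 #1 #3 ∷ []

three-corners-twisted : T (unorientable three-corners)
three-corners-twisted = tt

module _ {k p q : ℕ} where
  open Unmatched {k} {p}

  module DF = Duplicate {B = Side k q} (inj₂ #0) Vu ι π δ-V δ-ι view Vu-others

  hexes-dup : ∀ S O → hexes (DF.dup S O) ≡ hexes O
  hexes-dup []      O = hexes-map ι id O
  hexes-dup (_ ∷ S) O = hexes-dup S O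

  triple : ∀ {t β} → Embedded t true β k (suc p) q → Embedded t true β k (3 + p) q
  triple (embedded L C si hx) with star (inj₂ #0) Free⇒≢ L si
  ... | star-at Cs Os sp pr av with greedy [] Cs (λ _ _ → z≤n) (All.map proj₂ pr) (λ y →
        ℕ.≤-reflexive (trans (ℕ.+-identityʳ _) (trans (sym (cnt-star (inj₂ #0) Cs Os pr av y)) (trans (sym (≼-cnt sp (inj₂ #0) y)) (Cert.count C (inj₂ #0) y)))))
  ... | S , refl , col = embedded (DF.dup S Os)
        (Cert-cong E-π (DF.dup-Cert S Os (E≤1 {k} {suc p} {q} (inj₂ #0)) (≼-Cert sp C) pr av (λ c y → subst (_≤ 1) (trans (ncol-++ c S [] y) (ℕ.+-identityʳ _)) (col c y))))
        (DF.dup-Simple (λ {u} _ → Free-ι u) S Os pr (All.++⁻ʳ (map (corner (inj₂ #0)) (map proj₁ S)) (≼-Simple sp si)) av)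
        (trans (hexes-dup S Os) (trans (sym (trans (hexes-≼ sp) (hexes-corners _ (map proj₁ S) Os))) hx))

  -- Precolouring a run with all three colours makes the result non-orientable even over a sphere.
  -- The injection `f` ensures the degree of at least three that a run requires.
  triple-twist : (f : Fin 3 → Side k q) → (∀ {i j} → f i ≡ f j → i ≡ j) → ∀ {t β} → Embedded t true β k (suc p) q → Σ (Embedded t true β k (3 + p) q) NonOrientable
  triple-twist f inj (embedded L C si hx) with star (inj₂ #0) Free⇒≢ L si
  ... | star-at Cs Os sp pr av
    with find-run (inj₂ #0) Cs Os pr av
           (λ y → trans (sym (cnt-star (inj₂ #0) Cs Os pr av y)) (trans (sym (≼-cnt sp (inj₂ #0) y)) (Cert.count C (inj₂ #0) y)))
           (λ y y′ → Star.map (≼-Link sp) (Cert.link C (inj₂ #0) y y′ z<s z<s)) (f #0) away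
    where
    away : ∀ y₁ → ∃[ t ] (t ≢ f #0 × t ≢ y₁)
    away y₁ with f #1 ≟ y₁
    ... | no ne    = f #1 , (λ eq → contradiction (inj eq) (λ ())) , ne
    ... | yes refl = f #2 , (λ eq → contradiction (inj eq) (λ ())) , (λ eq → contradiction (inj eq) (λ ()))
  ... | run {b₀} {b₁} {b₂} {b₃} {u₁} {u₂} {u₃} R sp′ pr′ to with greedy S₀ R coloured₀ (All.map proj₂ (All.++⁻ʳ (map proj₁ S₀) pr′)) bound
    where
    S₀ : List (CCor {Side k (suc p)} {Side k q})
    S₀ = ((b₀ , u₁ , b₁) , #0) ∷ ((b₁ , u₂ , b₂) , #1) ∷ ((b₂ , u₃ , b₃) , #2) ∷ []
    single : ∀ {b d : Side k q} y → b ≢ d → δ y b + δ y d ≤ 1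
    single {b} {d} y ne with y ≟ b | y ≟ d
    ... | yes refl | yes refl = contradiction refl ne
    ... | yes _    | no _     = s≤s z≤n
    ... | no _     | yes _    = s≤s z≤n
    ... | no _     | no _     = z≤n
    ≤1 : ∀ {x y} → x ≡ y → y ≤ 1 → x ≤ 1
    ≤1 refl le = le
    coloured₀ : Coloured S₀
    coloured₀ #0 y = ≤1 (trans (ℕ.+-identityʳ _) (ℕ.+-identityʳ _)) (single y (proj₂ (All.head pr′)))
    coloured₀ #1 y = ≤1 (trans (ℕ.+-identityʳ _) (ℕ.+-identityʳ _)) (single y (proj₂ (All.head (All.tail pr′))))
    coloured₀ #2 y = ≤1 (trans (ℕ.+-identityʳ _) (ℕ.+-identityʳ _)) (single y (proj₂ (All.head (All.tail (All.tail pr′)))))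
    bound : ∀ y → tot R y + tot (map proj₁ S₀) y ≤ 2
    bound y = ℕ.≤-reflexive (trans (ℕ.+-comm (tot R y) _) (trans (sym (to y))
      (trans (sym (cnt-star (inj₂ #0) Cs Os pr av y)) (trans (sym (≼-cnt sp (inj₂ #0) y)) (Cert.count C (inj₂ #0) y)))))
  ... | T , refl , col = embedded (DF.dup S Os)
        (Cert-cong E-π (DF.dup-Cert S Os (E≤1 {k} {suc p} {q} (inj₂ #0)) (≼-Cert sp″ C) pr′ av (Coloured-comm (take 3 S) T col)))
        (DF.dup-Simple (λ {u} _ → Free-ι u) S Os pr′ (All.++⁻ʳ (map (corner (inj₂ #0)) (map proj₁ S)) (≼-Simple sp″ si)) av)
        (trans (hexes-dup S Os) (trans (sym (trans (hexes-≼ sp″) (hexes-corners _ (map proj₁ S) Os))) hx))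
      , unorientable-sound (lookup (Vu #0 ∷ Vu #1 ∷ Vu #2 ∷ ι u₁ ∷ ι u₂ ∷ ι u₃ ∷ [])) (lookup (b₀ ∷ b₁ ∷ b₂ ∷ b₃ ∷ [])) three-corners three-corners-twisted
    where
    S : List (CCor {Side k (suc p)} {Side k q})
    S = ((b₀ , u₁ , b₁) , #0) ∷ ((b₁ , u₂ , b₂) , #1) ∷ ((b₂ , u₃ , b₃) , #2) ∷ T
    sp″ = join sp (≼-++ʳ (inj₂ #0) Os sp′)

-- Transposing, deleting and relabelling

E-sym : ∀ {k p q} (x : Side k p) (y : Side k q) → E x y ≡ E y x
E-sym (inj₁ i) (inj₁ j) with i Fin.≟ j | j Fin.≟ i
... | yes _    | yes _  = refl
... | yes refl | no ne  = contradiction refl ne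
... | no ne    | yes eq = contradiction (sym eq) ne
... | no _     | no _   = refl
E-sym (inj₁ _) (inj₂ _) = refl
E-sym (inj₂ _) (inj₁ _) = refl
E-sym (inj₂ _) (inj₂ _) = refl

transpose : ∀ {t α β k p q} → Embedded t α β k p q → Embedded t β α k q p
transpose (embedded L C si hx) = embedded (map flip L) (Cert-cong (λ y x → E-sym x y) (flip-Cert C))
  (All.map⁺ (All.map (λ {f} → Simple-flip f) si)) (trans (hexes-flip L) hx)

transpose-twisted : ∀ {t α β k p q} (M : Embedded t α β k p q) → NonOrientable M → NonOrientable (transpose M)
transpose-twisted M tw = tw ∘ flip-Coherent

module _ {A B : Set} {{_ : Eq A}} {{_ : Eq B}} where

  dirs≤cnt : ∀ {L : List (Face A B)} (o : Orientation L) d x y → dirs o d x y ≤ cnt L x y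
  dirs≤cnt []      d x y = z≤n
  dirs≤cnt {f ∷ L} (o ∷ os) d x y = ℕ.+-mono-≤ (one (o xor d)) (dirs≤cnt os d x y)
    where
    one : ∀ d → dir d f x y ≤ up f x y + down f x y
    one true  = ℕ.m≤m+n _ _
    one false = ℕ.m≤n+m _ _

  -- The two quadrilaterals at the edge v b merge into a hexagon.
  module Delete (v : A) (b : B) (u : A) (d : B) (u′ : A) (d′ : B) (R : List (Cor {A} {B})) (O : List (Face A B))
    (proper : All (Proper v) ((b , u , d) ∷ (b , u′ , d′) ∷ R)) (avoid : All (Avoids v) O) (gone : tot R b ≡ 0)
    (Γ Γ′ : A → B → ℕ) (Γ-eq : ∀ x y → Γ′ x y + δ x v * δ y b ≡ Γ x y) (Γ′-vb : Γ′ v b ≡ 0) where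

    private
      rest before after : List (Face A B)
      rest   = map (corner v) R ++ O
      before = quad v b u d ∷ quad v b u′ d′ ∷ rest
      after  = hexa v d u b u′ d′ ∷ rest

      u≢v : u ≢ v
      u≢v = proj₁ (All.head proper)
      u′≢v : u′ ≢ v
      u′≢v = proj₁ (All.head (All.tail proper))

      balance : ∀ x y → cnt before x y ≡ cnt after x y + (δ x v * δ y b + δ x v * δ y b)
      balance x y = lemma (δ x v) (δ x u) (δ x u′) (δ y b) (δ y d) (δ y d′) (cnt rest x y)
        where
        lemma : ∀ v u u′ b d d′ r →
          (v * b + u * d) + (u * b + v * d) + ((v * b + u′ * d′) + (u′ * b + v * d′) + r)
          ≡ (v * d + (u * b + u′ * d′)) + (u * d + (u′ * b + v * d′)) + r + (v * b + v * b)
        lemma = solve-∀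

      count′ : (∀ x y → cnt before x y ≡ Γ x y + Γ x y) → ∀ x y → cnt after x y ≡ Γ′ x y + Γ′ x y
      count′ count x y = ℕ.+-cancelʳ-≡ (δ x v * δ y b + δ x v * δ y b) _ _
        (trans (sym (balance x y)) (trans (count x y) (trans (cong (λ e → e + e) (sym (Γ-eq x y))) (lemma (Γ′ x y) (δ x v * δ y b)))))
        where
        lemma : ∀ p q → (p + q) + (p + q) ≡ (p + p) + (q + q)
        lemma = solve-∀

      -- At `v` the neighbour `b` disappears between `d` and `d′`. Sending it to `d` collapses one
      -- of the two lost corners and turns the other into a corner of the hexagon, so link paths are
      -- carried over; `φ` does the same at `b`.
      θ : A → B → B
      θ x y with x ≟ v | y ≟ b
      ... | yes _ | yes _ = d
      ... | _     | _     = y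

      θ-off : ∀ {x} y → x ≢ v → θ x y ≡ y
      θ-off {x} y ne with x ≟ v | y ≟ b
      ... | yes eq | _     = contradiction eq ne
      ... | no _   | yes _ = refl
      ... | no _   | no _  = refl

      θ-on : θ v b ≡ d
      θ-on with v ≟ v | b ≟ b
      ... | yes _ | yes _ = refl
      ... | yes _ | no ne = contradiction refl ne
      ... | no ne | _     = contradiction refl ne

      θ-id : ∀ {x y} → y ≢ b → θ x y ≡ y
      θ-id {x} {y} ne with x ≟ v | y ≟ b
      ... | _     | yes eq = contradiction eq ne
      ... | yes _ | no _   = refl
      ... | no _  | no _   = refl

      θ-edge : ∀ {x y} → 0 < Γ′ x y → θ x y ≡ y
      θ-edge {x} {y} lt with x ≟ v | y ≟ b
      ... | yes refl | yes refl = contradiction (sym Γ′-vb) (ℕ.<⇒≢ lt)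
      ... | yes _    | no _     = refl
      ... | no _     | yes _    = refl
      ... | no _     | no _     = refl

      φ : B → A → A
      φ y x with x ≟ v | y ≟ b
      ... | yes _ | yes _ = u
      ... | _     | _     = x

      φ-off : ∀ {y} x → y ≢ b → φ y x ≡ x
      φ-off {y} x ne with x ≟ v | y ≟ b
      ... | _     | yes eq = contradiction eq ne
      ... | yes _ | no _   = refl
      ... | no _  | no _   = refl

      φ-on : φ b v ≡ u
      φ-on with v ≟ v | b ≟ b
      ... | yes _ | yes _ = refl
      ... | yes _ | no ne = contradiction refl ne
      ... | no ne | _     = contradiction refl ne

      φ-id : ∀ {x y} → x ≢ v → φ y x ≡ x
      φ-id {x} {y} ne with x ≟ v | y ≟ b
      ... | yes eq | _     = contradiction eq ne
      ... | no _   | yes _ = refl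
      ... | no _   | no _  = refl

      φ-edge : ∀ {x y} → 0 < Γ′ x y → φ y x ≡ x
      φ-edge {x} {y} lt with x ≟ v | y ≟ b
      ... | yes refl | yes refl = contradiction (sym Γ′-vb) (ℕ.<⇒≢ lt)
      ... | yes _    | no _     = refl
      ... | no _     | yes _    = refl
      ... | no _     | no _     = refl

      To : A → B → B → Set
      To x = Star (Link after x)

      Co : B → A → A → Set
      Co y = Star (Colink after y)

      rest-b : ∀ {x y} → Link rest v x y → x ≢ b × y ≢ b
      rest-b {x} {y} l = go l , go (Link-sym l)
        where
        go : ∀ {x y} → Link rest v x y → x ≢ b
        go l refl = contradiction (sym gone) (ℕ.<⇒≢ (Link-tot v {R} (All.tail (All.tail proper)) avoid l))

      b≢ : ∀ {x} → b ≢ x → x ≢ b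
      b≢ ne = ne ∘ sym

      step : ∀ {x y z} → Link before x y z → To x (θ x y) (θ x z)
      step (here q₁) rewrite θ-on | θ-id {v} (b≢ (proj₂ (All.head proper))) = ε
      step (here q₂) rewrite θ-on | θ-id {v} (b≢ (proj₂ (All.head proper))) = ε
      step (here q₃) rewrite θ-off b u≢v | θ-off d u≢v = here h₄ ◅ ε
      step (here q₄) rewrite θ-off b u≢v | θ-off d u≢v = here h₃ ◅ ε
      step (there (here q₁)) rewrite θ-on | θ-id {v} (b≢ (proj₂ (All.head (All.tail proper)))) = here h₁ ◅ ε
      step (there (here q₂)) rewrite θ-on | θ-id {v} (b≢ (proj₂ (All.head (All.tail proper)))) = here h₂ ◅ ε
      step (there (here q₃)) rewrite θ-off b u′≢v | θ-off d′ u′≢v = here h₅ ◅ ε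
      step (there (here q₄)) rewrite θ-off b u′≢v | θ-off d′ u′≢v = here h₆ ◅ ε
      step {x} {y} {z} (there (there l)) = go (x ≟ v)
        where
        go : Dec (x ≡ v) → To x (θ x y) (θ x z)
        go (no ne)    = subst₂ (To x) (sym (θ-off y ne)) (sym (θ-off z ne)) (there l ◅ ε)
        go (yes refl) = subst₂ (To x) (sym (θ-id (proj₁ (rest-b l)))) (sym (θ-id (proj₂ (rest-b l)))) (there l ◅ ε)

      rest-v : ∀ {R O} → All (λ (y , _ , z) → b ≢ y × b ≢ z) R → All (Avoids v) O → ∀ {x z} →
               Colink (map (corner v) R ++ O) b x z → x ≢ v × z ≢ v
      rest-v {[]} {f ∷ O} _ (av ∷ _) (here c) = Avoids-Cocorner {f = f} av c
      rest-v {[]} _ (_ ∷ avs) (there l) = rest-v {[]} [] avs l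
      rest-v {_ ∷ R} ((n , _) ∷ _) av (here q₁) = contradiction refl n
      rest-v {_ ∷ R} ((n , _) ∷ _) av (here q₂) = contradiction refl n
      rest-v {_ ∷ R} ((_ , n) ∷ _) av (here q₃) = contradiction refl n
      rest-v {_ ∷ R} ((_ , n) ∷ _) av (here q₄) = contradiction refl n
      rest-v {_ ∷ R} (_ ∷ ns) av (there l) = rest-v {R} ns av l

      off-b : ∀ (R : List (Cor {A} {B})) → tot R b ≡ 0 → All (λ (y , _ , z) → b ≢ y × b ≢ z) R
      off-b [] _ = []
      off-b ((y , w , z) ∷ R) eq =
        ((λ { refl → contradiction (trans (sym (δ-refl b)) (ℕ.m+n≡0⇒m≡0 _ (ℕ.m+n≡0⇒m≡0 _ eq))) (λ ()) }) ,
         (λ { refl → contradiction (trans (sym (δ-refl b)) (ℕ.m+n≡0⇒n≡0 (δ b y) (ℕ.m+n≡0⇒m≡0 _ eq))) (λ ()) }))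
        ∷ off-b R (ℕ.m+n≡0⇒n≡0 (δ b y + δ b z) eq)

      costep : ∀ {y x z} → Colink before y x z → Co y (φ y x) (φ y z)
      costep (here q₁) rewrite φ-on | φ-id {y = b} u≢v = ε
      costep (here q₂) rewrite φ-on | φ-id {y = b} u≢v = ε
      costep (here q₃) rewrite φ-off v (b≢ (proj₂ (All.head proper))) | φ-off u (b≢ (proj₂ (All.head proper))) = here h₁ ◅ ε
      costep (here q₄) rewrite φ-off v (b≢ (proj₂ (All.head proper))) | φ-off u (b≢ (proj₂ (All.head proper))) = here h₂ ◅ ε
      costep (there (here q₁)) rewrite φ-on | φ-id {y = b} u′≢v = here h₆ ◅ ε
      costep (there (here q₂)) rewrite φ-on | φ-id {y = b} u′≢v = here h₅ ◅ ε
      costep (there (here q₃)) rewrite φ-off v (b≢ (proj₂ (All.head (All.tail proper)))) | φ-off u′ (b≢ (proj₂ (All.head (All.tail proper)))) = here h₃ ◅ ε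
      costep (there (here q₄)) rewrite φ-off v (b≢ (proj₂ (All.head (All.tail proper)))) | φ-off u′ (b≢ (proj₂ (All.head (All.tail proper)))) = here h₄ ◅ ε
      costep {y} {x} {z} (there (there l)) = go (y ≟ b)
        where
        go : Dec (y ≡ b) → Co y (φ y x) (φ y z)
        go (no ne) = subst₂ (Co y) (sym (φ-off x ne)) (sym (φ-off z ne)) (there l ◅ ε)
        go (yes refl) with rest-v {R} (off-b R gone) avoid l
        ... | n , n′ = subst₂ (Co y) (sym (φ-id n)) (sym (φ-id n′)) (there l ◅ ε)

      edge : ∀ {x y} → 0 < Γ′ x y → 0 < Γ x y
      edge {x} {y} lt = subst (0 <_) (Γ-eq x y) (ℕ.m≤n⇒m≤n+o _ lt)

    delete-Cert : Cert Γ before → Cert Γ′ after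
    delete-Cert C = record
      { count  = count′ count
      ; link   = λ x y z e e′ → subst₂ (To x) (θ-edge e) (θ-edge e′) (Star.concat (Star.gmap (θ x) step (link x y z (edge e) (edge e′))))
      ; colink = λ y x z e e′ → subst₂ (Co y) (φ-edge e) (φ-edge e′) (Star.concat (Star.gmap (φ y) costep (colink y x z (edge e) (edge e′))))
      }
      where open Cert C

    delete-Coherent : Cert Γ before → Coherent after → Coherent before
    -- The hexagon runs along the first quadrilateral against its written direction and along the
    -- second with it, hence opposite bits.
    delete-Coherent C (o ∷ os , h) = (not o ∷ o ∷ os) , λ dr x y → subst (_≤ 1) (sym (same-dirs o dr x y)) (bound dr x y)
      where
      same-dirs : ∀ o dr x y → dirs {L = before} (not o ∷ o ∷ os) dr x y ≡ dirs {L = after} (o ∷ os) dr x y + δ x v * δ y b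
      same-dirs true  true  x y = lemma (δ x v) (δ x u) (δ x u′) (δ y b) (δ y d) (δ y d′) (dirs os true x y)
        where
        lemma : ∀ v u u′ b d d′ r → (v * b + u * d) + ((u′ * b + v * d′) + r) ≡ (u * d + (u′ * b + v * d′)) + r + v * b
        lemma = solve-∀
      same-dirs true  false x y = lemma (δ x v) (δ x u) (δ x u′) (δ y b) (δ y d) (δ y d′) (dirs os false x y)
        where
        lemma : ∀ v u u′ b d d′ r → (u * b + v * d) + ((v * b + u′ * d′) + r) ≡ (v * d + (u * b + u′ * d′)) + r + v * b
        lemma = solve-∀
      same-dirs false true  x y = lemma (δ x v) (δ x u) (δ x u′) (δ y b) (δ y d) (δ y d′) (dirs os true x y)
        where
        lemma : ∀ v u u′ b d d′ r → (u * b + v * d) + ((v * b + u′ * d′) + r) ≡ (v * d + (u * b + u′ * d′)) + r + v * b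
        lemma = solve-∀
      same-dirs false false x y = lemma (δ x v) (δ x u) (δ x u′) (δ y b) (δ y d) (δ y d′) (dirs os false x y)
        where
        lemma : ∀ v u u′ b d d′ r → (v * b + u * d) + ((u′ * b + v * d′) + r) ≡ (u * d + (u′ * b + v * d′)) + r + v * b
        lemma = solve-∀
      bound : ∀ dr x y → dirs {L = after} (o ∷ os) dr x y + δ x v * δ y b ≤ 1
      -- The restored edge adds one traversal, at a pair where the remaining faces have no side at
      -- all.
      bound dr x y with x ≟ v | y ≟ b
      ... | yes refl | yes refl = ℕ.+-monoˡ-≤ 1 (ℕ.≤-trans (dirs≤cnt {after} (o ∷ os) dr v b)
              (ℕ.≤-reflexive (trans (count′ (Cert.count C) v b) (cong (λ e → e + e) Γ′-vb))))
      ... | yes _ | no _ = subst (_≤ 1) (sym (ℕ.+-identityʳ _)) (h dr x y)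
      ... | no _  | _    = subst (_≤ 1) (sym (ℕ.+-identityʳ _)) (h dr x y)

module Relabel {A A′ B B′ : Set} {{_ : Eq A}} {{_ : Eq A′}} {{_ : Eq B}} {{_ : Eq B′}}
  (f : A → A′) (f⁻ : A′ → A) (f⁻f : ∀ a → f⁻ (f a) ≡ a) (ff⁻ : ∀ x → f (f⁻ x) ≡ x)
  (g : B → B′) (g⁻ : B′ → B) (g⁻g : ∀ b → g⁻ (g b) ≡ b) (gg⁻ : ∀ y → g (g⁻ y) ≡ y) where

  relabel : List (Face A B) → List (Face A′ B′)
  relabel = map (mapF f g)

  δf : ∀ x a → δ (f x) (f a) ≡ δ x a
  δf = δ-cong f λ eq → trans (sym (f⁻f _)) (trans (cong f⁻ eq) (f⁻f _))

  δg : ∀ y b → δ (g y) (g b) ≡ δ y b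
  δg = δ-cong g λ eq → trans (sym (g⁻g _)) (trans (cong g⁻ eq) (g⁻g _))

  dir-relabel : ∀ d φ x y → dir d (mapF f g φ) (f x) (g y) ≡ dir d φ x y
  dir-relabel true  (quad a b c d)     x y = cong₂ _+_ (cong₂ _*_ (δf x a) (δg y b)) (cong₂ _*_ (δf x c) (δg y d))
  dir-relabel false (quad a b c d)     x y = cong₂ _+_ (cong₂ _*_ (δf x c) (δg y b)) (cong₂ _*_ (δf x a) (δg y d))
  dir-relabel true  (hexa a b c d e h) x y = cong₂ _+_ (cong₂ _*_ (δf x a) (δg y b)) (cong₂ _+_ (cong₂ _*_ (δf x c) (δg y d)) (cong₂ _*_ (δf x e) (δg y h)))
  dir-relabel false (hexa a b c d e h) x y = cong₂ _+_ (cong₂ _*_ (δf x c) (δg y b)) (cong₂ _+_ (cong₂ _*_ (δf x e) (δg y d)) (cong₂ _*_ (δf x a) (δg y h)))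

  cnt-relabel : ∀ L x y → cnt (relabel L) (f x) (g y) ≡ cnt L x y
  cnt-relabel []      x y = refl
  cnt-relabel (φ ∷ L) x y = cong₂ _+_ (cong₂ _+_ (dir-relabel true φ x y) (dir-relabel false φ x y)) (cnt-relabel L x y)

  relabel-Cert : ∀ {Γ L} → Cert (λ a b → Γ (f a) (g b)) L → Cert Γ (relabel L)
  relabel-Cert {Γ} {L} C = record
    { count  = λ x y → subst₂ (λ x y → cnt (relabel L) x y ≡ Γ x y + Γ x y) (ff⁻ x) (gg⁻ y) (trans (cnt-relabel L (f⁻ x) (g⁻ y)) (count (f⁻ x) (g⁻ y)))
    ; link   = λ x y z e e′ → subst (λ x → Star (Link (relabel L) x) y z) (ff⁻ x) (subst₂ (Star _) (gg⁻ y) (gg⁻ z)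
        (Star.gmap g (λ l → Any.map⁺ (Any.map (Corner-map f g) l)) (link (f⁻ x) (g⁻ y) (g⁻ z) (back x y e) (back x z e′))))
    ; colink = λ y x z e e′ → subst (λ y → Star (Colink (relabel L) y) x z) (gg⁻ y) (subst₂ (Star _) (ff⁻ x) (ff⁻ z)
        (Star.gmap f (λ l → Any.map⁺ (Any.map (λ {φ} c → subst (λ k → Corner k _ _ _) (sym (flip-map f g φ)) (Corner-map g f c)) l))
          (colink (g⁻ y) (f⁻ x) (f⁻ z) (back x y e) (back z y e′))))
    }
    where
    open Cert C
    back : ∀ x y → 0 < Γ x y → 0 < Γ (f (f⁻ x)) (g (g⁻ y))
    back x y = subst₂ (λ x y → 0 < Γ x y) (sym (ff⁻ x)) (sym (gg⁻ y))

  relabel-Coherent : ∀ L → Coherent (relabel L) → Coherent L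
  relabel-Coherent L (o , h) with go L o
    where
    go : ∀ L (o : Orientation (relabel L)) → Σ (Orientation L) λ o′ → ∀ d x y → dirs o′ d x y ≡ dirs o d (f x) (g y)
    go [] [] = [] , λ d x y → refl
    go (φ ∷ L) (o ∷ os) with go L os
    ... | os′ , eq = o ∷ os′ , λ d x y → cong₂ _+_ (sym (dir-relabel (o xor d) φ x y)) (eq d x y)
  ... | o′ , eq = o′ , λ d x y → subst (_≤ 1) (sym (eq d x y)) (h d (f x) (g y))

match : ∀ {k p} → Side k (suc p) → Side (suc k) p
match (inj₁ i)       = inj₁ (suc i)
match (inj₂ zero)    = inj₁ zero
match (inj₂ (suc j)) = inj₂ j

unmatch : ∀ {k p} → Side (suc k) p → Side k (suc p)
unmatch (inj₁ zero)    = inj₂ zero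
unmatch (inj₁ (suc i)) = inj₁ i
unmatch (inj₂ j)       = inj₂ (suc j)

unmatch-match : ∀ {k p} (x : Side k (suc p)) → unmatch (match x) ≡ x
unmatch-match (inj₁ i)       = refl
unmatch-match (inj₂ zero)    = refl
unmatch-match (inj₂ (suc j)) = refl

match-unmatch : ∀ {k p} (x : Side (suc k) p) → match (unmatch x) ≡ x
match-unmatch (inj₁ zero)    = refl
match-unmatch (inj₁ (suc i)) = refl
match-unmatch (inj₂ j)       = refl

E-match : ∀ {k p q} (x : Side k (suc p)) (y : Side k (suc q)) → E (match x) (match y) + δ x (inj₂ zero) * δ y (inj₂ zero) ≡ E x y
E-match (inj₁ i)       (inj₁ j)       = ℕ.+-identityʳ _
E-match (inj₁ i)       (inj₂ zero)    = refl
E-match (inj₁ i)       (inj₂ (suc j)) = refl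
E-match (inj₂ zero)    (inj₁ j)       = refl
E-match (inj₂ (suc i)) (inj₁ j)       = refl
E-match (inj₂ zero)    (inj₂ zero)    = refl
E-match (inj₂ zero)    (inj₂ (suc j)) = refl
E-match (inj₂ (suc i)) (inj₂ zero)    = refl
E-match (inj₂ (suc i)) (inj₂ (suc j)) = refl

record Drawing (t k p q : ℕ) : Set where
  constructor drawing
  field
    faces : List (Face (Side k p) (Side k q))
    cert  : Cert E faces
    hexagonal : hexes faces ≡ t

Twisted : ∀ {t k p q} → Drawing t k p q → Set
Twisted D = ¬ Coherent (Drawing.faces D)

module _ {k p q : ℕ} where

  private
    v : Side k (suc p)
    v = inj₂ zero
    b : Side k (suc q)
    b = inj₂ zero
    module R = Relabel (match {k} {p}) unmatch unmatch-match match-unmatch (match {k} {q}) unmatch unmatch-match match-unmatch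

  -- Hexagons avoid `v`, so both faces at the edge are quadrilaterals; `extract` brings them to the
  -- front. The ends of the lost edge then become the first matched pair.
  delete : ∀ {t β} (M : Embedded t true β k (suc p) (suc q)) → Σ (Drawing (suc t) (suc k) p q) λ D → NonOrientable M → Twisted D
  delete (embedded L C si hx) with star v Free⇒≢ L si
  ... | star-at Cs Os sp pr av with trans (sym (cnt-star v Cs Os pr av b)) (trans (sym (≼-cnt sp v b)) (Cert.count C v b))
  ... | two with extract v b Cs (subst (0 <_) (sym two) z<s)
  ... | extracted {u} {d} R₁ sp₁ pr₁ to₁ with pr₁ pr
  ... | (p₁ , b≢d) ∷ prs₁ with ℕ.suc-injective (trans (sym (cong (_+ tot R₁ b) (cong₂ _+_ (δ-refl b) (δ-≢ b≢d)))) (trans (sym (to₁ b)) two))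
  ... | one with extract v b R₁ (subst (0 <_) (sym one) z<s)
  ... | extracted {u′} {d′} R₂ sp₂ pr₂ to₂ with pr₂ prs₁
  ... | (p₂ , b≢d′) ∷ prs₂ with ℕ.suc-injective (trans (sym (cong (_+ tot R₂ b) (cong₂ _+_ (δ-refl b) (δ-≢ b≢d′)))) (trans (sym (to₂ b)) one))
  ... | none = drawing (R.relabel after) (R.relabel-Cert (X.delete-Cert C′))
                 (trans (hexes-map match match after) (cong suc (trans (sym (hexes-≼ sp′)) hx))) ,
               λ tw or → tw (≼-Coherent sp′ (X.delete-Coherent C′ (R.relabel-Coherent after or)))
    where
    module X = Delete v b u d u′ d′ R₂ Os ((p₁ , b≢d) ∷ (p₂ , b≢d′) ∷ prs₂) av none E (λ x y → E (match x) (match y)) E-match refl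
    after : List (Face (Side k (suc p)) (Side k (suc q)))
    after = hexa v d u b u′ d′ ∷ map (corner v) R₂ ++ Os
    sp′ : L ≼ (quad v b u d ∷ quad v b u′ d′ ∷ map (corner v) R₂ ++ Os)
    sp′ = join sp (≼-++ʳ v Os (join sp₁ (same ∷ sp₂)))
    C′ : Cert E (quad v b u d ∷ quad v b u′ d′ ∷ map (corner v) R₂ ++ Os)
    C′ = ≼-Cert sp′ C

-- From face lists to rotation systems

pattern quad∷ L = quad _ _ _ _ ∷ L
pattern hexa∷ L = hexa _ _ _ _ _ _ ∷ L
pattern 4+ i = suc (suc (suc (suc i)))
pattern 6+ i = suc (suc (4+ i))

flips⇒≢ : ∀ {X : Set} (f : X → X) (g : X → Bool) → (∀ x → g (f x) ≡ not (g x)) → ∀ x → f x ≢ x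
flips⇒≢ f g h x eq with g x | trans (sym (cong g eq)) (h x)
... | true  | ()
... | false | ()

module _ {A B : Set} where

  -- Sides of faces are numbered, and these numbers serve as flags: every edge corresponds to two of
  -- them.
  size : List (Face A B) → ℕ
  size []                       = 0
  size (quad∷ L) = 4 + size L
  size (hexa∷ L) = 6 + size L

  sideVec : ∀ L → Vec (A × B) (size L)
  sideVec []                     = []
  sideVec (quad a b c d ∷ L)     = (a , b) ∷ (c , b) ∷ (c , d) ∷ (a , d) ∷ sideVec L
  sideVec (hexa a b c d e f ∷ L) = (a , b) ∷ (c , b) ∷ (c , d) ∷ (e , d) ∷ (e , f) ∷ (a , f) ∷ sideVec L

  label : ∀ L → Fin (size L) → A × B
  label L = lookup (sideVec L)

  -- The neighbouring side of the same face at the end in A, resp. B.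
  α β : ∀ (L : List (Face A B)) → Fin (size L) → Fin (size L)
  α (quad∷ L) #0     = #3
  α (quad∷ L) #1     = #2
  α (quad∷ L) #2     = #1
  α (quad∷ L) #3     = #0
  α (quad∷ L) (4+ i) = 4+ (α L i)
  α (hexa∷ L) #0     = #5
  α (hexa∷ L) #1     = #2
  α (hexa∷ L) #2     = #1
  α (hexa∷ L) #3     = #4
  α (hexa∷ L) #4     = #3
  α (hexa∷ L) #5     = #0
  α (hexa∷ L) (6+ i) = 6+ (α L i)
  β (quad∷ L) #0     = #1
  β (quad∷ L) #1     = #0
  β (quad∷ L) #2     = #3
  β (quad∷ L) #3     = #2
  β (quad∷ L) (4+ i) = 4+ (β L i)
  β (hexa∷ L) #0     = #1
  β (hexa∷ L) #1     = #0
  β (hexa∷ L) #2     = #3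
  β (hexa∷ L) #3     = #2
  β (hexa∷ L) #4     = #5
  β (hexa∷ L) #5     = #4
  β (hexa∷ L) (6+ i) = 6+ (β L i)

  faceOf : ∀ (L : List (Face A B)) → Fin (size L) → Fin (length L)
  faceOf (quad∷ L) #0     = zero
  faceOf (quad∷ L) #1     = zero
  faceOf (quad∷ L) #2     = zero
  faceOf (quad∷ L) #3     = zero
  faceOf (quad∷ L) (4+ i) = suc (faceOf L i)
  faceOf (hexa∷ L) #0     = zero
  faceOf (hexa∷ L) #1     = zero
  faceOf (hexa∷ L) #2     = zero
  faceOf (hexa∷ L) #3     = zero
  faceOf (hexa∷ L) #4     = zero
  faceOf (hexa∷ L) #5     = zero
  faceOf (hexa∷ L) (6+ i) = suc (faceOf L i)

  -- true: the face, traversed as written, runs along this side from A to B.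
  upward : ∀ (L : List (Face A B)) → Fin (size L) → Bool
  upward (quad∷ L) #0     = true
  upward (quad∷ L) #1     = false
  upward (quad∷ L) #2     = true
  upward (quad∷ L) #3     = false
  upward (quad∷ L) (4+ i) = upward L i
  upward (hexa∷ L) #0     = true
  upward (hexa∷ L) #1     = false
  upward (hexa∷ L) #2     = true
  upward (hexa∷ L) #3     = false
  upward (hexa∷ L) #4     = true
  upward (hexa∷ L) #5     = false
  upward (hexa∷ L) (6+ i) = upward L i

  -- Induction in which the sides of the first face are settled by computation; all the symmetry
  -- laws of `α` and `β` are of this kind.
  cases : ∀ (P : ∀ L → Fin (size L) → Set) →
    (∀ {a b c d} L → P (quad a b c d ∷ L) #0 × P (quad a b c d ∷ L) #1 × P (quad a b c d ∷ L) #2 × P (quad a b c d ∷ L) #3) →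
    (∀ {a b c d} L i → P L i → P (quad a b c d ∷ L) (4+ i)) →
    (∀ {a b c d e f} L → let K = hexa a b c d e f ∷ L in P K #0 × P K #1 × P K #2 × P K #3 × P K #4 × P K #5) →
    (∀ {a b c d e f} L i → P L i → P (hexa a b c d e f ∷ L) (6+ i)) → ∀ L i → P L i
  cases P q q+ h h+ (quad∷ L) #0     = proj₁ (q L)
  cases P q q+ h h+ (quad∷ L) #1     = proj₁ (proj₂ (q L))
  cases P q q+ h h+ (quad∷ L) #2     = proj₁ (proj₂ (proj₂ (q L)))
  cases P q q+ h h+ (quad∷ L) #3     = proj₂ (proj₂ (proj₂ (q L)))
  cases P q q+ h h+ (quad∷ L) (4+ i) = q+ L i (cases P q q+ h h+ L i)
  cases P q q+ h h+ (hexa∷ L) #0 = proj₁ (h L)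
  cases P q q+ h h+ (hexa∷ L) #1 = proj₁ (proj₂ (h L))
  cases P q q+ h h+ (hexa∷ L) #2 = proj₁ (proj₂ (proj₂ (h L)))
  cases P q q+ h h+ (hexa∷ L) #3 = proj₁ (proj₂ (proj₂ (proj₂ (h L))))
  cases P q q+ h h+ (hexa∷ L) #4 = proj₁ (proj₂ (proj₂ (proj₂ (proj₂ (h L)))))
  cases P q q+ h h+ (hexa∷ L) #5 = proj₂ (proj₂ (proj₂ (proj₂ (proj₂ (h L)))))
  cases P q q+ h h+ (hexa∷ L) (6+ i) = h+ L i (cases P q q+ h h+ L i)

  αα : ∀ L i → α L (α L i) ≡ i
  αα = cases (λ L i → α L (α L i) ≡ i) (λ L → refl , refl , refl , refl) (λ L i → cong (λ i → 4+ i))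
             (λ L → refl , refl , refl , refl , refl , refl) (λ L i → cong (λ i → 6+ i))

  ββ : ∀ L i → β L (β L i) ≡ i
  ββ = cases (λ L i → β L (β L i) ≡ i) (λ L → refl , refl , refl , refl) (λ L i → cong (λ i → 4+ i))
             (λ L → refl , refl , refl , refl , refl , refl) (λ L i → cong (λ i → 6+ i))

  upward-α : ∀ L i → upward L (α L i) ≡ not (upward L i)
  upward-α = cases (λ L i → upward L (α L i) ≡ not (upward L i)) (λ L → refl , refl , refl , refl) (λ L i → id)
             (λ L → refl , refl , refl , refl , refl , refl) (λ L i → id)

  upward-β : ∀ L i → upward L (β L i) ≡ not (upward L i)
  upward-β = cases (λ L i → upward L (β L i) ≡ not (upward L i)) (λ L → refl , refl , refl , refl) (λ L i → id)
             (λ L → refl , refl , refl , refl , refl , refl) (λ L i → id)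

  faceOf-α : ∀ L i → faceOf L (α L i) ≡ faceOf L i
  faceOf-α = cases (λ L i → faceOf L (α L i) ≡ faceOf L i) (λ L → refl , refl , refl , refl) (λ L i → cong suc)
             (λ L → refl , refl , refl , refl , refl , refl) (λ L i → cong suc)

  faceOf-β : ∀ L i → faceOf L (β L i) ≡ faceOf L i
  faceOf-β = cases (λ L i → faceOf L (β L i) ≡ faceOf L i) (λ L → refl , refl , refl , refl) (λ L i → cong suc)
             (λ L → refl , refl , refl , refl , refl , refl) (λ L i → cong suc)

  label-α : ∀ L i → proj₁ (label L (α L i)) ≡ proj₁ (label L i)
  label-α = cases (λ L i → proj₁ (label L (α L i)) ≡ proj₁ (label L i)) (λ L → refl , refl , refl , refl) (λ L i → id)
             (λ L → refl , refl , refl , refl , refl , refl) (λ L i → id)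

  label-β : ∀ L i → proj₂ (label L (β L i)) ≡ proj₂ (label L i)
  label-β = cases (λ L i → proj₂ (label L (β L i)) ≡ proj₂ (label L i)) (λ L → refl , refl , refl , refl) (λ L i → id)
             (λ L → refl , refl , refl , refl , refl , refl) (λ L i → id)

  -- The flag tells whether the current side is traversed from A to B.
  along : ∀ L → Bool × Fin (size L) → Bool × Fin (size L)
  along L (true , i)  = false , β L i
  along L (false , i) = true , α L i

  lift : ∀ {f : Face A B} {L} → Bool × Fin (size L) → Bool × Fin (size (f ∷ L))
  lift {quad _ _ _ _}     (e , i) = e , 4+ i
  lift {hexa _ _ _ _ _ _} (e , i) = e , 6+ i

  along-lift : ∀ {f L} k s → iter (along (f ∷ L)) k (lift {f} s) ≡ lift {f} (iter (along L) k s)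
  along-lift zero s = refl
  along-lift {f} {L} (suc k) s = trans (cong (along (f ∷ L)) (along-lift {f} {L} k s)) (one f (iter (along L) k s))
    where
    one : ∀ f s → along (f ∷ L) (lift {f} s) ≡ lift {f} (along L s)
    one (quad _ _ _ _)     (true , i)  = refl
    one (quad _ _ _ _)     (false , i) = refl
    one (hexa _ _ _ _ _ _) (true , i)  = refl
    one (hexa _ _ _ _ _ _) (false , i) = refl

  Reach : ∀ L → Bool × Fin (size L) → Bool × Fin (size L) → Set
  Reach L s t = ∃[ k ] iter (along L) k s ≡ t

  first : ∀ L → Fin (length L) → Fin (size L)
  first (quad∷ L) zero    = #0
  first (hexa∷ L) zero    = #0
  first (quad∷ L) (suc i) = 4+ (first L i)
  first (hexa∷ L) (suc i) = 6+ (first L i)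

  faceOf-first : ∀ L i → faceOf L (first L i) ≡ i
  faceOf-first (quad∷ L) zero    = refl
  faceOf-first (hexa∷ L) zero    = refl
  faceOf-first (quad∷ L) (suc i) = cong suc (faceOf-first L i)
  faceOf-first (hexa∷ L) (suc i) = cong suc (faceOf-first L i)

  upward-first : ∀ L i → upward L (first L i) ≡ true
  upward-first (quad∷ L) zero    = refl
  upward-first (hexa∷ L) zero    = refl
  upward-first (quad∷ L) (suc i) = upward-first L i
  upward-first (hexa∷ L) (suc i) = upward-first L i

  -- Each step of `along` negates both `upward` and the flag, so their xor is invariant and
  -- determines the flag on arrival at the first side.
  to-first : ∀ L i e → Reach L (e , i) (not (upward L i xor e) , first L (faceOf L i))
  to-first (quad∷ L) #0 true  = 0 , refl
  to-first (quad∷ L) #0 false = 0 , refl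
  to-first (quad∷ L) #1 true  = 1 , refl
  to-first (quad∷ L) #1 false = 3 , refl
  to-first (quad∷ L) #2 true  = 2 , refl
  to-first (quad∷ L) #2 false = 2 , refl
  to-first (quad∷ L) #3 true  = 3 , refl
  to-first (quad∷ L) #3 false = 1 , refl
  to-first (f@(quad _ _ _ _) ∷ L) (4+ i) e with to-first L i e
  ... | k , eq = k , trans (along-lift {f} {L} k (e , i)) (cong (lift {f} {L}) eq)
  to-first (hexa∷ L) #0 true  = 0 , refl
  to-first (hexa∷ L) #0 false = 0 , refl
  to-first (hexa∷ L) #1 true  = 1 , refl
  to-first (hexa∷ L) #1 false = 5 , refl
  to-first (hexa∷ L) #2 true  = 4 , refl
  to-first (hexa∷ L) #2 false = 2 , refl
  to-first (hexa∷ L) #3 true  = 3 , refl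
  to-first (hexa∷ L) #3 false = 3 , refl
  to-first (hexa∷ L) #4 true  = 2 , refl
  to-first (hexa∷ L) #4 false = 4 , refl
  to-first (hexa∷ L) #5 true  = 5 , refl
  to-first (hexa∷ L) #5 false = 1 , refl
  to-first (f@(hexa _ _ _ _ _ _) ∷ L) (6+ i) e with to-first L i e
  ... | k , eq = k , trans (along-lift {f} {L} k (e , i)) (cong (lift {f} {L}) eq)

  back : ∀ {L} → Bool × Fin (size L) → Bool × Fin (size L)
  back (e , i) = not e , i

  -- Reversing the traversal inverts `along`; thus paths from the first side are obtained from paths
  -- to it.
  along-back : ∀ L s → along L (back {L} (along L s)) ≡ back {L} s
  along-back L (true , i)  = cong (false ,_) (ββ L i)
  along-back L (false , i) = cong (true ,_) (αα L i)

  iter-back : ∀ L k s → iter (along L) k (back {L} (iter (along L) k s)) ≡ back {L} s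
  iter-back L zero    s = refl
  iter-back L (suc k) s = trans (sym (iter-comm (along L) k _))
    (trans (cong (iter (along L) k) (along-back L (iter (along L) k s))) (iter-back L k s))

  from-first : ∀ L i e → Reach L (not (upward L i xor e) , first L (faceOf L i)) (e , i)
  from-first L i e with to-first L i (not e)
  ... | k , eq = k , trans (cong (λ b → iter (along L) k (b , first L (faceOf L i))) (turned (upward L i) e))
        (trans (cong (iter (along L) k ∘ back {L}) (sym eq)) (trans (iter-back L k (not e , i)) (cong (_, i) (not-involutive e))))
    where
    turned : ∀ u e → not (u xor e) ≡ not (not (u xor not e))
    turned true  e = cong (not ∘ not) (sym (not-involutive e))
    turned false e = sym (not-involutive (not e))

  -- The face and the xor of `upward` with the flag are complete invariants of the orbits, two
  -- orbits to a face.
  along-reach : ∀ L s t → faceOf L (proj₂ s) ≡ faceOf L (proj₂ t) →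
                upward L (proj₂ s) xor proj₁ s ≡ upward L (proj₂ t) xor proj₁ t → Reach L s t
  along-reach L (e , i) (e′ , j) eq eq′ with to-first L i e | from-first L j e′
  ... | k , p | l , q = l + k , trans (iter-+ (along L) l k (e , i)) (trans (cong (iter (along L) l)
        (trans p (cong₂ (λ u c → not u , first L c) eq′ eq))) q)

  along-faceOf : ∀ L s → faceOf L (proj₂ (along L s)) ≡ faceOf L (proj₂ s)
  along-faceOf L (true , i)  = faceOf-β L i
  along-faceOf L (false , i) = faceOf-α L i

  along-upward : ∀ L s → upward L (proj₂ (along L s)) xor proj₁ (along L s) ≡ upward L (proj₂ s) xor proj₁ s
  along-upward L (true , i)  rewrite upward-β L i with upward L i
  ... | true  = refl
  ... | false = refl
  along-upward L (false , i) rewrite upward-α L i with upward L i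
  ... | true  = refl
  ... | false = refl

  Link-side : ∀ {L a b b′} → Link L a b b′ → ∃[ i ] (label L i ≡ (a , b) × label L (α L i) ≡ (a , b′))
  Link-side (here q₁) = #0 , refl , refl
  Link-side (here q₂) = #3 , refl , refl
  Link-side (here q₃) = #1 , refl , refl
  Link-side (here q₄) = #2 , refl , refl
  Link-side (here h₁) = #0 , refl , refl
  Link-side (here h₂) = #5 , refl , refl
  Link-side (here h₃) = #1 , refl , refl
  Link-side (here h₄) = #2 , refl , refl
  Link-side (here h₅) = #3 , refl , refl
  Link-side (here h₆) = #4 , refl , refl
  Link-side {quad∷ L} (there l) with Link-side l
  ... | i , p , q = 4+ i , p , q
  Link-side {hexa∷ L} (there l) with Link-side l
  ... | i , p , q = 6+ i , p , q

  Colink-side : ∀ {L b a a′} → Colink L b a a′ → ∃[ i ] (label L i ≡ (a , b) × label L (β L i) ≡ (a′ , b))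
  Colink-side {quad∷ L} (here q₁) = #0 , refl , refl
  Colink-side {quad∷ L} (here q₂) = #1 , refl , refl
  Colink-side {quad∷ L} (here q₃) = #3 , refl , refl
  Colink-side {quad∷ L} (here q₄) = #2 , refl , refl
  Colink-side {hexa∷ L} (here h₁) = #0 , refl , refl
  Colink-side {hexa∷ L} (here h₂) = #1 , refl , refl
  Colink-side {hexa∷ L} (here h₃) = #5 , refl , refl
  Colink-side {hexa∷ L} (here h₄) = #4 , refl , refl
  Colink-side {hexa∷ L} (here h₅) = #3 , refl , refl
  Colink-side {hexa∷ L} (here h₆) = #2 , refl , refl
  Colink-side {quad∷ L} (there l) with Colink-side {L} l
  ... | i , p , q = 4+ i , p , q
  Colink-side {hexa∷ L} (there l) with Colink-side {L} l
  ... | i , p , q = 6+ i , p , q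

module _ {A B : Set} {{_ : Eq A}} {{_ : Eq B}} where

  occ : ∀ {n} → A → B → Vec (A × B) n → ℕ
  occ x y []            = 0
  occ x y ((a , b) ∷ v) = δ x a * δ y b + occ x y v

  occ-cnt : ∀ L x y → cnt L x y ≡ occ x y (sideVec L)
  occ-cnt [] x y = refl
  occ-cnt (quad a b c d ∷ L) x y = trans (cong (up (quad a b c d) x y + down (quad a b c d) x y +_) (occ-cnt L x y))
    (lemma (δ x a * δ y b) (δ x c * δ y d) (δ x c * δ y b) (δ x a * δ y d) _)
    where
    lemma : ∀ p q r s t → (p + q) + (r + s) + t ≡ p + (r + (q + (s + t)))
    lemma = solve-∀
  occ-cnt (hexa a b c d e f ∷ L) x y = trans (cong (up (hexa a b c d e f) x y + down (hexa a b c d e f) x y +_) (occ-cnt L x y))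
    (lemma (δ x a * δ y b) (δ x c * δ y d) (δ x e * δ y f) (δ x c * δ y b) (δ x e * δ y d) (δ x a * δ y f) _)
    where
    lemma : ∀ p q r s t u w → (p + (q + r)) + (s + (t + u)) + w ≡ p + (s + (q + (t + (r + (u + w)))))
    lemma = solve-∀

  private
    hit : ∀ {x a : A} {y b : B} → (a , b) ≡ (x , y) → δ x a * δ y b ≡ 1
    hit {x} {y = y} refl rewrite δ-refl x | δ-refl y = refl

    miss : ∀ {x a : A} {y b : B} → (a , b) ≢ (x , y) → δ x a * δ y b ≡ 0
    miss {x} {a} {y} {b} ne with x ≟ a | y ≟ b
    ... | yes refl | yes refl = contradiction refl ne
    ... | yes _    | no _     = refl
    ... | no _     | _        = refl

    same? : ∀ (p q : A × B) → Dec (p ≡ q)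
    same? (a , b) (x , y) with a ≟ x | b ≟ y
    ... | yes refl | yes refl = yes refl
    ... | yes _    | no ne    = no λ { refl → ne refl }
    ... | no ne    | _        = no λ { refl → ne refl }

  occ-0 : ∀ {n} x y (v : Vec (A × B) n) → occ x y v ≡ 0 → ∀ i → lookup v i ≢ (x , y)
  occ-0 x y ((a , b) ∷ v) eq zero    h = contradiction (trans (sym (hit h)) (ℕ.m+n≡0⇒m≡0 _ eq)) λ ()
  occ-0 x y ((a , b) ∷ v) eq (suc i) h = occ-0 x y v (ℕ.m+n≡0⇒n≡0 (δ x a * δ y b) eq) i h

  occ-pos : ∀ {n} x y (v : Vec (A × B) n) → 0 < occ x y v → ∃[ i ] lookup v i ≡ (x , y)
  occ-pos x y ((a , b) ∷ v) lt with same? (a , b) (x , y)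
  ... | yes eq = zero , eq
  ... | no ne with occ-pos x y v (subst (λ z → 0 < z + occ x y v) (miss ne) lt)
  ...   | i , eq = suc i , eq

  occ-1 : ∀ {n} x y (v : Vec (A × B) n) → occ x y v ≡ 1 →
          ∃[ i ] (lookup v i ≡ (x , y) × (∀ j → lookup v j ≡ (x , y) → j ≡ i))
  occ-1 x y ((a , b) ∷ v) eq with same? (a , b) (x , y)
  ... | yes h = zero , h , λ { zero _ → refl ; (suc j) h′ → contradiction h′
          (occ-0 x y v (ℕ.suc-injective (trans (cong (_+ occ x y v) (sym (hit h))) eq)) j) }
  ... | no ne with occ-1 x y v (trans (cong (_+ occ x y v) (sym (miss ne))) eq)
  ...   | i , h , u = suc i , h , λ { zero h′ → contradiction h′ ne ; (suc j) h′ → cong suc (u j h′) }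

  -- Supplies the involution that crosses an edge: the other side with the same label.
  occ-2 : ∀ {n} x y (v : Vec (A × B) n) → occ x y v ≡ 2 → ∀ i → lookup v i ≡ (x , y) →
          ∃[ i′ ] (i′ ≢ i × lookup v i′ ≡ (x , y) × (∀ j → lookup v j ≡ (x , y) → j ≡ i ⊎ j ≡ i′))
  occ-2 x y ((a , b) ∷ v) eq i h with same? (a , b) (x , y)
  occ-2 x y ((a , b) ∷ v) eq zero h | no ne = contradiction h ne
  occ-2 x y ((a , b) ∷ v) eq (suc i) h | no ne
    with occ-2 x y v (trans (cong (_+ occ x y v) (sym (miss ne))) eq) i h
  ... | i′ , ne′ , h′ , u = suc i′ , (λ { refl → ne′ refl }) , h′ , λ where
        zero h″    → contradiction h″ ne
        (suc j) h″ → Data.Sum.map (cong suc) (cong suc) (u j h″)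
  occ-2 x y ((a , b) ∷ v) eq i h | yes h₀
    with occ-1 x y v (ℕ.suc-injective (trans (cong (_+ occ x y v) (sym (hit h₀))) eq))
  occ-2 x y ((a , b) ∷ v) eq zero h | yes h₀ | i′ , h′ , u = suc i′ , (λ ()) , h′ , λ where
        zero _     → inj₁ refl
        (suc j) h″ → inj₂ (cong suc (u j h″))
  occ-2 x y ((a , b) ∷ v) eq (suc i) h | yes h₀ | i′ , h′ , u = zero , (λ ()) , h₀ , λ where
        zero _     → inj₂ refl
        (suc j) h″ → inj₁ (cong suc (trans (u j h″) (sym (u i h))))

xor-cancel : ∀ a b → a xor (a xor b) ≡ b
xor-cancel true  b = not-involutive b
xor-cancel false b = refl

flip-≢ : ∀ {p b} → p ≢ b → not p ≡ b
flip-≢ {true}  {true}  ne = contradiction refl ne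
flip-≢ {true}  {false} ne = refl
flip-≢ {false} {true}  ne = refl
flip-≢ {false} {false} ne = contradiction refl ne

code : Bool → Fin 2
code true  = #1
code false = #0

code-inj : ∀ {b c} → code b ≡ code c → b ≡ c
code-inj {true}  {true}  _ = refl
code-inj {false} {false} _ = refl

dart-≡ : ∀ G {d d′ : Dart G} → proj₁ d ≡ proj₁ d′ → d ≡ d′
dart-≡ _ {u , t} {.u , t′} refl = cong (u ,_) (T-irrelevant t t′)

not≢ : ∀ b → not b ≢ b
not≢ true  ()
not≢ false ()

module _ {A B : Set} where

  orient : ∀ (L : List (Face A B)) → (Fin (length L) → Bool) → All (λ _ → Bool) L
  orient []      o = []
  orient (f ∷ L) o = o zero ∷ orient L (o ∘ suc)

module _ {A B : Set} {{_ : Eq A}} {{_ : Eq B}} where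

  dirs-side : ∀ (L : List (Face A B)) o i →
              0 < dirs (orient L o) (o (faceOf L i) xor upward L i) (proj₁ (label L i)) (proj₂ (label L i))
  dirs-side (f ∷ L) o i = go f i
    where
    hit : ∀ (a : A) (b : B) → 0 < δ a a * δ b b
    hit a b rewrite δ-refl a | δ-refl b = s≤s z≤n
    first-face : ∀ f u x y → 0 < dir u f x y → 0 < dirs {L = f ∷ L} (orient (f ∷ L) o) (o zero xor u) x y
    first-face f u x y lt = ℕ.m≤n⇒m≤n+o _ (subst (λ d → 0 < dir d f x y) (sym (xor-cancel (o zero) u)) lt)
    go : ∀ f (i : Fin (size (f ∷ L))) → let K = f ∷ L in
         0 < dirs {L = K} (orient K o) (o (faceOf K i) xor upward K i) (proj₁ (label K i)) (proj₂ (label K i))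
    go f@(quad a b c d) #0 = first-face f true  a b (ℕ.m≤n⇒m≤n+o _ (hit a b))
    go f@(quad a b c d) #1 = first-face f false c b (ℕ.m≤n⇒m≤n+o _ (hit c b))
    go f@(quad a b c d) #2 = first-face f true  c d (ℕ.m≤n⇒m≤o+n (δ c a * δ d b) (hit c d))
    go f@(quad a b c d) #3 = first-face f false a d (ℕ.m≤n⇒m≤o+n (δ a c * δ d b) (hit a d))
    go (quad a b c d) (4+ i) = ℕ.≤-trans (dirs-side L (o ∘ suc) i) (ℕ.m≤n+m _ _)
    go f@(hexa a b c d e g) #0 = first-face f true  a b (ℕ.m≤n⇒m≤n+o _ (hit a b))
    go f@(hexa a b c d e g) #1 = first-face f false c b (ℕ.m≤n⇒m≤n+o _ (hit c b))
    go f@(hexa a b c d e g) #2 = first-face f true  c d (ℕ.m≤n⇒m≤o+n (δ c a * δ d b) (ℕ.m≤n⇒m≤n+o _ (hit c d)))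
    go f@(hexa a b c d e g) #3 = first-face f false e d (ℕ.m≤n⇒m≤o+n (δ e c * δ d b) (ℕ.m≤n⇒m≤n+o _ (hit e d)))
    go f@(hexa a b c d e g) #4 = first-face f true  e g (ℕ.m≤n⇒m≤o+n (δ e a * δ g b) (ℕ.m≤n⇒m≤o+n (δ e c * δ g d) (hit e g)))
    go f@(hexa a b c d e g) #5 = first-face f false a g (ℕ.m≤n⇒m≤o+n (δ a c * δ g b) (ℕ.m≤n⇒m≤o+n (δ a e * δ g d) (hit a g)))
    go (hexa a b c d e g) (6+ i) = ℕ.≤-trans (dirs-side L (o ∘ suc) i) (ℕ.m≤n+m _ _)

  dirs-cnt : ∀ {L : List (Face A B)} (o : Orientation L) x y → dirs o true x y + dirs o false x y ≡ cnt L x y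
  dirs-cnt []      x y = refl
  dirs-cnt {f ∷ L} (o ∷ os) x y = trans (lemma (dir (o xor true) f x y) (dirs os true x y) (dir (o xor false) f x y) (dirs os false x y))
    (cong₂ _+_ (two o) (dirs-cnt os x y))
    where
    lemma : ∀ p q r s → (p + q) + (r + s) ≡ (p + r) + (q + s)
    lemma = solve-∀
    two : ∀ o → dir (o xor true) f x y + dir (o xor false) f x y ≡ up f x y + down f x y
    two true  = ℕ.+-comm (down f x y) _
    two false = refl

data End (m n : ℕ) : Fin (m + n) → Set where
  left  : ∀ (a : Fin m) → End m n (a ↑ˡ n)
  right : ∀ (b : Fin n) → End m n (m ↑ʳ b)

end : ∀ m n u → End m n u
end m n u with splitAt m u | Fin.join-splitAt m n u
... | inj₁ a | eq = subst (End m n) eq (left a)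
... | inj₂ b | eq = subst (End m n) eq (right b)

-- The rotation system of a certified face list

module Build (m n : ℕ) (e : Fin m → Fin n → Bool)
  (adj′ : Fin (m + n) → Fin (m + n) → Bool) (sym′ : ∀ u w → adj′ u w ≡ adj′ w u)
  (adj-ab : ∀ a b → adj′ (a ↑ˡ n) (m ↑ʳ b) ≡ e a b)
  (adj-aa : ∀ a a′ → adj′ (a ↑ˡ n) (a′ ↑ˡ n) ≡ false)
  (adj-bb : ∀ b b′ → adj′ (m ↑ʳ b) (m ↑ʳ b′) ≡ false)
  (nbA : ∀ a → ∃[ b ] T (e a b)) (nbB : ∀ b → ∃[ a ] T (e a b))
  (L : List (Face (Fin m) (Fin n))) (C : Cert (λ a b → if e a b then 1 else 0) L) where

  G : Graph
  G = record { V = m + n ; adj = adj′ ; adj-sym = sym′ }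

  open Cert C

  private
    N : ℕ
    N = size L

    la : Fin N → Fin m
    la x = proj₁ (label L x)

    lb : Fin N → Fin n
    lb x = proj₂ (label L x)

    occ≡ : ∀ a b → occ a b (sideVec L) ≡ (if e a b then 1 else 0) + (if e a b then 1 else 0)
    occ≡ a b = trans (sym (occ-cnt L a b)) (count a b)

    occ≡2 : ∀ {a b} → T (e a b) → occ a b (sideVec L) ≡ 2
    occ≡2 {a} {b} t with e a b | occ≡ a b
    ... | true | eq = eq

    Γ-pos : ∀ {a b} → T (e a b) → 0 < (if e a b then 1 else 0)
    Γ-pos {a} {b} t with e a b
    ... | true = s≤s z≤n

    edge : ∀ x → T (e (la x) (lb x))
    edge x with e (la x) (lb x) | occ≡ (la x) (lb x)
    ... | true  | _  = tt
    ... | false | eq = contradiction refl (occ-0 (la x) (lb x) (sideVec L) eq x)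

    flag : ∀ {a b} → T (e a b) → ∃[ x ] label L x ≡ (a , b)
    flag {a} {b} t = occ-pos a b (sideVec L) (subst (0 <_) (sym (occ≡2 t)) z<s)

    abstract
      partner : ∀ x → ∃[ y ] (y ≢ x × label L y ≡ label L x × (∀ z → label L z ≡ label L x → z ≡ x ⊎ z ≡ y))
      partner x = occ-2 (la x) (lb x) (sideVec L) (occ≡2 (edge x)) x refl

    τ : Fin N → Fin N
    τ x = proj₁ (partner x)

    τ≢ : ∀ x → τ x ≢ x
    τ≢ x = proj₁ (proj₂ (partner x))

    label-τ : ∀ x → label L (τ x) ≡ label L x
    label-τ x = proj₁ (proj₂ (proj₂ (partner x)))

    same-label : ∀ {x y} → label L y ≡ label L x → y ≡ x ⊎ y ≡ τ x
    same-label {x} {y} = proj₂ (proj₂ (proj₂ (partner x))) y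

    ττ : ∀ x → τ (τ x) ≡ x
    ττ x with same-label (trans (label-τ (τ x)) (label-τ x))
    ... | inj₁ eq = eq
    ... | inj₂ eq = contradiction eq (τ≢ (τ x))

    -- `α` crosses a face at its vertex in A and `τ` crosses an edge, so alternating them circles
    -- around that vertex. `pos` will choose one of the two senses of rotation at each vertex.
    module RA = Dihedral (α L) τ (αα L) ττ (flips⇒≢ (α L) (upward L) (upward-α L)) τ≢
    module RB = Dihedral (β L) τ (ββ L) ττ (flips⇒≢ (β L) (upward L) (upward-β L)) τ≢

    conn-same-A : ∀ {x y} → label L y ≡ label L x → Star RA.Move x y
    conn-same-A eq with same-label eq
    ... | inj₁ refl = Star.ε
    ... | inj₂ refl = RA.byτ ◅ Star.ε

    conn-same-B : ∀ {x y} → label L y ≡ label L x → Star RB.Move x y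
    conn-same-B eq with same-label eq
    ... | inj₁ refl = Star.ε
    ... | inj₂ refl = RB.byτ ◅ Star.ε

    conn-A : ∀ {a b b′} → Star (Link L a) b b′ → ∀ {x y} → label L x ≡ (a , b) → label L y ≡ (a , b′) → Star RA.Move x y
    conn-A Star.ε p q = conn-same-A (trans q (sym p))
    conn-A (l ◅ ls) p q with Link-side {L = L} l
    ... | i , r , s = conn-same-A (trans r (sym p)) ◅◅ (RA.byα ◅ conn-A ls s q)

    conn-B : ∀ {b a a′} → Star (Colink L b) a a′ → ∀ {x y} → label L x ≡ (a , b) → label L y ≡ (a′ , b) → Star RB.Move x y
    conn-B Star.ε p q = conn-same-B (trans q (sym p))
    conn-B (l ◅ ls) p q with Colink-side {L = L} l
    ... | i , r , s = conn-same-B (trans r (sym p)) ◅◅ (RB.byα ◅ conn-B ls s q)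

    base-A : Fin m → Fin N
    base-A a = proj₁ (flag (proj₂ (nbA a)))

    base-B : Fin n → Fin N
    base-B b = proj₁ (flag (proj₂ (nbB b)))

    reach-A : ∀ x → Star RA.Move (base-A (la x)) x
    reach-A x = conn-A (link (la x) (proj₁ (nbA (la x))) (lb x) (Γ-pos (proj₂ (nbA (la x)))) (Γ-pos (edge x)))
                       (proj₂ (flag (proj₂ (nbA (la x))))) refl

    reach-B : ∀ x → Star RB.Move (base-B (lb x)) x
    reach-B x = conn-B (colink (lb x) (proj₁ (nbB (lb x))) (la x) (Γ-pos (proj₂ (nbB (lb x)))) (Γ-pos (edge x)))
                       (proj₂ (flag (proj₂ (nbB (lb x))))) refl

    mv : Bool → Fin N → Fin N
    mv true  = α L
    mv false = β L

    mv-mv : ∀ σ x → mv σ (mv σ x) ≡ x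
    mv-mv true  = αα L
    mv-mv false = ββ L

    abstract
      pos : Bool → Fin N → Bool
      pos true  = RA.pos la base-A reach-A (label-α L) (cong proj₁ ∘ label-τ)
      pos false = RB.pos lb base-B reach-B (label-β L) (cong proj₂ ∘ label-τ)

      pos-τ : ∀ σ x → pos σ (τ x) ≡ not (pos σ x)
      pos-τ true  = RA.pos-τ la base-A reach-A (label-α L) (cong proj₁ ∘ label-τ)
      pos-τ false = RB.pos-τ lb base-B reach-B (label-β L) (cong proj₂ ∘ label-τ)

      pos-mv : ∀ σ x → pos σ (mv σ x) ≡ not (pos σ x)
      pos-mv true  = RA.pos-α la base-A reach-A (label-α L) (cong proj₁ ∘ label-τ)
      pos-mv false = RB.pos-α lb base-B reach-B (label-β L) (cong proj₂ ∘ label-τ)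

      cyclic-A : ∀ x y → la x ≡ la y → pos true x ≡ true → pos true y ≡ true → ∃[ k ] iter (λ z → τ (mv true z)) k x ≡ y
      cyclic-A = RA.pos-cyclic la base-A reach-A (label-α L) (cong proj₁ ∘ label-τ)

      cyclic-B : ∀ x y → lb x ≡ lb y → pos false x ≡ true → pos false y ≡ true → ∃[ k ] iter (λ z → τ (mv false z)) k x ≡ y
      cyclic-B = RB.pos-cyclic lb base-B reach-B (label-β L) (cong proj₂ ∘ label-τ)

    start : Bool → Fin N → Fin (m + n)
    start true  x = la x ↑ˡ n
    start false x = m ↑ʳ lb x

    adj-start : ∀ σ x → T (adj′ (start σ x) (start (not σ) x))
    adj-start true  x = subst T (sym (adj-ab (la x) (lb x))) (edge x)
    adj-start false x = subst T (trans (sym (adj-ab (la x) (lb x))) (sym′ _ _)) (edge x)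

    toDart : Bool → Fin N → Dart G
    toDart σ x = (start σ x , start (not σ) x) , adj-start σ x

    start-label : ∀ σ {x y} → label L x ≡ label L y → start σ x ≡ start σ y
    start-label true  eq = cong (λ l → proj₁ l ↑ˡ n) eq
    start-label false eq = cong (λ l → m ↑ʳ proj₂ l) eq

    toDart-label : ∀ σ {x y} → label L x ≡ label L y → toDart σ x ≡ toDart σ y
    toDart-label σ eq = dart-≡ G (cong₂ _,_ (start-label σ eq) (start-label (not σ) eq))

    left≢right : ∀ {a : Fin m} {b : Fin n} → a ↑ˡ n ≢ m ↑ʳ b
    left≢right {a} {b} eq with trans (sym (Fin.splitAt-↑ˡ m a n)) (trans (cong (splitAt m) eq) (Fin.splitAt-↑ʳ m n b))
    ... | ()

    toDart-inj : ∀ {σ σ′ x y} → toDart σ x ≡ toDart σ′ y → σ ≡ σ′ × label L x ≡ label L y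
    toDart-inj {true}  {true}  eq = refl , cong₂ _,_ (Fin.↑ˡ-injective n _ _ (cong (proj₁ ∘ proj₁) eq)) (Fin.↑ʳ-injective m _ _ (cong (proj₂ ∘ proj₁) eq))
    toDart-inj {false} {false} eq = refl , cong₂ _,_ (Fin.↑ˡ-injective n _ _ (cong (proj₂ ∘ proj₁) eq)) (Fin.↑ʳ-injective m _ _ (cong (proj₁ ∘ proj₁) eq))
    toDart-inj {true}  {false} eq = contradiction (cong (proj₁ ∘ proj₁) eq) left≢right
    toDart-inj {false} {true}  eq = contradiction (sym (cong (proj₁ ∘ proj₁) eq)) left≢right

    same-pos : ∀ σ {x y} → label L x ≡ label L y → pos σ x ≡ pos σ y → x ≡ y
    same-pos σ {x} {y} eq p with same-label eq
    ... | inj₁ x≡y = x≡y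
    ... | inj₂ x≡τy = contradiction (trans (sym (trans (cong (pos σ) x≡τy) (pos-τ σ y))) p) (not≢ _)

    choose : ∀ σ b x → ∃[ y ] (label L y ≡ label L x × pos σ y ≡ b)
    choose σ b x with pos σ x ≟ᵇ b
    ... | yes eq = x , refl , eq
    ... | no ne  = τ x , label-τ x , trans (pos-τ σ x) (flip-≢ ne)

    -- Of the two sides of an edge, exactly one is swept by the chosen rotation at the source of the
    -- dart.
    Flag : Dart G → Set
    Flag d = Σ (Bool × Fin N) λ (σ , x) → toDart σ x ≡ d × pos σ x ≡ true

    dart-flag : ∀ d → Flag d
    dart-flag ((u , w) , p) = go (end m n u) (end m n w) p
      where
      go : ∀ {u w} → End m n u → End m n w → ∀ p → Flag ((u , w) , p)
      go (left a) (left a′) p = ⊥-elim (subst T (adj-aa a a′) p)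
      go (right b) (right b′) p = ⊥-elim (subst T (adj-bb b b′) p)
      go (left a) (right b) p with flag (subst T (adj-ab a b) p)
      ... | x , eq with choose true true x
      ...   | y , eq′ , py = (true , y) , dart-≡ G (cong (λ l → proj₁ l ↑ˡ n , m ↑ʳ proj₂ l) (trans eq′ eq)) , py
      go (right b) (left a) p with flag (subst T (trans (sym′ _ _) (adj-ab a b)) p)
      ... | x , eq with choose false true x
      ...   | y , eq′ , py = (false , y) , dart-≡ G (cong (λ l → m ↑ʳ proj₂ l , proj₁ l ↑ˡ n) (trans eq′ eq)) , py

    turn : ∀ {d} → Flag d → Dart G
    turn ((σ , x) , _) = toDart σ (mv σ x)

    unturn : ∀ {d} → Flag d → Dart G
    unturn ((σ , x) , _) = toDart σ (mv σ (τ x))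

    next′ prev′ : Dart G → Dart G
    next′ d = turn (dart-flag d)
    prev′ d = unturn (dart-flag d)

    flag-unique : ∀ {d} (φ ψ : Flag d) → proj₁ φ ≡ proj₁ ψ
    flag-unique ((σ , x) , p , q) ((σ′ , y) , p′ , q′) with toDart-inj {σ} {σ′} (trans p (sym p′))
    ... | refl , eq = cong (σ ,_) (same-pos σ eq (trans q (sym q′)))

    next-toDart : ∀ σ x → pos σ x ≡ true → next′ (toDart σ x) ≡ toDart σ (mv σ x)
    next-toDart σ x p = cong (λ (σ , x) → toDart σ (mv σ x)) (flag-unique (dart-flag (toDart σ x)) ((σ , x) , refl , p))

    prev-toDart : ∀ σ x → pos σ x ≡ false → prev′ (toDart σ x) ≡ toDart σ (mv σ x)
    prev-toDart σ x p = trans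
      (cong (λ (σ , x) → toDart σ (mv σ (τ x))) (flag-unique (dart-flag (toDart σ x)) ((σ , τ x) , toDart-label σ (label-τ x) , trans (pos-τ σ x) (cong not p))))
      (cong (λ z → toDart σ (mv σ z)) (ττ x))

    start-mv : ∀ σ x → start σ (mv σ x) ≡ start σ x
    start-mv true  x = cong (_↑ˡ n) (label-α L x)
    start-mv false x = cong (m ↑ʳ_) (label-β L x)

    next-src′ : ∀ d → src G (next′ d) ≡ src G d
    next-src′ d with dart-flag d
    ... | (σ , x) , refl , _ = start-mv σ x

    prev-next′ : ∀ d → prev′ (next′ d) ≡ d
    prev-next′ d with dart-flag d
    ... | (σ , x) , refl , p = trans (prev-toDart σ (mv σ x) (trans (pos-mv σ x) (cong not p))) (cong (toDart σ) (mv-mv σ x))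

    next-prev′ : ∀ d → next′ (prev′ d) ≡ d
    next-prev′ d with dart-flag d
    ... | (σ , x) , refl , p = trans (next-toDart σ (mv σ (τ x)) (trans (pos-mv σ (τ x)) (trans (cong not (pos-τ σ x)) (trans (not-involutive _) p))))
          (trans (cong (toDart σ) (mv-mv σ (τ x))) (toDart-label σ (label-τ x)))

    ρ : Bool → Fin N → Fin N
    ρ σ x = τ (mv σ x)

    pos-ρ : ∀ σ x → pos σ x ≡ true → pos σ (ρ σ x) ≡ true
    pos-ρ σ x p = trans (pos-τ σ _) (trans (cong not (pos-mv σ x)) (trans (not-involutive _) p))

    iter-next : ∀ σ k x → pos σ x ≡ true → iter next′ k (toDart σ x) ≡ toDart σ (iter (ρ σ) k x) × pos σ (iter (ρ σ) k x) ≡ true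
    iter-next σ zero    x p = refl , p
    iter-next σ (suc k) x p with iter-next σ k x p
    ... | eq , q = trans (cong next′ eq) (trans (next-toDart σ _ q) (toDart-label σ (sym (label-τ _)))) , pos-ρ σ _ q

    cyclic′ : ∀ d d′ → src G d ≡ src G d′ → ∃[ k ] iter next′ k d ≡ d′
    cyclic′ d d′ eq with dart-flag d | dart-flag d′
    ... | (true , x) , refl , p | (true , y) , refl , q with cyclic-A x y (Fin.↑ˡ-injective n _ _ eq) p q
    ...   | k , refl = k , proj₁ (iter-next true k x p)
    cyclic′ d d′ eq | (false , x) , refl , p | (false , y) , refl , q with cyclic-B x y (Fin.↑ʳ-injective m _ _ eq) p q
    ...   | k , refl = k , proj₁ (iter-next false k x p)
    cyclic′ d d′ eq | (true , x) , refl , p | (false , y) , refl , q = contradiction eq left≢right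
    cyclic′ d d′ eq | (false , x) , refl , p | (true , y) , refl , q = contradiction (sym eq) left≢right

    -- Rotations at the two ends that sweep the same side of the edge turn in opposite senses, as
    -- seen along the edge; equal values of `pos` therefore mean a twisted edge.
    bit : Fin m → Fin n → Bool
    bit a b with T? (e a b)
    ... | yes t = let (x , _) = flag t in not (pos true x xor pos false x)
    ... | no _  = false

    sign″ : Fin m ⊎ Fin n → Fin m ⊎ Fin n → Bool
    sign″ (inj₁ a) (inj₂ b) = bit a b
    sign″ (inj₂ b) (inj₁ a) = bit a b
    sign″ _        _        = false

    sign″-sym : ∀ s t → sign″ s t ≡ sign″ t s
    sign″-sym (inj₁ a) (inj₂ b)  = refl
    sign″-sym (inj₂ b) (inj₁ a)  = refl
    sign″-sym (inj₁ a) (inj₁ a′) = refl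
    sign″-sym (inj₂ b) (inj₂ b′) = refl

  R : RotSys G
  R = record
    { next = next′ ; prev = prev′ ; next-src = next-src′ ; prev-next = prev-next′ ; next-prev = next-prev′ ; cyclic = cyclic′
    ; sign = λ u w → sign″ (splitAt m u) (splitAt m w)
    ; sign-sym = λ u w → sign″-sym (splitAt m u) (splitAt m w) }

  private
    sign′ : Fin (m + n) → Fin (m + n) → Bool
    sign′ = RotSys.sign R

    bit-label : ∀ x → bit (la x) (lb x) ≡ not (pos true x xor pos false x)
    bit-label x with T? (e (la x) (lb x))
    ... | no ¬t = contradiction (edge x) ¬t
    ... | yes t with flag t
    ...   | y , eq with same-label {x} {y} eq
    ...     | inj₁ refl = refl
    ...     | inj₂ refl rewrite pos-τ true x | pos-τ false x with pos true x | pos false x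
    ...       | true  | true  = refl
    ...       | true  | false = refl
    ...       | false | true  = refl
    ...       | false | false = refl

    sign-toDart : ∀ σ x → sign′ (start σ x) (start (not σ) x) ≡ not (pos true x xor pos false x)
    sign-toDart true  x rewrite Fin.splitAt-↑ˡ m (la x) n | Fin.splitAt-↑ʳ m n (lb x) = bit-label x
    sign-toDart false x rewrite Fin.splitAt-↑ˡ m (la x) n | Fin.splitAt-↑ʳ m n (lb x) = bit-label x

    -- Conjugates walking along a face to face tracing. The direction is negated so that, after
    -- passing the signature, it equals `pos` at the far end and makes the rotation there turn into
    -- the face of `x`.
    Ψ : Bool × Fin N → Dart G × Bool
    Ψ (σ , x) = toDart σ x , not (pos σ x)

    rev-toDart : ∀ σ x → rev G (toDart σ x) ≡ toDart (not σ) x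
    rev-toDart true  x = dart-≡ G refl
    rev-toDart false x = dart-≡ G refl

    dir-toDart : ∀ σ x → not (pos σ x) xor sign′ (start σ x) (start (not σ) x) ≡ pos (not σ) x
    dir-toDart σ x rewrite sign-toDart σ x with σ | pos true x in p | pos false x in q
    ... | true  | true  | true  rewrite p | q = refl
    ... | true  | true  | false rewrite p | q = refl
    ... | true  | false | true  rewrite p | q = refl
    ... | true  | false | false rewrite p | q = refl
    ... | false | true  | true  rewrite p | q = refl
    ... | false | true  | false rewrite p | q = refl
    ... | false | false | true  rewrite p | q = refl
    ... | false | false | false rewrite p | q = refl

    along-mv : ∀ σ x → along L (σ , x) ≡ (not σ , mv (not σ) x)
    along-mv true  x = refl
    along-mv false x = refl

    step-Ψ : ∀ s → faceStep G R (Ψ s) ≡ Ψ (along L s)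
    step-Ψ (σ , x) = begin
      (if not (pos σ x) xor sign′ (start σ x) (start (not σ) x) then next′ (rev G (toDart σ x)) else prev′ (rev G (toDart σ x))) ,
        not (pos σ x) xor sign′ (start σ x) (start (not σ) x)
        ≡⟨ cong₂ (λ dr d → (if dr then next′ d else prev′ d) , dr) (dir-toDart σ x) (rev-toDart σ x) ⟩
      (if pos (not σ) x then next′ (toDart (not σ) x) else prev′ (toDart (not σ) x)) , pos (not σ) x
        ≡⟨ cong₂ _,_ (branch (pos (not σ) x) refl) (sym (trans (cong not (pos-mv (not σ) x)) (not-involutive _))) ⟩
      Ψ (not σ , mv (not σ) x)
        ≡⟨ cong Ψ (sym (along-mv σ x)) ⟩
      Ψ (along L (σ , x)) ∎
      where
      open ≡-Reasoning
      branch : ∀ b → pos (not σ) x ≡ b → (if b then next′ (toDart (not σ) x) else prev′ (toDart (not σ) x)) ≡ toDart (not σ) (mv (not σ) x)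
      branch true  eq = next-toDart (not σ) x eq
      branch false eq = prev-toDart (not σ) x eq

    iter-Ψ : ∀ k s → iter (faceStep G R) k (Ψ s) ≡ Ψ (iter (along L) k s)
    iter-Ψ zero    s = refl
    iter-Ψ (suc k) s = trans (cong (faceStep G R) (iter-Ψ k s)) (step-Ψ _)

    Ψ⁻ : Dart G × Bool → Bool × Fin N
    Ψ⁻ (d , b) with dart-flag d
    ... | (σ , x) , _ = σ , proj₁ (choose σ (not b) x)

    ΨΨ⁻ : ∀ t → Ψ (Ψ⁻ t) ≡ t
    ΨΨ⁻ (d , b) with dart-flag d
    ... | (σ , x) , refl , p with choose σ (not b) x
    ...   | y , eq , q = cong₂ _,_ (toDart-label σ eq) (trans (cong not q) (not-involutive b))

    Ψ-inj : ∀ s t → Ψ s ≡ Ψ t → s ≡ t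
    Ψ-inj (σ , x) (σ′ , y) eq with toDart-inj {σ} {σ′} (cong proj₁ eq)
    ... | refl , eq′ = cong (σ ,_) (same-pos σ eq′ (not-injective (cong proj₂ eq)))

    Ψ⁻Ψ : ∀ s → Ψ⁻ (Ψ s) ≡ s
    Ψ⁻Ψ s = Ψ-inj _ s (ΨΨ⁻ (Ψ s))

    decode : Fin 2 → Bool
    decode #1 = true
    decode #0 = false

    code-decode : ∀ i → code (decode i) ≡ i
    code-decode #0 = refl
    code-decode #1 = refl

    -- A face tracing orbit is a face together with one of its two directions.
    class : Bool × Fin N → Fin (length L * 2)
    class (σ , x) = combine (faceOf L x) (code (upward L x xor σ))

    class-along : ∀ k s → class (iter (along L) k s) ≡ class s
    class-along zero    s = refl
    class-along (suc k) s = trans (cong₂ (λ f u → combine f (code u)) (along-faceOf L (iter (along L) k s)) (along-upward L (iter (along L) k s))) (class-along k s)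

    orbits : HasOrbits (faceStep G R) (length L * 2)
    orbits = class ∘ Ψ⁻ , surjective , transitive , invariant
      where
      surjective : ∀ i → ∃[ t ] class (Ψ⁻ t) ≡ i
      surjective i = Ψ s , trans (cong class (Ψ⁻Ψ s)) (trans (cong₂ (λ f u → combine f (code u)) (faceOf-first L f) (trans (cong (_xor not (decode u)) (upward-first L f)) (not-involutive _)))
          (trans (cong (combine f) (code-decode u)) (Fin.combine-remQuot {length L} 2 i)))
        where
        f = proj₁ (remQuot {length L} 2 i)
        u = proj₂ (remQuot {length L} 2 i)
        s : Bool × Fin N
        s = not (decode u) , first L f
      transitive : ∀ s t → class (Ψ⁻ s) ≡ class (Ψ⁻ t) → ∃[ k ] iter (faceStep G R) k s ≡ t
      transitive s t eq with Fin.combine-injective (faceOf L (proj₂ (Ψ⁻ s))) _ (faceOf L (proj₂ (Ψ⁻ t))) _ eq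
      ... | p , q with along-reach L (Ψ⁻ s) (Ψ⁻ t) p (code-inj q)
      ...   | k , r = k , trans (cong (iter (faceStep G R) k) (sym (ΨΨ⁻ s))) (trans (iter-Ψ k (Ψ⁻ s)) (trans (cong Ψ r) (ΨΨ⁻ t)))
      invariant : ∀ s k → class (Ψ⁻ (iter (faceStep G R) k s)) ≡ class (Ψ⁻ s)
      invariant s k = begin
        class (Ψ⁻ (iter (faceStep G R) k s))          ≡⟨ cong (λ z → class (Ψ⁻ (iter (faceStep G R) k z))) (sym (ΨΨ⁻ s)) ⟩
        class (Ψ⁻ (iter (faceStep G R) k (Ψ (Ψ⁻ s)))) ≡⟨ cong (class ∘ Ψ⁻) (iter-Ψ k (Ψ⁻ s)) ⟩
        class (Ψ⁻ (Ψ (iter (along L) k (Ψ⁻ s))))      ≡⟨ cong class (Ψ⁻Ψ _) ⟩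
        class (iter (along L) k (Ψ⁻ s))               ≡⟨ class-along k (Ψ⁻ s) ⟩
        class (Ψ⁻ s) ∎
        where open ≡-Reasoning

  -- The two sides of an edge stand for its two darts.
  darts : Card (Dart G) N
  darts = mk↔ₛ′ to from to-from from-to
    where
    to : Dart G → Fin N
    to d with dart-flag d
    ... | (true , x) , _  = x
    ... | (false , x) , _ = proj₁ (choose true false x)
    from : Fin N → Dart G
    from x = toDart (pos true x) x
    from-to : ∀ d → from (to d) ≡ d
    from-to d with dart-flag d
    ... | (true , x) , refl , p = cong (λ b → toDart b x) p
    ... | (false , x) , refl , p with choose true false x
    ...   | y , eq , q = trans (cong (λ b → toDart b y) q) (toDart-label false eq)
    to-from : ∀ x → to (from x) ≡ x
    to-from x with pos true x in px
    ... | true with dart-flag (toDart true x)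
    ...   | (true , y) , eq , q = same-pos true (proj₂ (toDart-inj {true} {true} eq)) (trans q (sym px))
    ...   | (false , y) , eq , q with proj₁ (toDart-inj {false} {true} eq)
    ...     | ()
    to-from x | false with dart-flag (toDart false x)
    ...   | (true , y) , eq , q with proj₁ (toDart-inj {true} {false} eq)
    ...     | ()
    to-from x | false | (false , y) , eq , q with choose true false y
    ...     | z , eq′ , q′ = same-pos true (trans eq′ (proj₂ (toDart-inj {false} {false} eq))) (trans q′ (sym px))

  -- Switching by `s` makes all rotations agree, so `way` tells which of the two sides of its edge a
  -- side is. Along a face both `way` and `upward` alternate; their xor is constant on the face and
  -- orients it.
  coherent : Orientable G R → Coherent L
  coherent (s , h) = orient L face-bit , bounded
    where
    way : Fin N → Bool
    way x = pos true x xor s (start true x)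
    way-B : ∀ x → way x ≡ not (pos false x xor s (start false x))
    way-B x = untangle (pos true x) (pos false x) _ _ (trans (sym (sign-toDart true x)) (h _ _ (adj-start true x)))
      where
      untangle : ∀ b c t u → not (b xor c) ≡ t xor u → b xor t ≡ not (c xor u)
      untangle true  true  true  false _ = refl
      untangle true  true  false true  _ = refl
      untangle true  false true  true  _ = refl
      untangle true  false false false _ = refl
      untangle false true  true  true  _ = refl
      untangle false true  false false _ = refl
      untangle false false true  false _ = refl
      untangle false false false true  _ = refl
    not-xor : ∀ b c → not b xor c ≡ not (b xor c)
    not-xor true  c = sym (not-involutive c)
    not-xor false c = refl
    way-τ : ∀ x → way (τ x) ≡ not (way x)
    way-τ x = trans (cong₂ (λ b u → b xor s u) (pos-τ true x) (start-label true (label-τ x))) (not-xor (pos true x) _)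
    way-along : ∀ t → way (proj₂ (along L t)) ≡ not (way (proj₂ t))
    way-along (false , x) = trans (cong₂ (λ b u → b xor s u) (pos-mv true x) (start-mv true x)) (not-xor (pos true x) _)
    way-along (true , x)  = trans (way-B (β L x)) (trans (cong not (trans (cong₂ (λ b u → b xor s u) (pos-mv false x) (start-mv false x)) (not-xor (pos false x) _)))
                              (cong not (sym (way-B x))))
    level : Fin N → Bool
    level x = way x xor upward L x
    level-along : ∀ k t → level (proj₂ (iter (along L) k t)) ≡ level (proj₂ t)
    level-along zero    t = refl
    level-along (suc k) t = trans (trans (cong₂ _xor_ (way-along t′) (upward-along t′)) (not-not (way (proj₂ t′)) _)) (level-along k t)
      where
      t′ = iter (along L) k t
      upward-along : ∀ t → upward L (proj₂ (along L t)) ≡ not (upward L (proj₂ t))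
      upward-along (true , x)  = upward-β L x
      upward-along (false , x) = upward-α L x
      not-not : ∀ b c → not b xor not c ≡ b xor c
      not-not true  c = refl
      not-not false c = not-involutive c
    face-bit : Fin (length L) → Bool
    face-bit f = level (first L f)
    face-level : ∀ x → face-bit (faceOf L x) xor upward L x ≡ way x
    face-level x with to-first L x true
    ... | k , eq = trans (cong (_xor upward L x) (trans (sym (cong (level ∘ proj₂) eq)) (level-along k (true , x)))) (cancel (way x) _)
      where
      cancel : ∀ b c → (b xor c) xor c ≡ b
      cancel true  true  = refl
      cancel true  false = refl
      cancel false true  = refl
      cancel false false = refl
    o : Orientation L
    o = orient L face-bit
    each : ∀ d {x y} → T (e x y) → 0 < dirs o d x y
    each d {a} {b} t with flag t
    ... | x , refl = go (way x ≟ᵇ d)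
      where
      go : Dec (way x ≡ d) → 0 < dirs o d a b
      -- One of the two sides of the edge runs in the direction `d`: this one or, as `way` differs
      -- on it, its partner.
      go (yes eq) = subst (λ d → 0 < dirs o d a b) (trans (face-level x) eq) (dirs-side L face-bit x)
      go (no ne)  = subst₂ (λ d l → 0 < dirs o d (proj₁ l) (proj₂ l)) (trans (face-level (τ x)) (trans (way-τ x) (flip-≢ ne))) (label-τ x) (dirs-side L face-bit (τ x))
    bounded : ∀ d x y → dirs o d x y ≤ 1
    bounded d x y with T? (e x y)
    ... | yes t = two d (each true t) (each false t) (trans (dirs-cnt o x y) (trans (occ-cnt L x y) (occ≡2 t)))
      where
      two : ∀ d → 0 < dirs o true x y → 0 < dirs o false x y → dirs o true x y + dirs o false x y ≡ 2 → dirs o d x y ≤ 1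
      two true  p q eq = ℕ.+-cancelʳ-≤ 1 _ 1 (ℕ.≤-trans (ℕ.+-monoʳ-≤ (dirs o true x y) q) (ℕ.≤-reflexive eq))
      two false p q eq = ℕ.+-cancelˡ-≤ 1 _ 1 (ℕ.≤-trans (ℕ.+-monoˡ-≤ (dirs o false x y) p) (ℕ.≤-reflexive eq))
    ... | no ¬t = ℕ.≤-trans (none d) z≤n
      where
      zero-sum : dirs o true x y + dirs o false x y ≡ 0
      zero-sum = trans (dirs-cnt o x y) (trans (count x y) (off ¬t))
        where
        off : ¬ T (e x y) → (if e x y then 1 else 0) + (if e x y then 1 else 0) ≡ 0
        off ¬t with e x y
        ... | true  = contradiction tt ¬t
        ... | false = refl
      none : ∀ d → dirs o d x y ≤ 0
      none true  = ℕ.≤-reflexive (ℕ.m+n≡0⇒m≡0 _ zero-sum)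
      none false = ℕ.≤-reflexive (ℕ.m+n≡0⇒n≡0 (dirs o true x y) zero-sum)

  -- Only finitely many switchings exist. The decision is what lets an embedding of Euler genus
  -- below h be placed in the right alternative of `EmbedsInN`.
  orientable? : Dec (Orientable G R)
  orientable? = map′ (λ (s , h) → lookup s , h)
    (λ (s , h) → Vec.tabulate s , λ u w t → trans (h u w t) (sym (cong₂ _xor_ (lookup∘tabulate s u) (lookup∘tabulate s w))))
    (anySubset? λ s → Fin.all? λ u → Fin.all? λ w → T? (adj′ u w) →-dec (sign′ u w ≟ᵇ (lookup s u xor lookup s w)))

  embeds : ∀ g h → 2 * (m + n) + length L * 2 + 2 * g ≡ 4 + size L → (¬ Coherent L × g ≤ h) ⊎ g < h → EmbedsInN G h
  embeds g h euler how = R , g , (N , length L * 2 , darts , orbits , euler) , go how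
    where
    go : (¬ Coherent L × g ≤ h) ⊎ g < h → (¬ Orientable G R × g ≤ h) ⊎ (Orientable G R × g < h)
    go (inj₁ (nc , le)) = inj₁ (nc ∘ coherent , le)
    go (inj₂ lt) with orientable?
    ... | yes or = inj₂ (or , lt)
    ... | no nor = inj₁ (nor , ℕ.<⇒≤ lt)

-- The lower bound

-- A bipartition (side) and minimum degree two force every facial walk to have length at least four.
module FaceLength (G : Graph) (side : Fin (V G) → Bool)
  (bipartite : ∀ u w → T (adj G u w) → side w ≡ not (side u))
  (branch : ∀ (d : Dart G) → ∃[ d′ ] (src G d′ ≡ src G d × d′ ≢ d)) (R : RotSys G) where

  open RotSys R

  private
    State : Set
    State = Dart G × Bool

    f : State → State
    f = faceStep G R

    turn : Bool → Dart G → Dart G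
    turn b d = if b then next d else prev d

    prev-src : ∀ d → src G (prev d) ≡ src G d
    prev-src d = trans (sym (next-src (prev d))) (cong (src G) (next-prev d))

    turn-src : ∀ b d → src G (turn b d) ≡ src G d
    turn-src true  = next-src
    turn-src false = prev-src

    fixed : ∀ b d → turn b d ≡ d → next d ≡ d
    fixed true  d eq = eq
    fixed false d eq = trans (cong next (sym eq)) (next-prev d)

    -- A fixed dart would be the whole rotation at its vertex, against degree at least two.
    moves : ∀ b d → turn b d ≢ d
    moves b d eq with branch d
    ... | d′ , at-end , ne with cyclic d d′ (sym at-end)
    ...   | k , eq′ = ne (trans (sym eq′) (stuck k))
      where
      stuck : ∀ k → iter next k d ≡ d
      stuck zero    = refl
      stuck (suc k) = trans (cong next (stuck k)) (fixed b d eq)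

    f-turn : ∀ s → ∃[ b ] (proj₁ (f s) ≡ turn b (rev G (proj₁ s)))
    f-turn (d , b) = b xor sign (src G d) (tgt G d) , refl

    f-src : ∀ s → src G (proj₁ (f s)) ≡ tgt G (proj₁ s)
    f-src s with f-turn s
    ... | b , eq = trans (cong (src G) eq) (turn-src b _)

    -- Returning after two steps means that the first step turned the reversed dart into itself.
    -- Closed walks of length one and three are excluded by the bipartition.
    f²≢ : ∀ s → f (f s) ≢ s
    f²≢ s eq = moves (proj₁ (f-turn s)) (rev G (proj₁ s)) (trans (sym (proj₂ (f-turn s))) (dart-≡ G (cong₂ _,_ (f-src s)
                 (trans (sym (f-src (f s))) (cong (src G ∘ proj₁) eq)))))

    colour : State → Bool
    colour s = side (src G (proj₁ s))

    colour-f : ∀ s → colour (f s) ≡ not (colour s)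
    colour-f s = trans (cong side (f-src s)) (bipartite _ _ (proj₂ (proj₁ s)))

    f≢ : ∀ s → f s ≢ s
    f≢ s eq with colour s | trans (sym (cong colour eq)) (colour-f s)
    ... | true  | ()
    ... | false | ()

    f³≢ : ∀ s → f (f (f s)) ≢ s
    f³≢ s eq with colour s | trans (sym (cong colour eq)) (trans (colour-f (f (f s))) (cong not (trans (colour-f (f s)) (cong not (colour-f s)))))
    ... | true  | ()
    ... | false | ()

    four : ∀ s (i j : Fin 4) → iter f (toℕ i) s ≡ iter f (toℕ j) s → i ≡ j
    four s #0 #0 eq = refl
    four s #0 #1 eq = contradiction (sym eq) (f≢ s)
    four s #0 #2 eq = contradiction (sym eq) (f²≢ s)
    four s #0 #3 eq = contradiction (sym eq) (f³≢ s)
    four s #1 #0 eq = contradiction eq (f≢ s)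
    four s #1 #1 eq = refl
    four s #1 #2 eq = contradiction (sym eq) (f≢ (f s))
    four s #1 #3 eq = contradiction (sym eq) (f²≢ (f s))
    four s #2 #0 eq = contradiction eq (f²≢ s)
    four s #2 #1 eq = contradiction eq (f≢ (f s))
    four s #2 #2 eq = refl
    four s #2 #3 eq = contradiction (sym eq) (f≢ (f (f s)))
    four s #3 #0 eq = contradiction eq (f³≢ s)
    four s #3 #1 eq = contradiction eq (f²≢ (f s))
    four s #3 #2 eq = contradiction eq (f≢ (f (f s)))
    four s #3 #3 eq = refl

  -- The first four states from a representative of each orbit are distinct, which injects
  -- `Fin c × Fin 4` into the states.
  orbits≤ : ∀ {c d} → Card (Dart G) d → HasOrbits f c → c * 4 ≤ d * 2
  orbits≤ {c} {d} card (r , surj , _ , inv) = Fin.injective⇒≤ {f = into ∘ state ∘ remQuot 4} injective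
    where
    state : Fin c × Fin 4 → State
    state (i , j) = iter f (toℕ j) (proj₁ (surj i))
    into : State → Fin (d * 2)
    into (x , b) = combine (Inverse.to card x) (code b)
    r-state : ∀ p → r (state p) ≡ proj₁ p
    r-state (i , j) = trans (inv _ (toℕ j)) (proj₂ (surj i))
    into-inj : ∀ {s t} → into s ≡ into t → s ≡ t
    into-inj {x , b} {y , b′} eq with Fin.combine-injective (Inverse.to card x) (code b) _ _ eq
    ... | p , q = cong₂ _,_ (trans (sym (Inverse.strictlyInverseʳ card x)) (trans (cong (Inverse.from card) p) (Inverse.strictlyInverseʳ card y))) (code-inj q)
    state-inj : ∀ {p q} → state p ≡ state q → p ≡ q
    state-inj {i , j} {i′ , j′} eq with trans (sym (r-state (i , j))) (trans (cong r eq) (r-state (i′ , j′)))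
    ... | refl = cong (i ,_) (four _ j j′ eq)
    injective : ∀ {x y} → into (state (remQuot 4 x)) ≡ into (state (remQuot 4 y)) → x ≡ y
    injective {x} {y} eq = trans (sym (Fin.combine-remQuot {c} 4 x)) (trans (cong (λ (i , j) → combine i j) (state-inj (into-inj eq))) (Fin.combine-remQuot {c} 4 y))

-- Small embeddings and the induction

-- Numerals beyond the range are clamped to the last vertex, which keeps the tables below total.
pick : ∀ {n} → ℕ → Fin (suc n)
pick {n}     zero    = zero
pick {zero}  (suc i) = zero
pick {suc n} (suc i) = suc (pick i)

vtx : ∀ {k p} → ℕ → Side (suc k) p
vtx {k} i = Fin.splitAt (suc k) (pick i)

table : ∀ {A B : Set} → (ℕ → A) → (ℕ → B) → List (ℕ × ℕ × ℕ × ℕ) → List (Face A B)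
table g h = map (λ (a , b , c , d) → quad (g a) (h b) (g c) (h d))

module _ {A B : Set} {{_ : Eq A}} {{_ : Eq B}} where

  distinct? : Face A B → Bool
  distinct? (quad a b c d)     = not (does (a ≟ c)) ∧ not (does (b ≟ d))
  distinct? (hexa _ _ _ _ _ _) = false

  does-≢ : ∀ {C : Set} {{_ : Eq C}} (x y : C) → T (not (does (x ≟ y))) → x ≢ y
  does-≢ x y t with x ≟ y
  ... | no ne = ne

  distinct-face : ∀ (f : Face A B) → T (distinct? f) → Distinct f
  distinct-face (quad a b c d) t = does-≢ a c (T-∧₁ t) , does-≢ b d (T-∧₂ {not (does (a ≟ c))} t)

  distinct-sound : ∀ (L : List (Face A B)) → T (all distinct? L) → All Distinct L
  distinct-sound []      t = []
  distinct-sound (f ∷ L) t = distinct-face f (T-∧₁ t) ∷ distinct-sound L (T-∧₂ {distinct? f} t)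

Distinct-weaken : ∀ {A B : Set} {PA : A → Set} {PB : B → Set} (f : Face A B) → Distinct f → Simple PA PB f
Distinct-weaken (quad a b c d) ne = ne

hexes-distinct : ∀ {A B : Set} {L : List (Face A B)} → All Distinct L → hexes L ≡ 0
hexes-distinct []                            = refl
hexes-distinct {L = quad _ _ _ _ ∷ L} (_ ∷ ds) = hexes-distinct ds

-- The subscripts are k, p, q of the graph, so k exceeds the first argument of `Seed` by one. This
-- graph is the cube, drawn on the sphere.
seed₄₀₀ : Seed 3 0 0
seed₄₀₀ = seed {a = vtx 2} {vtx 1} {vtx 3} {vtx 1} {vtx 3} {vtx 1} {vtx 2} {vtx 1}
  (table vtx vtx ((0 , 1 , 3 , 2) ∷ (1 , 2 , 3 , 0) ∷ []))
  (check-sound 4 E _ tt) (distinct-sound _ tt)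

-- This pattern starts at k = 6, since (k, p, q) = (4, 0, 1) is excluded.
seed₆₀₁ : Seed 5 0 1
seed₆₀₁ = seed {a = vtx 4} {vtx 2} {vtx 5} {vtx 3} {vtx 1} {vtx 5} {vtx 6} {vtx 2}
  (table vtx vtx ((3 , 1 , 5 , 0) ∷ (2 , 1 , 5 , 6) ∷ (3 , 0 , 1 , 2) ∷ (3 , 2 , 0 , 5) ∷ (3 , 5 , 2 , 4) ∷
                  (3 , 4 , 1 , 6) ∷ (0 , 2 , 5 , 3) ∷ (0 , 3 , 1 , 4) ∷ (0 , 4 , 5 , 6) ∷ (2 , 4 , 5 , 3) ∷
                  (2 , 0 , 1 , 5) ∷ (2 , 3 , 4 , 6) ∷ (1 , 2 , 4 , 3) ∷ (1 , 5 , 4 , 6) ∷ []))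
  (check-sound 4 E _ tt) (distinct-sound _ tt)

seed₄₀₂ : Seed 3 0 2
seed₄₀₂ = seed {a = vtx 2} {vtx 3} {vtx 1} {vtx 3} {vtx 1} {vtx 3} {vtx 4} {vtx 4}
  (table vtx vtx ((0 , 4 , 1 , 5) ∷ (0 , 3 , 1 , 2) ∷ (0 , 2 , 3 , 5) ∷ (1 , 2 , 3 , 0) ∷ (1 , 3 , 2 , 5) ∷
                  (2 , 4 , 3 , 5) ∷ []))
  (check-sound 4 E _ tt) (distinct-sound _ tt)

seed₂₁₂ : Seed 1 1 2
seed₂₁₂ = seed {a = vtx 2} {vtx 1} {vtx 1} {vtx 1} {vtx 2} {vtx 1} {vtx 3} {vtx 3}
  (table vtx vtx ((0 , 1 , 2 , 3) ∷ []))
  (check-sound 4 E _ tt) (distinct-sound _ tt)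

seed₂₂₂ : Seed 1 2 2
seed₂₂₂ = seed {a = vtx 3} {vtx 2} {vtx 1} {vtx 2} {vtx 1} {vtx 2} {vtx 3} {vtx 3}
  (table vtx vtx ((0 , 2 , 1 , 3) ∷ (1 , 2 , 2 , 0) ∷ (2 , 2 , 3 , 3) ∷ []))
  (check-sound 4 E _ tt) (distinct-sound _ tt)

-- This pattern starts at k = 7: the graph with k = 5 is excluded, and the one with k = 3 is a
-- six-cycle.
seed₇₀₀ : Seed 6 0 0
seed₇₀₀ = seed {a = vtx 2} {vtx 5} {vtx 1} {vtx 4} {vtx 1} {vtx 3} {vtx 5} {vtx 5}
  (table vtx vtx ((4 , 6 , 2 , 5) ∷ (0 , 3 , 4 , 2) ∷ (0 , 2 , 3 , 4) ∷ (0 , 4 , 1 , 6) ∷ (0 , 5 , 3 , 6) ∷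
                  (3 , 2 , 1 , 0) ∷ (1 , 2 , 6 , 4) ∷ (4 , 2 , 5 , 6) ∷ (5 , 2 , 6 , 0) ∷ (1 , 6 , 5 , 3) ∷
                  (4 , 3 , 6 , 0) ∷ (1 , 3 , 6 , 5) ∷ (2 , 3 , 5 , 4) ∷ (2 , 4 , 3 , 6) ∷ (3 , 0 , 4 , 1) ∷
                  (3 , 1 , 6 , 5) ∷ (5 , 1 , 6 , 4) ∷ []))
  (check-sound 4 E _ tt) (distinct-sound _ tt)

seed₃₀₂ : Seed 2 0 2
seed₃₀₂ = seed {a = vtx 2} {vtx 1} {vtx 1} {vtx 1} {vtx 3} {vtx 1} {vtx 2} {vtx 4}
  (table vtx vtx ((0 , 1 , 2 , 4) ∷ (0 , 2 , 1 , 4) ∷ []))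
  (check-sound 4 E _ tt) (distinct-sound _ tt)

-- The four faces of the seed position already make up the whole sphere.
seed₁₂₂ : Seed 0 2 2
seed₁₂₂ = seed {a = vtx 1} {vtx 2} {vtx 2} {vtx 2} {vtx 2} {vtx 1} {vtx 1} {vtx 1}
  (table vtx vtx ([]))
  (check-sound 4 E _ tt) (distinct-sound _ tt)

X : ℕ → ℕ → ℕ → ℕ
X k p q = (k + p ∸ 2) * (k + q ∸ 2)

-- In the second alternative of status the surface is the sphere.
record Quad (k p q : ℕ) : Set where
  constructor quadrangulation
  field
    drawn  : Embedded 0 true true k p q
    status : NonOrientable drawn ⊎ X k p q ≡ k
    room   : k ≤ X k p q

seed-embedded : ∀ {k p q} → Seed k p q → Embedded 0 true true (suc k) p q
seed-embedded s = embedded (Seed.faces s) (Seed.cert s) (All.map (λ {f} → Distinct-weaken f) (Seed.distinct s)) (hexes-distinct (Seed.distinct s))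

module _ {k p q : ℕ} (s : Seed k p q) (status : ¬ Coherent (Seed.faces s) ⊎ X (suc k) p q ≡ suc k)
  (m≥3 : T (3 ≤ᵇ suc k + p)) (n≥3 : T (3 ≤ᵇ suc k + q)) (room : T (suc k ≤ᵇ X (suc k) p q)) where

  private
    seeds : ∀ i → Seed (i * 2 + k) p q
    seeds zero    = s
    seeds (suc i) = proj₁ (grow-seed (seeds i))

    large : ∀ i {p} → T (3 ≤ᵇ suc k + p) → 3 ≤ suc (i * 2 + k) + p
    large i {p} t = ℕ.≤-trans (ℕ.≤ᵇ⇒≤ 3 _ t) (s≤s (ℕ.+-monoˡ-≤ p (ℕ.m≤n+m k (i * 2))))

    product : ∀ {k a b} → k ≤ a → 3 ≤ a → 3 ≤ b → 2 + k ≤ a * b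
    product {k} {a} {b} le a≥3 b≥3 = begin
      2 + k           ≤⟨ ℕ.+-mono-≤ (ℕ.≤-trans (ℕ.n≤1+n 2) a≥3) le ⟩
      a + a           ≤⟨ ℕ.+-monoʳ-≤ a (ℕ.m≤m+n a (a + 0)) ⟩
      3 * a           ≤⟨ ℕ.*-monoˡ-≤ a b≥3 ⟩
      b * a           ≡⟨ ℕ.*-comm b a ⟩
      a * b ∎
      where open ℕ.≤-Reasoning

    chain′ : ∀ i → Quad (suc (i * 2 + k)) p q
    chain′ zero    = quadrangulation (seed-embedded s) status (ℕ.≤ᵇ⇒≤ _ _ room)
    chain′ (suc i) = quadrangulation (seed-embedded (seeds (suc i))) (inj₁ (proj₂ (grow-seed (seeds i))))
                       (product (ℕ.m≤m+n _ p) (large i {p} m≥3) (large i {q} n≥3))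

  chain : ∀ i → Quad (suc (k + i * 2)) p q
  chain i = subst (λ z → Quad (suc z) p q) (ℕ.+-comm (i * 2) k) (chain′ i)

points : ∀ k q → 3 ≤ k + q → Σ (Fin 3 → Side k q) λ f → ∀ {i j} → f i ≡ f j → i ≡ j
points k q le = (λ i → Fin.splitAt k (Fin.inject≤ i le)) , λ {i} {j} eq → Fin.inject≤-injective le le i j
  (trans (sym (Fin.join-splitAt k q _)) (trans (cong (Fin.join k q) eq) (Fin.join-splitAt k q _)))

module _ {t : ℕ} {β : Bool} {k c q : ℕ} (M : Embedded t true β k (suc c) q) where

  private
    raise′ : ∀ j → Embedded t true β k (suc (j * 2 + c)) q
    raise′ zero    = M
    raise′ (suc j) = triple (raise′ j)

    raise-twist′ : 3 ≤ k + q → ∀ j → Σ (Embedded t true β k (suc (suc j * 2 + c)) q) NonOrientable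
    raise-twist′ le j = let (f , inj) = points k q le in triple-twist f inj (raise′ j)

  raise : ∀ j → Embedded t true β k (suc (c + j * 2)) q
  raise j = subst (λ z → Embedded t true β k (suc z) q) (ℕ.+-comm (j * 2) c) (raise′ j)

  raise-twist : 3 ≤ k + q → ∀ j → Σ (Embedded t true β k (suc (c + suc j * 2)) q) NonOrientable
  raise-twist le j = subst (λ z → Σ (Embedded t true β k (suc z) q) NonOrientable) (ℕ.+-comm (suc j * 2) c) (raise-twist′ le j)

X-mono : ∀ k p p′ q → p ≤ p′ → X k p q ≤ X k p′ q
X-mono k p p′ q le = ℕ.*-monoˡ-≤ (k + q ∸ 2) (ℕ.∸-monoˡ-≤ 2 (ℕ.+-monoʳ-≤ k le))

transposeQ : ∀ {k p q} → Quad k p q → Quad k q p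
transposeQ {k} {p} {q} (quadrangulation M st room) = quadrangulation (transpose M)
  (Data.Sum.map (transpose-twisted M) (trans (ℕ.*-comm (k + q ∸ 2) _)) st) (subst (k ≤_) (ℕ.*-comm (k + p ∸ 2) _) room)

raiseP : ∀ {k c q} → 3 ≤ k + q → Quad k (suc c) q → ∀ j → Quad k (suc (c + j * 2)) q
raiseP {k} {c} {q} le Q zero = subst (λ z → Quad k (suc z) q) (sym (ℕ.+-identityʳ c)) Q
raiseP {k} {c} {q} le (quadrangulation M st room) (suc j) = let (M′ , tw) = raise-twist M le j in
  quadrangulation M′ (inj₁ tw) (ℕ.≤-trans room (X-mono k (suc c) _ q (s≤s (ℕ.m≤m+n c _))))

raiseQ : ∀ {k c p} → 3 ≤ k + p → Quad k p (suc c) → ∀ j → Quad k p (suc (c + j * 2))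
raiseQ le Q j = transposeQ (raiseP le (transposeQ Q) j)

raisePQ : ∀ {k c c′} → 3 ≤ k + suc c → 3 ≤ k + suc c′ → Quad k (suc c) (suc c′) → ∀ i j → Quad k (suc (c + i * 2)) (suc (c′ + j * 2))
raisePQ {k} {c} le le′ Q i j = raiseQ (ℕ.≤-trans le (ℕ.+-monoʳ-≤ k (s≤s (ℕ.m≤m+n c _)))) (raiseP le′ Q i) j

small : ∀ {n k} p → T (n ≤ᵇ k) → n ≤ k + p
small p t = ℕ.m≤n⇒m≤n+o p (ℕ.≤ᵇ⇒≤ _ _ t)

-- Only the first n faces are oriented in all ways, since the search grows exponentially with their
-- number.
decided : ∀ {A B : Set} {{_ : Eq A}} {{_ : Eq B}} {{_ : Finite A}} {{_ : Finite B}} n (L : List (Face A B)) →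
          T (unorientable (take n L)) → map (mapF id id) (take n L) ++ drop n L ≡ L → ¬ Coherent L
decided n L t eq = subst (¬_ ∘ Coherent) eq (unorientable-sound id id (take n L) t)

chain₄₀₀ : ∀ i → Quad (4 + i * 2) 0 0
chain₄₀₀ = chain seed₄₀₀ (inj₂ refl) tt tt tt

chain₆₀₁ : ∀ i → Quad (6 + i * 2) 0 1
chain₆₀₁ = chain seed₆₀₁ (inj₁ (decided 5 (Seed.faces seed₆₀₁) tt refl)) tt tt tt

chain₄₀₂ : ∀ i → Quad (4 + i * 2) 0 2
chain₄₀₂ = chain seed₄₀₂ (inj₁ (decided 5 (Seed.faces seed₄₀₂) tt refl)) tt tt tt

chain₂₁₂ : ∀ i → Quad (2 + i * 2) 1 2
chain₂₁₂ = chain seed₂₁₂ (inj₂ refl) tt tt tt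

chain₂₂₂ : ∀ i → Quad (2 + i * 2) 2 2
chain₂₂₂ = chain seed₂₂₂ (inj₁ (decided 5 (Seed.faces seed₂₂₂) tt refl)) tt tt tt

chain₇₀₀ : ∀ i → Quad (7 + i * 2) 0 0
chain₇₀₀ = chain seed₇₀₀ (inj₁ (decided 5 (Seed.faces seed₇₀₀) tt refl)) tt tt tt

chain₃₀₂ : ∀ i → Quad (3 + i * 2) 0 2
chain₃₀₂ = chain seed₃₀₂ (inj₂ refl) tt tt tt

chain₁₂₂ : ∀ i → Quad (1 + i * 2) 2 2
chain₁₂₂ = chain seed₁₂₂ (inj₂ refl) tt tt tt

-- Starting embeddings without a seed

free? : ∀ {k p} → Bool → Side k p → Bool
free? true (inj₂ zero) = false
free? _    _           = true

free-sound : ∀ {k p} α (x : Side k p) → T (free? α x) → Ok α x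
free-sound true  (inj₁ _)       t = tt
free-sound true  (inj₂ (suc _)) t = tt
free-sound false x              t = tt

simple? : ∀ {k p q} → Bool → Bool → Face (Side k p) (Side k q) → Bool
simple? α β f@(quad _ _ _ _)     = distinct? f
simple? α β (hexa a b c d e f) = (free? α a ∧ (free? α c ∧ free? α e)) ∧ (free? β b ∧ (free? β d ∧ free? β f))

simple-sound : ∀ {k p q} α β (L : List (Face (Side k p) (Side k q))) → T (all (simple? α β) L) → All (Simple (Ok α) (Ok β)) L
simple-sound α β [] t = []
simple-sound α β (f@(quad _ _ _ _) ∷ L) t =
  distinct-face f (T-∧₁ t) ∷ simple-sound α β L (T-∧₂ {distinct? f} t)
simple-sound α β (h@(hexa a b c d e f) ∷ L) t =
  (three α a c e (T-∧₁ {free? α a ∧ (free? α c ∧ free? α e)} u) , three β b d f (T-∧₂ {free? α a ∧ (free? α c ∧ free? α e)} u))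
  ∷ simple-sound α β L (T-∧₂ {simple? α β h} t)
  where
  u = T-∧₁ {simple? α β h} t
  three : ∀ {k p} α (x y z : Side k p) → T (free? α x ∧ (free? α y ∧ free? α z)) → Ok α x × Ok α y × Ok α z
  three α x y z t = free-sound α x (T-∧₁ t) , free-sound α y (T-∧₁ (T-∧₂ {free? α x} t)) , free-sound α z (T-∧₂ {free? α y} (T-∧₂ {free? α x} t))

free-vtx : ∀ {p} → ℕ → Side 0 (suc p)
free-vtx i = inj₂ (pick i)

K₂₂ : Embedded 0 true true 0 2 2
K₂₂ = embedded (table free-vtx free-vtx ((0 , 0 , 1 , 1) ∷ (0 , 0 , 1 , 1) ∷ [])) (check-sound 4 E _ tt) (simple-sound true true _ tt) refl

K₃₂ : Embedded 0 true true 0 3 2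
K₃₂ = embedded (table free-vtx free-vtx ((0 , 0 , 1 , 1) ∷ (0 , 0 , 2 , 1) ∷ (1 , 0 , 2 , 1) ∷ [])) (check-sound 4 E _ tt) (simple-sound true true _ tt) refl

-- Raising q by tripling would have to begin at the excluded (4, 0, 1), so this embedding is given
-- outright.
quad₄₀₃ : Quad 4 0 3
quad₄₀₃ = quadrangulation (embedded F (check-sound 4 E _ tt) (simple-sound true true _ tt) refl) (inj₁ (decided 3 F tt refl)) (ℕ.≤ᵇ⇒≤ 4 _ tt)
  where
  F : List (Face (Side 4 0) (Side 4 3))
  F = table vtx vtx ((0 , 2 , 1 , 6) ∷ (0 , 4 , 3 , 6) ∷ (1 , 2 , 3 , 4) ∷ (0 , 1 , 3 , 2) ∷ (0 , 1 , 2 , 3) ∷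
      (0 , 3 , 1 , 5) ∷ (0 , 5 , 2 , 4) ∷ (1 , 5 , 3 , 0) ∷ (1 , 0 , 2 , 4) ∷ (1 , 3 , 2 , 6) ∷
      (2 , 0 , 3 , 6) ∷ (2 , 1 , 3 , 5) ∷ [])

hexagon : ∀ {p q} → ℕ × ℕ × ℕ × ℕ × ℕ × ℕ → Face (Side 0 (suc p)) (Side 0 (suc q))
hexagon (a , b , c , d , e , f) = hexa (free-vtx a) (free-vtx b) (free-vtx c) (free-vtx d) (free-vtx e) (free-vtx f)

-- The hexagon meets every vertex and blocks tripling on both sides. Hence the separate starts
-- `K₃₅`, where the larger side can be tripled, and `K₅₅`, where both can.
K₃₃ : Σ (Embedded 1 false false 0 3 3) NonOrientable
K₃₃ = embedded F (check-sound 4 E _ tt) (simple-sound false false _ tt) refl , decided 2 F tt refl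
  where
  F : List (Face (Side 0 3) (Side 0 3))
  F = hexagon (0 , 0 , 1 , 1 , 2 , 2) ∷ table free-vtx free-vtx ((0 , 0 , 2 , 1) ∷ (0 , 1 , 1 , 2) ∷ (1 , 0 , 2 , 2) ∷ [])

K₃₅ : Σ (Embedded 1 false true 0 3 5) NonOrientable
K₃₅ = embedded F (check-sound 4 E _ tt) (simple-sound false true _ tt) refl , decided 2 F tt refl
  where
  F : List (Face (Side 0 3) (Side 0 5))
  F = hexagon (0 , 1 , 1 , 2 , 2 , 3) ∷ table free-vtx free-vtx
        ((0 , 2 , 1 , 3) ∷ (0 , 1 , 2 , 0) ∷ (2 , 2 , 0 , 4) ∷ (0 , 0 , 1 , 4) ∷ (1 , 0 , 2 , 3) ∷ (1 , 1 , 2 , 4) ∷ [])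

K₅₅ : Σ (Embedded 1 true true 0 5 5) NonOrientable
K₅₅ = embedded F (check-sound 4 E _ tt) (simple-sound true true _ tt) refl , decided 2 F tt refl
  where
  F : List (Face (Side 0 5) (Side 0 5))
  F = hexagon (1 , 1 , 2 , 2 , 3 , 3) ∷ table free-vtx free-vtx
        ((2 , 1 , 3 , 3) ∷ (1 , 1 , 4 , 2) ∷ (1 , 2 , 3 , 4) ∷ (1 , 3 , 4 , 0) ∷ (1 , 0 , 2 , 4) ∷ (2 , 2 , 0 , 0) ∷
         (0 , 2 , 4 , 4) ∷ (0 , 0 , 3 , 1) ∷ (0 , 4 , 2 , 3) ∷ (0 , 1 , 4 , 3) ∷ (3 , 0 , 4 , 4) ∷ [])

-- The case distinction by parity

parity : ℕ → Bool
parity zero    = false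
parity (suc n) = not (parity n)

-- Zero is kept apart from the other even numbers: tripling needs an unmatched vertex, and a seed
-- needs a deleted pair.
data Shape : ℕ → Bool → Set where
  none : Shape 0 false
  odd  : ∀ j → Shape (1 + j * 2) true
  even : ∀ j → Shape (2 + j * 2) false

shape : ∀ n → Shape n (parity n)
shape zero = none
shape (suc n) with parity n | shape n
... | _ | none   = odd 0
... | _ | odd j  = even j
... | _ | even j = odd (suc j)

-- In terms of the parities of k, p, q this says that mn - k is even, as a quadrangulation requires.
good : Bool → Bool → Bool → Bool
good false π θ = not (π ∧ θ)
good true  π θ = not π ∧ not θ

-- Besides the three excluded graphs this contains the six-cycle G_{3,3,3}: quadrilaterals on its
-- six edges would be three in number, giving Euler characteristic 3.
Exceptional : ℕ → ℕ → ℕ → Set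
Exceptional k p q = (k ≡ 3 × p ≡ 0 × q ≡ 0) ⊎ ((k ≡ 4 × p ≡ 0 × q ≡ 1) ⊎ ((k ≡ 4 × p ≡ 1 × q ≡ 0) ⊎ (k ≡ 5 × p ≡ 0 × q ≡ 0)))

-- K_{p,2} is a spherical quadrangulation; tripling one of its two vertices of degree p ≥ 3 yields
-- K_{p,4} and makes the surface non-orientable.
bipartite-even : ∀ {p π} → Shape p π → 3 ≤ p → ∀ j → Quad 0 p (4 + j * 2)
bipartite-even sh le j = let (M , tw) = raise-twist (transpose (base sh le)) le j in transposeQ (quadrangulation M (inj₁ tw) z≤n)
  where
  base : ∀ {p π} → Shape p π → 3 ≤ p → Embedded 0 true true 0 p 2
  base (odd zero) (s≤s ())
  base (odd (suc i)) _ = raise K₃₂ i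
  base (even i) _ = raise K₂₂ i

-- A chain of seeds reaches k, tripling then reaches p and q. Where p or q is 0 nothing can be
-- tripled on that side, so the patterns containing a zero have chains of their own.
quadrangulate : ∀ {k p q κ π θ} → Shape k κ → Shape p π → Shape q θ → T (good κ π θ) → 3 ≤ k + p → 3 ≤ k + q → ¬ Exceptional k p q → Quad k p q
quadrangulate none none _ _ () _ _
quadrangulate none (odd _) none _ _ () _
quadrangulate none (even _) none _ _ () _
quadrangulate none p (even zero) _ _ (s≤s (s≤s ())) _
quadrangulate none p@(odd _) (even (suc j)) _ le _ _ = bipartite-even p le j
quadrangulate none p@(even _) (even (suc j)) _ le _ _ = bipartite-even p le j
quadrangulate none (even zero) (odd _) _ (s≤s (s≤s ())) _ _
quadrangulate none (even (suc i)) q@(odd _) _ _ le _ = transposeQ (bipartite-even q le i)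
quadrangulate (odd zero) none none _ (s≤s ()) _ _
quadrangulate (odd 1) none none _ _ _ ex = contradiction (inj₁ (refl , refl , refl)) ex
quadrangulate (odd 2) none none _ _ _ ex = contradiction (inj₂ (inj₂ (inj₂ (refl , refl , refl)))) ex
quadrangulate (odd (suc (suc (suc i)))) none none _ _ _ _ = chain₇₀₀ i
quadrangulate (odd zero) none (even j) _ (s≤s ()) _ _
quadrangulate (odd (suc i)) none (even j) _ _ _ _ = raiseQ (small 0 tt) (chain₃₀₂ i) j
quadrangulate (odd zero) (even j) none _ _ (s≤s ()) _
quadrangulate (odd (suc i)) (even j) none _ _ _ _ = transposeQ (raiseQ (small 0 tt) (chain₃₀₂ i) j)
quadrangulate (odd i) (even j) (even l) _ _ _ _ = raisePQ (s≤s (ℕ.m≤n+m 2 (i * 2))) (s≤s (ℕ.m≤n+m 2 (i * 2))) (chain₁₂₂ i) j l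
quadrangulate (even zero) none _ _ (s≤s (s≤s ())) _ _
quadrangulate (even (suc i)) none none _ _ _ _ = chain₄₀₀ i
quadrangulate (even 1) none (odd zero) _ _ _ ex = contradiction (inj₂ (inj₁ (refl , refl , refl))) ex
quadrangulate (even 1) none (odd (suc j)) _ _ _ _ = raiseQ (small 0 tt) quad₄₀₃ j
quadrangulate (even (suc (suc i))) none (odd j) _ _ _ _ = raiseQ (small 0 tt) (chain₆₀₁ i) j
quadrangulate (even (suc i)) none (even j) _ _ _ _ = raiseQ (small 0 tt) (chain₄₀₂ i) j
quadrangulate (even zero) _ none _ _ (s≤s (s≤s ())) _
quadrangulate (even 1) (odd zero) none _ _ _ ex = contradiction (inj₂ (inj₂ (inj₁ (refl , refl , refl)))) ex
quadrangulate (even 1) (odd (suc j)) none _ _ _ _ = transposeQ (raiseQ (small 0 tt) quad₄₀₃ j)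
quadrangulate (even (suc (suc i))) (odd j) none _ _ _ _ = transposeQ (raiseQ (small 0 tt) (chain₆₀₁ i) j)
quadrangulate (even (suc i)) (even j) none _ _ _ _ = transposeQ (raiseQ (small 0 tt) (chain₄₀₂ i) j)
quadrangulate (even i) (odd j) (even l) _ _ _ _ = raisePQ (s≤s (s≤s (ℕ.m≤n+m 1 (i * 2)))) (s≤s (s≤s (ℕ.≤-trans (ℕ.n≤1+n 1) (ℕ.m≤n+m 2 (i * 2))))) (chain₂₁₂ i) j l
quadrangulate (even i) (even j) (odd l) _ _ _ _ = transposeQ (raisePQ (s≤s (s≤s (ℕ.m≤n+m 1 (i * 2)))) (s≤s (s≤s (ℕ.≤-trans (ℕ.n≤1+n 1) (ℕ.m≤n+m 2 (i * 2))))) (chain₂₁₂ i) l j)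
quadrangulate (even i) (even j) (even l) _ _ _ _ = raisePQ (s≤s (s≤s (ℕ.≤-trans (ℕ.n≤1+n 1) (ℕ.m≤n+m 2 (i * 2))))) (s≤s (s≤s (ℕ.≤-trans (ℕ.n≤1+n 1) (ℕ.m≤n+m 2 (i * 2))))) (chain₂₂₂ i) j l

-- A drawing with t hexagons and no other non-quadrilaterals has Euler genus (X + t ∸ k) / 2.
record Optimal (k p q : ℕ) : Set where
  constructor optimal
  field
    {t}     : ℕ
    drawn   : Drawing t k p q
    few     : t ≤ 1 ⊎ X k p q + t ≡ k
    status  : Twisted drawn ⊎ X k p q + t ≡ k
    room    : k ≤ X k p q + t

X-suc : ∀ k p q → X k (suc p) (suc q) ≡ X (suc k) p q
X-suc k p q = cong₂ (λ a b → (a ∸ 2) * (b ∸ 2)) (ℕ.+-suc k p) (ℕ.+-suc k q)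

from-quad : ∀ {k p q} → Quad k p q → Optimal k p q
from-quad {k} {p} {q} (quadrangulation (embedded F C si hx) st room) =
  optimal (drawing F C hx) (inj₁ z≤n) (Data.Sum.map id (trans (ℕ.+-identityʳ _)) st) (ℕ.≤-trans room (ℕ.m≤m+n _ 0))

-- Deleting an edge between unmatched vertices leaves m, n and hence X unchanged, and raises k and
-- the number of hexagons by one each; so the Euler genus stays the same.
from-deletion : ∀ {k p q} → Quad k (suc p) (suc q) → Optimal (suc k) p q
from-deletion {k} {p} {q} (quadrangulation M st room) with delete M
... | D , tw = optimal D (inj₁ ℕ.≤-refl) (Data.Sum.map tw (λ eq → trans (ℕ.+-comm _ 1) (cong suc (trans (sym (X-suc k p q)) eq))) st)
                 (subst (suc k ≤_) (trans (cong suc (X-suc k p q)) (ℕ.+-comm 1 _)) (s≤s room))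

from-hex : ∀ {α β p q} → Σ (Embedded 1 α β 0 p q) NonOrientable → Optimal 0 p q
from-hex (embedded F C si hx , tw) = optimal (drawing F C hx) (inj₁ ℕ.≤-refl) (inj₁ tw) z≤n

transpose-hex : ∀ {t α β k p q} → Σ (Embedded t α β k p q) NonOrientable → Σ (Embedded t β α k q p) NonOrientable
transpose-hex (M , tw) = transpose M , transpose-twisted M tw

raise-hex : ∀ {t β k c q} → 3 ≤ k + q → Σ (Embedded t true β k (suc c) q) NonOrientable → ∀ j → Σ (Embedded t true β k (suc (c + j * 2)) q) NonOrientable
raise-hex {t} {β} {k} {c} {q} le M zero = subst (λ z → Σ (Embedded t true β k (suc z) q) NonOrientable) (sym (ℕ.+-identityʳ c)) M
raise-hex le (M , _) (suc j) = raise-twist M le j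

hexagonal-bipartite : ∀ i j → Σ Bool λ α → Σ Bool λ β → Σ (Embedded 1 α β 0 (3 + i * 2) (3 + j * 2)) NonOrientable
hexagonal-bipartite zero    zero    = _ , _ , K₃₃
hexagonal-bipartite zero    (suc j) = _ , _ , transpose-hex (raise-hex (small 0 tt) (transpose-hex K₃₅) j)
hexagonal-bipartite (suc i) zero    = _ , _ , raise-hex (small 0 tt) (transpose-hex K₃₅) i
hexagonal-bipartite (suc i) (suc j) = _ , _ , transpose-hex (raise-hex (s≤s (s≤s (s≤s z≤n))) (transpose-hex (raise-hex (small 0 tt) K₅₅ i)) j)

-- A six-cycle on the sphere has two hexagonal faces. This is the drawing for which `few` and
-- `status` use their second alternative with t = 2.
G₃₃₃ : Optimal 3 0 0
G₃₃₃ = optimal {t = 2} (drawing F (check-sound 4 E _ tt) refl) (inj₂ refl) (inj₂ refl) ℕ.≤-refl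
  where
  v : ℕ → Side 3 0
  v = vtx
  F : List (Face (Side 3 0) (Side 3 0))
  F = hexa (v 0) (v 1) (v 2) (v 0) (v 1) (v 2) ∷ hexa (v 0) (v 1) (v 2) (v 0) (v 1) (v 2) ∷ []

odd-odd : ∀ {p q π θ} → Shape p π → Shape q θ → good false π θ ≡ false → 3 ≤ p → 3 ≤ q → Optimal 0 p q
odd-odd (odd zero)    (odd _)       _ (s≤s ()) _
odd-odd (odd (suc i)) (odd zero)    _ _ (s≤s ())
odd-odd (odd (suc i)) (odd (suc j)) _ _ _ = from-hex (proj₂ (proj₂ (hexagonal-bipartite i j)))

-- Putting one deleted edge back changes the parities of k, p and q all at once, and makes the
-- number of edges even.
flip-good : ∀ κ π θ → good (not κ) π θ ≡ false → T (good κ (not π) (not θ))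
flip-good true  true  true  eq = tt
flip-good false true  true  eq = tt
flip-good false true  false eq = tt
flip-good false false true  eq = tt

deletable : ∀ k {p q} → ¬ Exceptional k (suc p) (suc q)
deletable k (inj₁ (_ , () , _))
deletable k (inj₂ (inj₁ (_ , () , _)))
deletable k (inj₂ (inj₂ (inj₁ (_ , _ , ()))))
deletable k (inj₂ (inj₂ (inj₂ (_ , () , _))))

optimum : ∀ k p q → 3 ≤ k + p → 3 ≤ k + q → ¬ (k ≡ 4 × p ≡ 1 × q ≡ 0) → ¬ (k ≡ 4 × p ≡ 0 × q ≡ 1) → ¬ (k ≡ 5 × p ≡ 0 × q ≡ 0) → Optimal k p q
optimum k p q m≥3 n≥3 x y z with k ℕ.≟ 3 ×-dec (p ℕ.≟ 0 ×-dec q ℕ.≟ 0)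
... | yes (refl , refl , refl) = G₃₃₃
... | no w = go k m≥3 n≥3 ordinary
  where
  ordinary : ¬ Exceptional k p q
  ordinary (inj₁ e) = w e
  ordinary (inj₂ (inj₁ e)) = y e
  ordinary (inj₂ (inj₂ (inj₁ e))) = x e
  ordinary (inj₂ (inj₂ (inj₂ e))) = z e
  go : ∀ k → 3 ≤ k + p → 3 ≤ k + q → ¬ Exceptional k p q → Optimal k p q
  go k m≥3 n≥3 ex with good (parity k) (parity p) (parity q) in eq
  go k m≥3 n≥3 ex | true = from-quad (quadrangulate (shape k) (shape p) (shape q) (subst T (sym eq) tt) m≥3 n≥3 ex)
  go zero m≥3 n≥3 ex | false = odd-odd (shape p) (shape q) eq m≥3 n≥3
  go (suc k) m≥3 n≥3 ex | false = from-deletion (quadrangulate (shape k) (shape (suc p)) (shape (suc q)) (flip-good (parity k) (parity p) (parity q) eq)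
    (subst (3 ≤_) (sym (ℕ.+-suc k p)) m≥3) (subst (3 ≤_) (sym (ℕ.+-suc k q)) n≥3) (deletable k))

-- Counting sides

∑ : ∀ n → (Fin n → ℕ) → ℕ
∑ zero    f = 0
∑ (suc n) f = f zero + ∑ n (f ∘ suc)

∑-cong : ∀ n {f g : Fin n → ℕ} → (∀ i → f i ≡ g i) → ∑ n f ≡ ∑ n g
∑-cong zero    h = refl
∑-cong (suc n) h = cong₂ _+_ (h zero) (∑-cong n (h ∘ suc))

∑-+ : ∀ n (f g : Fin n → ℕ) → ∑ n (λ i → f i + g i) ≡ ∑ n f + ∑ n g
∑-+ zero    f g = refl
∑-+ (suc n) f g = trans (cong (f zero + g zero +_) (∑-+ n (f ∘ suc) (g ∘ suc))) (lemma (f zero) (g zero) _ _)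
  where
  lemma : ∀ p q r s → (p + q) + (r + s) ≡ (p + r) + (q + s)
  lemma = solve-∀

∑-* : ∀ n c (f : Fin n → ℕ) → ∑ n (λ i → f i * c) ≡ ∑ n f * c
∑-* zero    c f = refl
∑-* (suc n) c f = trans (cong (f zero * c +_) (∑-* n c (f ∘ suc))) (sym (ℕ.*-distribʳ-+ c (f zero) _))

∑-const : ∀ n c → ∑ n (λ _ → c) ≡ n * c
∑-const zero    c = refl
∑-const (suc n) c = cong (c +_) (∑-const n c)

∑-δ : ∀ n (a : Fin n) → ∑ n (λ x → δ x a) ≡ 1
∑-δ (suc n) zero    = cong suc (trans (∑-const n 0) (ℕ.*-zeroʳ n))
∑-δ (suc n) (suc a) = ∑-δ n a

total-occ : ∀ {m n l} (v : Vec (Fin m × Fin n) l) → ∑ m (λ a → ∑ n (λ b → occ a b v)) ≡ l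
total-occ {m} {n} [] = trans (∑-cong m (λ _ → trans (∑-const n 0) (ℕ.*-zeroʳ n))) (trans (∑-const m 0) (ℕ.*-zeroʳ m))
total-occ {m} {n} ((a , b) ∷ v) = begin
  ∑ m (λ x → ∑ n (λ y → δ x a * δ y b + occ x y v))
    ≡⟨ ∑-cong m (λ x → ∑-+ n _ _) ⟩
  ∑ m (λ x → ∑ n (λ y → δ x a * δ y b) + ∑ n (λ y → occ x y v))
    ≡⟨ ∑-+ m _ _ ⟩
  ∑ m (λ x → ∑ n (λ y → δ x a * δ y b)) + ∑ m (λ x → ∑ n (λ y → occ x y v))
    ≡⟨ cong₂ _+_ (trans (∑-cong m row) (∑-δ m a)) (total-occ v) ⟩
  suc _ ∎
  where
  open ≡-Reasoning
  row : ∀ x → ∑ n (λ y → δ x a * δ y b) ≡ δ x a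
  row x = trans (∑-cong n (λ y → ℕ.*-comm (δ x a) _)) (trans (∑-* n (δ x a) _) (trans (cong (_* δ x a) (∑-δ n b)) (ℕ.*-identityˡ _)))

-- The graph with a deleted matching and its genus

<ᵇ-true : ∀ {i n} → i < n → (i <ᵇ n) ≡ true
<ᵇ-true {i} {n} lt with i <ᵇ n | ℕ.<⇒<ᵇ lt
... | true | _ = refl

<ᵇ-false : ∀ {i n} → n ≤ i → (i <ᵇ n) ≡ false
<ᵇ-false {i} {n} le with i <ᵇ n in eq
... | false = refl
... | true  = contradiction (ℕ.<ᵇ⇒< i n (subst T (sym eq) tt)) (ℕ.≤⇒≯ le)

≡ᵇ-false : ∀ {i j} → i ≢ j → (i ≡ᵇ j) ≡ false
≡ᵇ-false {i} {j} ne with i ≡ᵇ j in eq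
... | false = refl
... | true  = contradiction (ℕ.≡ᵇ⇒≡ i j (subst T (sym eq) tt)) ne

≡ᵇ-refl : ∀ i → (i ≡ᵇ i) ≡ true
≡ᵇ-refl zero    = refl
≡ᵇ-refl (suc i) = ≡ᵇ-refl i

avoid : ∀ x y → ∃[ z ] (z < 3 × z ≢ x × z ≢ y)
avoid 0 0 = 1 , s≤s (s≤s z≤n) , (λ ()) , (λ ())
avoid 0 1 = 2 , s≤s (s≤s (s≤s z≤n)) , (λ ()) , (λ ())
avoid 0 (suc (suc y)) = 1 , s≤s (s≤s z≤n) , (λ ()) , (λ ())
avoid 1 0 = 2 , s≤s (s≤s (s≤s z≤n)) , (λ ()) , (λ ())
avoid (suc (suc x)) 0 = 1 , s≤s (s≤s z≤n) , (λ ()) , (λ ())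
avoid (suc x) (suc y) = 0 , s≤s z≤n , (λ ()) , (λ ())

module NearlyComplete (k p q : ℕ) (m≥3 : 3 ≤ k + p) (n≥3 : 3 ≤ k + q) where

  m n : ℕ
  m = k + p
  n = k + q

  G : Graph
  G = Gmnk m n k

  e : Fin m → Fin n → Bool
  e a b = not ((toℕ a <ᵇ k) ∧ (toℕ a ≡ᵇ toℕ b))

  Γ : Fin m → Fin n → ℕ
  Γ a b = if e a b then 1 else 0

  adj′ : Fin (m + n) → Fin (m + n) → Bool
  adj′ = adj G

  bip-left : ∀ (a : Fin m) y → bipAdj m k y (toℕ (a ↑ˡ n)) ≡ false
  bip-left a y rewrite Fin.toℕ-↑ˡ a n | <ᵇ-true (Fin.toℕ<n a) = ∧-zeroʳ (y <ᵇ m)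

  bip-right : ∀ (b : Fin n) y → bipAdj m k (toℕ (m ↑ʳ b)) y ≡ false
  bip-right b y rewrite Fin.toℕ-↑ʳ m b | <ᵇ-false (ℕ.m≤m+n m (toℕ b)) = refl

  bip-edge : ∀ a b → bipAdj m k (toℕ (a ↑ˡ n)) (toℕ (m ↑ʳ b)) ≡ e a b
  bip-edge a b rewrite Fin.toℕ-↑ˡ a n | Fin.toℕ-↑ʳ m b | <ᵇ-true (Fin.toℕ<n a) | <ᵇ-false (ℕ.m≤m+n m (toℕ b)) | ℕ.m+n∸m≡n m (toℕ b) = refl

  adj-ab : ∀ a b → adj′ (a ↑ˡ n) (m ↑ʳ b) ≡ e a b
  adj-ab a b = trans (cong₂ _∨_ (bip-edge a b) (bip-right b _)) (∨-identityʳ _)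

  adj-aa : ∀ a a′ → adj′ (a ↑ˡ n) (a′ ↑ˡ n) ≡ false
  adj-aa a a′ = cong₂ _∨_ (bip-left a′ _) (bip-left a _)

  adj-bb : ∀ b b′ → adj′ (m ↑ʳ b) (m ↑ʳ b′) ≡ false
  adj-bb b b′ = cong₂ _∨_ (bip-right b _) (bip-right b′ _)

  edge : ∀ {a b} → toℕ a ≢ toℕ b → T (e a b)
  edge {a} {b} ne = subst (T ∘ not) (sym (trans (cong ((toℕ a <ᵇ k) ∧_) (≡ᵇ-false ne)) (∧-zeroʳ _))) tt

  nbA₂ : ∀ a (b : Fin n) → ∃[ b′ ] (b′ ≢ b × T (e a b′))
  nbA₂ a b with avoid (toℕ a) (toℕ b)
  ... | z , lt , ne , ne′ = fromℕ< lt′ , (λ eq → ne′ (trans (sym (Fin.toℕ-fromℕ< lt′)) (cong toℕ eq))) , edge (λ eq → ne (sym (trans eq (Fin.toℕ-fromℕ< lt′))))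
    where lt′ = ℕ.≤-trans lt n≥3

  nbB₂ : ∀ b (a : Fin m) → ∃[ a′ ] (a′ ≢ a × T (e a′ b))
  nbB₂ b a with avoid (toℕ b) (toℕ a)
  ... | z , lt , ne , ne′ = fromℕ< lt′ , (λ eq → ne′ (trans (sym (Fin.toℕ-fromℕ< lt′)) (cong toℕ eq))) , edge (λ eq → ne (trans (sym (Fin.toℕ-fromℕ< lt′)) eq))
    where lt′ = ℕ.≤-trans lt m≥3

  nbA : ∀ a → ∃[ b ] T (e a b)
  nbA a = let (b , _ , t) = nbA₂ a (fromℕ< (ℕ.≤-trans (s≤s z≤n) n≥3)) in b , t

  nbB : ∀ b → ∃[ a ] T (e a b)
  nbB b = let (a , _ , t) = nbB₂ b (fromℕ< (ℕ.≤-trans (s≤s z≤n) m≥3)) in a , t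

  module Rel = Relabel (Fin.join k p) (splitAt k) (Fin.splitAt-join k p) (Fin.join-splitAt k p)
                       (Fin.join k q) (splitAt k) (Fin.splitAt-join k q) (Fin.join-splitAt k q)

  E-Γ : ∀ x y → E x y ≡ Γ (Fin.join k p x) (Fin.join k q y)
  E-Γ (inj₁ i) (inj₁ j) rewrite Fin.toℕ-↑ˡ i p | Fin.toℕ-↑ˡ j q | <ᵇ-true (Fin.toℕ<n i) with i Fin.≟ j
  ... | yes refl rewrite ≡ᵇ-refl (toℕ i) = refl
  ... | no ne rewrite ≡ᵇ-false (ne ∘ Fin.toℕ-injective) = refl
  E-Γ (inj₁ i) (inj₂ j) rewrite Fin.toℕ-↑ˡ i p | Fin.toℕ-↑ʳ k j
    | ≡ᵇ-false (ℕ.<⇒≢ (ℕ.≤-trans (Fin.toℕ<n i) (ℕ.m≤m+n k (toℕ j)))) | ∧-zeroʳ (toℕ i <ᵇ k) = refl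
  E-Γ (inj₂ i) y rewrite Fin.toℕ-↑ʳ k i | <ᵇ-false (ℕ.m≤m+n k (toℕ i)) = refl

  ∑-join : ∀ r (f : Fin (k + r) → ℕ) → ∑ (k + r) f ≡ ∑ k (f ∘ (_↑ˡ r)) + ∑ r (f ∘ (k ↑ʳ_))
  ∑-join r f = go k f
    where
    go : ∀ k (f : Fin (k + r) → ℕ) → ∑ (k + r) f ≡ ∑ k (f ∘ (_↑ˡ r)) + ∑ r (f ∘ (k ↑ʳ_))
    go zero    f = refl
    go (suc k) f = trans (cong (f zero +_) (go k (f ∘ suc))) (sym (ℕ.+-assoc (f zero) _ _))

  diagonal : ∀ k (i : Fin k) → ∑ k (λ j → if does (i Fin.≟ j) then 0 else 1) + 1 ≡ k
  diagonal (suc k) zero    = trans (ℕ.+-comm _ 1) (cong suc (trans (∑-const k 1) (ℕ.*-identityʳ k)))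
  diagonal (suc k) (suc i) = cong suc (diagonal k i)

  row-matched : ∀ i → ∑ n (Γ (i ↑ˡ p)) + 1 ≡ n
  row-matched i = begin
    ∑ n (Γ (i ↑ˡ p)) + 1
      ≡⟨ cong (_+ 1) (∑-join q (Γ (i ↑ˡ p))) ⟩
    (∑ k (λ j → Γ (i ↑ˡ p) (j ↑ˡ q)) + ∑ q (λ j → Γ (i ↑ˡ p) (k ↑ʳ j))) + 1
      ≡⟨ cong (_+ 1) (cong₂ _+_ (∑-cong k (λ j → sym (E-Γ (inj₁ i) (inj₁ j)))) (trans (∑-cong q (λ j → sym (E-Γ (inj₁ i) (inj₂ j)))) (trans (∑-const q 1) (ℕ.*-identityʳ q)))) ⟩
    (∑ k (λ j → if does (i Fin.≟ j) then 0 else 1) + q) + 1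
      ≡⟨ lemma (∑ k (λ j → if does (i Fin.≟ j) then 0 else 1)) q ⟩
    (∑ k (λ j → if does (i Fin.≟ j) then 0 else 1) + 1) + q
      ≡⟨ cong (_+ q) (diagonal k i) ⟩
    n ∎
    where
    open ≡-Reasoning
    lemma : ∀ x y → (x + y) + 1 ≡ (x + 1) + y
    lemma = solve-∀

  row-unmatched : ∀ j → ∑ n (Γ (k ↑ʳ j)) ≡ n
  row-unmatched j = trans (∑-cong n full) (trans (∑-const n 1) (ℕ.*-identityʳ n))
    where
    full : ∀ b → Γ (k ↑ʳ j) b ≡ 1
    full b rewrite Fin.toℕ-↑ʳ k j | <ᵇ-false (ℕ.m≤m+n k (toℕ j)) = refl

  edges : ∑ m (λ a → ∑ n (Γ a)) + k ≡ m * n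
  edges = begin
    ∑ m (λ a → ∑ n (Γ a)) + k
      ≡⟨ cong (_+ k) (∑-join p (λ a → ∑ n (Γ a))) ⟩
    (∑ k (λ i → ∑ n (Γ (i ↑ˡ p))) + ∑ p (λ j → ∑ n (Γ (k ↑ʳ j)))) + k
      ≡⟨ lemma (∑ k (λ i → ∑ n (Γ (i ↑ˡ p)))) _ k ⟩
    (∑ k (λ i → ∑ n (Γ (i ↑ˡ p))) + k) + ∑ p (λ j → ∑ n (Γ (k ↑ʳ j)))
      ≡⟨ cong₂ _+_ (trans (cong (∑ k (λ i → ∑ n (Γ (i ↑ˡ p))) +_) (sym (trans (∑-const k 1) (ℕ.*-identityʳ k)))) (sym (∑-+ k _ _))) (∑-cong p row-unmatched) ⟩
    ∑ k (λ i → ∑ n (Γ (i ↑ˡ p)) + 1) + ∑ p (λ _ → n)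
      ≡⟨ cong₂ _+_ (trans (∑-cong k row-matched) (∑-const k n)) (∑-const p n) ⟩
    k * n + p * n
      ≡⟨ sym (ℕ.*-distribʳ-+ n k p) ⟩
    m * n ∎
    where
    open ≡-Reasoning
    lemma : ∀ x y z → (x + y) + z ≡ (x + z) + y
    lemma = solve-∀

  module Drawn {t : ℕ} (D : Drawing t k p q) where

    L : List (Face (Fin m) (Fin n))
    L = Rel.relabel (Drawing.faces D)

    C : Cert Γ L
    C = Rel.relabel-Cert (Cert-cong E-Γ (Drawing.cert D))

    open Build m n e adj′ (adj-sym G) adj-ab adj-aa adj-bb nbA nbB L C public hiding (G)

    size-edges : size L + 2 * k ≡ 2 * (m * n)
    size-edges = begin
      size L + 2 * k                                                        ≡⟨ cong (_+ 2 * k) (sym (total-occ (sideVec L))) ⟩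
      ∑ m (λ a → ∑ n (λ b → occ a b (sideVec L))) + 2 * k                   ≡⟨ cong (_+ 2 * k) (∑-cong m (λ a → ∑-cong n (λ b → trans (sym (occ-cnt L a b)) (Cert.count C a b)))) ⟩
      ∑ m (λ a → ∑ n (λ b → Γ a b + Γ a b)) + 2 * k                         ≡⟨ cong (_+ 2 * k) (trans (∑-cong m (λ a → ∑-+ n (Γ a) (Γ a))) (∑-+ m _ _)) ⟩
      (∑ m (λ a → ∑ n (Γ a)) + ∑ m (λ a → ∑ n (Γ a))) + 2 * k               ≡⟨ lemma (∑ m (λ a → ∑ n (Γ a))) k ⟩
      2 * (∑ m (λ a → ∑ n (Γ a)) + k)                                       ≡⟨ cong (2 *_) edges ⟩
      2 * (m * n) ∎
      where
      open ≡-Reasoning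
      lemma : ∀ x y → (x + x) + 2 * y ≡ 2 * (x + y)
      lemma = solve-∀

    size-faces : size L ≡ 4 * length L + 2 * t
    size-faces = trans (go L) (cong (λ z → 4 * length L + 2 * z) (trans (hexes-map′ (Drawing.faces D)) (Drawing.hexagonal D)))
      where
      hexes-map′ : ∀ K → hexes (Rel.relabel K) ≡ hexes K
      hexes-map′ []                     = refl
      hexes-map′ (quad _ _ _ _ ∷ K)     = hexes-map′ K
      hexes-map′ (hexa _ _ _ _ _ _ ∷ K) = cong suc (hexes-map′ K)
      go : ∀ {A B : Set} (K : List (Face A B)) → size K ≡ 4 * length K + 2 * hexes K
      go [] = refl
      go (quad _ _ _ _ ∷ K) = trans (cong (4 +_) (go K)) (lemma (length K) (hexes K))
        where
        lemma : ∀ x y → 4 + (4 * x + 2 * y) ≡ 4 * suc x + 2 * y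
        lemma = solve-∀
      go (hexa _ _ _ _ _ _ ∷ K) = trans (cong (6 +_) (go K)) (lemma (length K) (hexes K))
        where
        lemma : ∀ x y → 6 + (4 * x + 2 * y) ≡ 4 * suc x + 2 * suc y
        lemma = solve-∀

    side : Fin (m + n) → Bool
    side u = is-left (splitAt m u)
      where
      is-left : Fin m ⊎ Fin n → Bool
      is-left (inj₁ _) = true
      is-left (inj₂ _) = false

    bipartite : ∀ u w → T (adj′ u w) → side w ≡ not (side u)
    bipartite u w t = go (end m n u) (end m n w) t
      where
      go : ∀ {u w} → End m n u → End m n w → T (adj′ u w) → side w ≡ not (side u)
      go (left a)  (left a′)  t = ⊥-elim (subst T (adj-aa a a′) t)
      go (right b) (right b′) t = ⊥-elim (subst T (adj-bb b b′) t)
      go (left a)  (right b)  t rewrite Fin.splitAt-↑ˡ m a n | Fin.splitAt-↑ʳ m n b = refl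
      go (right b) (left a)   t rewrite Fin.splitAt-↑ˡ m a n | Fin.splitAt-↑ʳ m n b = refl

    branch : ∀ (d : Dart G) → ∃[ d′ ] (src G d′ ≡ src G d × d′ ≢ d)
    branch ((u , w) , t) = go (end m n u) (end m n w) t
      where
      go : ∀ {u w} → End m n u → End m n w → (t : T (adj′ u w)) → Σ (Dart G) λ d′ → src G d′ ≡ u × d′ ≢ ((u , w) , t)
      go (left a)  (left a′)  t = ⊥-elim (subst T (adj-aa a a′) t)
      go (right b) (right b′) t = ⊥-elim (subst T (adj-bb b b′) t)
      go (left a)  (right b)  t with nbA₂ a b
      ... | b′ , ne , t′ = ((a ↑ˡ n , m ↑ʳ b′) , subst T (sym (adj-ab a b′)) t′) , refl ,
            λ eq → ne (Fin.↑ʳ-injective m _ _ (cong (proj₂ ∘ proj₁) eq))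
      go (right b) (left a)   t with nbB₂ b a
      ... | a′ , ne , t′ = ((m ↑ʳ b , a′ ↑ˡ n) , subst T (trans (sym (adj-ab a′ b)) (adj-sym G (a′ ↑ˡ n) (m ↑ʳ b))) t′) , refl ,
            λ eq → ne (Fin.↑ˡ-injective n _ _ (cong (proj₂ ∘ proj₁) eq))

    -- Euler's formula combined with four states on each facial orbit. In the chain `2 * d` is
    -- subtracted at the end only, so that all steps stay within the natural numbers.
    lower : ∀ R g → EulerGenus G R g → 4 + m * n ≤ 2 * (m + n) + k + 2 * g
    lower R g (d , c , card , orb , euler) = ℕ.*-cancelˡ-≤ 4 (begin
      4 * (4 + m * n)                            ≡⟨ l₁ (m * n) ⟩
      16 + 2 * (2 * (m * n))                     ≡⟨ cong (λ z → 16 + 2 * z) (sym (trans (cong (_+ 2 * k) d≡) size-edges)) ⟩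
      16 + 2 * (d + 2 * k)                       ≡⟨ l₂ d k ⟩
      (4 * (4 + d) + 4 * k) ∸ 2 * d              ≡⟨ cong (λ z → (4 * z + 4 * k) ∸ 2 * d) (sym euler) ⟩
      (4 * (2 * (m + n) + c + 2 * g) + 4 * k) ∸ 2 * d   ≤⟨ ℕ.∸-monoˡ-≤ (2 * d) (ℕ.≤-reflexive (l₃ (m + n) c g k)) ⟩
      (4 * (2 * (m + n) + k + 2 * g) + c * 4) ∸ 2 * d   ≤⟨ ℕ.∸-monoˡ-≤ (2 * d) (ℕ.+-monoʳ-≤ (4 * (2 * (m + n) + k + 2 * g)) (ℕ.≤-trans FL (ℕ.≤-reflexive (ℕ.*-comm d 2)))) ⟩
      (4 * (2 * (m + n) + k + 2 * g) + 2 * d) ∸ 2 * d   ≡⟨ ℕ.m+n∸n≡m _ (2 * d) ⟩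
      4 * (2 * (m + n) + k + 2 * g) ∎)
      where
      open ℕ.≤-Reasoning
      d≡ : d ≡ size L
      -- The sides of the drawing count the darts of the graph, so every rotation system of the
      -- graph has this same number.
      d≡ = ↔⇒≡ (darts ↔-∘ ↔-sym card)
      FL : c * 4 ≤ d * 2
      FL = FaceLength.orbits≤ G side bipartite branch R card orb
      l₁ : ∀ x → 4 * (4 + x) ≡ 16 + 2 * (2 * x)
      l₁ = solve-∀
      l₂ : ∀ d k → 16 + 2 * (d + 2 * k) ≡ (4 * (4 + d) + 4 * k) ∸ 2 * d
      l₂ d k = sym (trans (cong (_∸ 2 * d) (eq d k)) (ℕ.m+n∸n≡m _ (2 * d)))
        where
        eq : ∀ d k → 4 * (4 + d) + 4 * k ≡ (16 + 2 * (d + 2 * k)) + 2 * d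
        eq = solve-∀
      l₃ : ∀ v c g k → 4 * (2 * v + c + 2 * g) + 4 * k ≡ 4 * (2 * v + k + 2 * g) + c * 4
      l₃ = solve-∀

  X-formula : m * n + 4 ≡ X k p q + 2 * (m + n)
  X-formula = subst₂ (λ a b → a * b + 4 ≡ X k p q + 2 * (a + b)) (ℕ.m+[n∸m]≡n (ℕ.≤-trans (ℕ.n≤1+n 2) m≥3)) (ℕ.m+[n∸m]≡n (ℕ.≤-trans (ℕ.n≤1+n 2) n≥3)) (lemma (m ∸ 2) (n ∸ 2))
    where
    lemma : ∀ a b → (2 + a) * (2 + b) + 4 ≡ a * b + 2 * ((2 + a) + (2 + b))
    lemma = solve-∀

  double : ∀ x → 2 * x ≡ x + x
  double x = cong (x +_) (ℕ.+-identityʳ x)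

  genus : Optimal k p q → NonorientableGenus G (⌈ X k p q ∸ k /2⌉ ⊔ 1)
  genus (optimal {t} D few status room) = ℕ.m≤n⊔m _ 1 , embeds g h euler how , minimal
    where
    open Drawn D
    h F g : ℕ
    h = ⌈ X k p q ∸ k /2⌉ ⊔ 1
    F = length L
    -- Euler's formula V - E + F = 2 - g, where E = 2F + t because a hexagon has two sides more than
    -- a quadrilateral.
    g = F + t + 2 ∸ (m + n)
    faces-edges : 2 * F + t + k ≡ m * n
    faces-edges = ℕ.*-cancelˡ-≡ _ _ 2 (trans (trans (lemma F t k) (cong (_+ 2 * k) (sym size-faces))) size-edges)
      where
      lemma : ∀ F t k → 2 * (2 * F + t + k) ≡ (4 * F + 2 * t) + 2 * k
      lemma = solve-∀
    balance : 2 * (F + t + 2) + k ≡ (X k p q + t) + 2 * (m + n)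
    balance = begin
      2 * (F + t + 2) + k          ≡⟨ l₁ F t k ⟩
      (2 * F + t + k + 4) + t      ≡⟨ cong (λ z → (z + 4) + t) faces-edges ⟩
      (m * n + 4) + t              ≡⟨ cong (_+ t) X-formula ⟩
      (X k p q + 2 * (m + n)) + t  ≡⟨ l₂ (X k p q) (2 * (m + n)) t ⟩
      (X k p q + t) + 2 * (m + n) ∎
      where
      open ≡-Reasoning
      l₁ : ∀ F t k → 2 * (F + t + 2) + k ≡ (2 * F + t + k + 4) + t
      l₁ = solve-∀
      l₂ : ∀ x y z → (x + y) + z ≡ (x + z) + y
      l₂ = solve-∀
    V≤ : m + n ≤ F + t + 2
    V≤ = ℕ.*-cancelˡ-≤ 2 (ℕ.+-cancelʳ-≤ k _ _ (begin
      2 * (m + n) + k              ≤⟨ ℕ.+-monoʳ-≤ (2 * (m + n)) room ⟩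
      2 * (m + n) + (X k p q + t)  ≡⟨ ℕ.+-comm (2 * (m + n)) _ ⟩
      (X k p q + t) + 2 * (m + n)  ≡⟨ sym balance ⟩
      2 * (F + t + 2) + k ∎))
      where open ℕ.≤-Reasoning
    g-eq : (m + n) + g ≡ F + t + 2
    g-eq = ℕ.m+[n∸m]≡n V≤
    euler : 2 * (m + n) + F * 2 + 2 * g ≡ 4 + size L
    euler = begin
      2 * (m + n) + F * 2 + 2 * g    ≡⟨ l₁ (m + n) F g ⟩
      2 * ((m + n) + g) + 2 * F      ≡⟨ cong (λ z → 2 * z + 2 * F) g-eq ⟩
      2 * (F + t + 2) + 2 * F        ≡⟨ l₂ F t ⟩
      4 + (4 * F + 2 * t)            ≡⟨ cong (4 +_) (sym size-faces) ⟩
      4 + size L ∎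
      where
      open ≡-Reasoning
      l₁ : ∀ v F g → 2 * v + F * 2 + 2 * g ≡ 2 * (v + g) + 2 * F
      l₁ = solve-∀
      l₂ : ∀ F t → 2 * (F + t + 2) + 2 * F ≡ 4 + (4 * F + 2 * t)
      l₂ = solve-∀
    twice-g : 2 * g + k ≡ X k p q + t
    twice-g = ℕ.+-cancelʳ-≡ (2 * (m + n)) _ _ (begin
      (2 * g + k) + 2 * (m + n)    ≡⟨ l₁ g k (m + n) ⟩
      2 * ((m + n) + g) + k        ≡⟨ cong (λ z → 2 * z + k) g-eq ⟩
      2 * (F + t + 2) + k          ≡⟨ balance ⟩
      (X k p q + t) + 2 * (m + n) ∎)
      where
      open ≡-Reasoning
      l₁ : ∀ g k v → (2 * g + k) + 2 * v ≡ 2 * (v + g) + k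
      l₁ = solve-∀
    flat : X k p q + t ≡ k → g ≡ 0
    flat eq = ℕ.*-cancelˡ-≡ g 0 2 (ℕ.+-cancelʳ-≡ k _ 0 (trans twice-g eq))
    g≤h : t ≤ 1 ⊎ X k p q + t ≡ k → g ≤ h
    g≤h (inj₂ eq) = subst (_≤ h) (sym (flat eq)) z≤n
    -- One hexagon costs no more than the rounding: 2g = X + t - k is at most X - k + 1, and half of
    -- that rounded down is the half of X - k rounded up.
    g≤h (inj₁ t≤1) = ℕ.≤-trans (ℕ.≤-trans (ℕ.≤-reflexive (ℕ.n≡⌊n+n/2⌋ g)) (ℕ.⌊n/2⌋-mono (begin
      g + g                     ≡⟨ sym (double g) ⟩
      2 * g                     ≡⟨ sym (ℕ.m+n∸n≡m (2 * g) k) ⟩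
      2 * g + k ∸ k             ≡⟨ cong (_∸ k) twice-g ⟩
      X k p q + t ∸ k           ≤⟨ ℕ.∸-monoˡ-≤ k (ℕ.≤-trans (ℕ.+-monoʳ-≤ (X k p q) t≤1) (ℕ.≤-reflexive (ℕ.+-comm (X k p q) 1))) ⟩
      suc (X k p q) ∸ k         ≤⟨ suc-∸ (X k p q) k ⟩
      suc (X k p q ∸ k) ∎))) (ℕ.m≤m⊔n _ 1)
      where
      open ℕ.≤-Reasoning
      suc-∸ : ∀ x k → suc x ∸ k ≤ suc (x ∸ k)
      suc-∸ x zero          = ℕ.≤-refl
      suc-∸ zero (suc k)    = ℕ.≤-trans (ℕ.m∸n≤m 0 k) z≤n
      suc-∸ (suc x) (suc k) = suc-∸ x k
    how : (¬ Coherent L × g ≤ h) ⊎ g < h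
    how = Data.Sum.map (λ tw → tw ∘ Rel.relabel-Coherent (Drawing.faces D) , g≤h few)
                       -- On the sphere g = 0 is below h because of the maximum with 1.
                       (λ eq → subst (_< h) (sym (flat eq)) (ℕ.m≤n⊔m _ 1)) status
    bound : ∀ R g → EulerGenus G R g → ⌈ X k p q ∸ k /2⌉ ≤ g
    bound R g eg = ℕ.≤-trans (ℕ.⌈n/2⌉-mono (begin
      X k p q ∸ k        ≤⟨ ℕ.∸-monoˡ-≤ k X≤ ⟩
      (g + g) + k ∸ k    ≡⟨ ℕ.m+n∸n≡m (g + g) k ⟩
      g + g ∎)) (ℕ.≤-reflexive (sym (ℕ.n≡⌈n+n/2⌉ g)))
      where
      open ℕ.≤-Reasoning
      X≤ : X k p q ≤ (g + g) + k
      X≤ = ℕ.+-cancelʳ-≤ (2 * (m + n)) _ _ (begin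
        X k p q + 2 * (m + n)        ≡⟨ sym X-formula ⟩
        m * n + 4                    ≡⟨ ℕ.+-comm (m * n) 4 ⟩
        4 + m * n                    ≤⟨ lower R g eg ⟩
        2 * (m + n) + k + 2 * g      ≡⟨ lemma (m + n) k g ⟩
        ((g + g) + k) + 2 * (m + n) ∎)
        where
        lemma : ∀ v k g → 2 * v + k + 2 * g ≡ ((g + g) + k) + 2 * v
        lemma = solve-∀
    minimal : ∀ h′ → 1 ≤ h′ → h′ < h → ¬ EmbedsInN G h′
    minimal h′ 1≤h′ h′<h (R , g′ , eg , how′) = ℕ.<⇒≱ h′<h (ℕ.⊔-lub (ℕ.≤-trans (bound R g′ eg) (g′≤h′ how′)) 1≤h′)
      where
      g′≤h′ : (¬ Orientable G R × g′ ≤ h′) ⊎ (Orientable G R × g′ < h′) → g′ ≤ h′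
      g′≤h′ (inj₁ (_ , le)) = le
      g′≤h′ (inj₂ (_ , lt)) = ℕ.<⇒≤ lt

nearly-complete : ∀ m n k → 3 ≤ m → 3 ≤ n → k ≤ m → k ≤ n →
  ¬ (m ≡ 5 × n ≡ 4 × k ≡ 4) → ¬ (m ≡ 4 × n ≡ 5 × k ≡ 4) → ¬ (m ≡ 5 × n ≡ 5 × k ≡ 5) →
  NonorientableGenus (Gmnk m n k) (⌈ (m ∸ 2) * (n ∸ 2) ∸ k /2⌉ ⊔ 1)
nearly-complete m n k m≥3 n≥3 k≤m k≤n x y z =
  subst₂ (λ m n → NonorientableGenus (Gmnk m n k) (⌈ (m ∸ 2) * (n ∸ 2) ∸ k /2⌉ ⊔ 1)) em en
    (NearlyComplete.genus k p q m≥3′ n≥3′ (optimum k p q m≥3′ n≥3′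
      (λ (a , b , c) → x (add-up em a b , add-up en a c , a))
      (λ (a , b , c) → y (add-up em a b , add-up en a c , a))
      (λ (a , b , c) → z (add-up em a b , add-up en a c , a))))
  where
  p q : ℕ
  p = m ∸ k
  q = n ∸ k
  em : k + p ≡ m
  em = ℕ.m+[n∸m]≡n k≤m
  en : k + q ≡ n
  en = ℕ.m+[n∸m]≡n k≤n
  m≥3′ : 3 ≤ k + p
  m≥3′ = subst (3 ≤_) (sym em) m≥3
  n≥3′ : 3 ≤ k + q
  n≥3′ = subst (3 ≤_) (sym en) n≥3
  add-up : ∀ {a b k′ p′} → k + a ≡ b → k ≡ k′ → a ≡ p′ → b ≡ k′ + p′
  add-up refl refl refl = refl

-- Closed formulas for the two special families

half : ∀ {x} h → x ≡ h + h → ⌈ x /2⌉ ≡ x / 2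
half h refl = trans (sym (ℕ.n≡⌈n+n/2⌉ h)) (sym (trans (cong (_/ 2) (trans (cong (h +_) (sym (ℕ.+-identityʳ h))) (ℕ.*-comm 2 h))) (ℕ.m*n/n≡m h 2)))

⊔1 : ∀ x {y} → x ≡ suc (suc y) → ⌈ x /2⌉ ⊔ 1 ≡ ⌈ x /2⌉
⊔1 _ refl = ℕ.m≥n⇒m⊔n≡m (s≤s z≤n)

cancel : ∀ {a b c} → a ≡ c + b → a ∸ b ≡ c
cancel {b = b} {c} refl = ℕ.m+n∸n≡m c b

square : ∀ n → 6 ≤ n → NonorientableGenus (Gmnk n n n) ⌈ (n ∸ 2) * (n ∸ 2) ∸ n /2⌉
                     × ⌈ (n ∸ 2) * (n ∸ 2) ∸ n /2⌉ ≡ (n * n + 4 ∸ 5 * n) / 2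
square n n≥6 with ℕ.m≤n⇒∃[o]m+o≡n n≥6
... | j , refl =
  subst (NonorientableGenus (Gmnk n n n)) (⊔1 _ {8 + (7 * j + j * j)} value)
    (nearly-complete n n n 3≤n 3≤n ℕ.≤-refl ℕ.≤-refl (λ { (() , _) }) (λ { (() , _) }) (λ { (() , _) })) ,
  trans (trans (cong ⌈_/2⌉ value) (half (5 + proj₁ (triangle j)) evenness)) (cong (_/ 2) (sym value′))
  where
  3≤n : 3 ≤ 6 + j
  3≤n = s≤s (s≤s (s≤s z≤n))
  value : (4 + j) * (4 + j) ∸ (6 + j) ≡ 10 + (7 * j + j * j)
  value = cancel (lemma j)
    where
    lemma : ∀ j → (4 + j) * (4 + j) ≡ (10 + (7 * j + j * j)) + (6 + j)
    lemma = solve-∀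
  value′ : (6 + j) * (6 + j) + 4 ∸ 5 * (6 + j) ≡ 10 + (7 * j + j * j)
  value′ = cancel (lemma j)
    where
    lemma : ∀ j → (6 + j) * (6 + j) + 4 ≡ (10 + (7 * j + j * j)) + 5 * (6 + j)
    lemma = solve-∀
  -- j(j + 7) is even, and half of it grows by j + 4 at each step.
  triangle : ∀ j → ∃[ h ] 7 * j + j * j ≡ h + h
  triangle zero    = 0 , refl
  triangle (suc j) with triangle j
  ... | h , eq = h + (4 + j) , trans (l₁ j) (trans (cong (_+ (8 + 2 * j)) eq) (l₂ h j))
    where
    l₁ : ∀ j → 7 * suc j + suc j * suc j ≡ (7 * j + j * j) + (8 + 2 * j)
    l₁ = solve-∀
    l₂ : ∀ h j → (h + h) + (8 + 2 * j) ≡ (h + (4 + j)) + (h + (4 + j))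
    l₂ = solve-∀
  evenness : 10 + (7 * j + j * j) ≡ (5 + proj₁ (triangle j)) + (5 + proj₁ (triangle j))
  evenness = trans (cong (10 +_) (proj₂ (triangle j))) (lemma (proj₁ (triangle j)))
    where
    lemma : ∀ h → 10 + (h + h) ≡ (5 + h) + (5 + h)
    lemma = solve-∀

near-square : ∀ n → 6 ≤ n → n % 2 ≡ 0 → NonorientableGenus (Gmnk (n + 1) n n) ⌈ (n ∸ 1) * (n ∸ 2) ∸ n /2⌉
                                      × ⌈ (n ∸ 1) * (n ∸ 2) ∸ n /2⌉ ≡ (n * n + 2 ∸ 4 * n) / 2
near-square n n≥6 n%2 with ℕ.m≤n⇒∃[o]m+o≡n n≥6
... | j , refl =
  subst (NonorientableGenus (Gmnk (n + 1) n n)) (trans (⊔1 _ {12 + (8 * j + j * j)} value″) (cong ⌈_/2⌉ (trans value″ (sym value))))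
    (nearly-complete (n + 1) n n (s≤s (s≤s (s≤s z≤n))) (s≤s (s≤s (s≤s z≤n))) (ℕ.m≤m+n n 1) ℕ.≤-refl (λ { (() , _) }) (λ { (() , _) }) (λ { (() , _) })) ,
  trans (cong ⌈_/2⌉ value) (trans (half (7 + (8 * i + 2 * (i * i))) evenness) (cong (_/ 2) (sym value′)))
  where
  value : (5 + j) * (4 + j) ∸ (6 + j) ≡ 14 + (8 * j + j * j)
  value = cancel (lemma j)
    where
    lemma : ∀ j → (5 + j) * (4 + j) ≡ (14 + (8 * j + j * j)) + (6 + j)
    lemma = solve-∀
  value″ : (4 + (j + 1)) * (4 + j) ∸ (6 + j) ≡ 14 + (8 * j + j * j)
  value″ = cancel (lemma j)
    where
    lemma : ∀ j → (4 + (j + 1)) * (4 + j) ≡ (14 + (8 * j + j * j)) + (6 + j)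
    lemma = solve-∀
  value′ : (6 + j) * (6 + j) + 2 ∸ 4 * (6 + j) ≡ 14 + (8 * j + j * j)
  value′ = cancel (lemma j)
    where
    lemma : ∀ j → (6 + j) * (6 + j) + 2 ≡ (14 + (8 * j + j * j)) + 4 * (6 + j)
    lemma = solve-∀
  i : ℕ
  -- Evenness of n = 6 + j is used in the form j = 2i.
  i = (6 + j) / 2 ∸ 3
  j≡ : j ≡ i * 2
  j≡ = begin
    j                        ≡⟨⟩
    6 + j ∸ 6                ≡⟨ cong (_∸ 6) (trans (ℕ.m≡m%n+[m/n]*n (6 + j) 2) (cong (_+ (6 + j) / 2 * 2) n%2)) ⟩
    (6 + j) / 2 * 2 ∸ 3 * 2  ≡⟨ sym (ℕ.*-distribʳ-∸ 2 ((6 + j) / 2) 3) ⟩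
    i * 2 ∎
    where open ≡-Reasoning
  evenness : 14 + (8 * j + j * j) ≡ (7 + (8 * i + 2 * (i * i))) + (7 + (8 * i + 2 * (i * i)))
  evenness = trans (cong (λ j → 14 + (8 * j + j * j)) j≡) (lemma i)
    where
    lemma : ∀ i → 14 + (8 * (i * 2) + i * 2 * (i * 2)) ≡ (7 + (8 * i + 2 * (i * i))) + (7 + (8 * i + 2 * (i * i)))
    lemma = solve-∀

theorem2 : (∀ m n k → 3 ≤ m → 3 ≤ n → k ≤ m → k ≤ n →
    ¬ (m ≡ 5 × n ≡ 4 × k ≡ 4) → ¬ (m ≡ 4 × n ≡ 5 × k ≡ 4) → ¬ (m ≡ 5 × n ≡ 5 × k ≡ 5) →
    NonorientableGenus (Gmnk m n k) (⌈ (m ∸ 2) * (n ∸ 2) ∸ k /2⌉ ⊔ 1))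
    × (∀ n → 6 ≤ n →
    NonorientableGenus (Gmnk n n n) ⌈ (n ∸ 2) * (n ∸ 2) ∸ n /2⌉
    × ⌈ (n ∸ 2) * (n ∸ 2) ∸ n /2⌉ ≡ (n * n + 4 ∸ 5 * n) / 2)
    × (∀ n → 6 ≤ n → n % 2 ≡ 0 →
    NonorientableGenus (Gmnk (n + 1) n n) ⌈ (n ∸ 1) * (n ∸ 2) ∸ n /2⌉
    × ⌈ (n ∸ 1) * (n ∸ 2) ∸ n /2⌉ ≡ (n * n + 2 ∸ 4 * n) / 2)
theorem2 = nearly-complete , square , near-square
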